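{- For every $\epsilon>0$, \texttt{CleverMaker} has a strategy in the $(1:(1-\epsilon)n)$ half-random perfect matching game on $E(K_n)$ against \texttt{RandomBreaker} which, asymptotically almost surely (i.e. with probability tending to $1$ as $n\to\infty$), is winning within $\frac{n}{2}+O(\log n)$ moves of \texttt{CleverMaker}. In particular, the sharp threshold bias for both the $(1:b)$ half-random perfect matching game and the $(1:b)$ half-random minimum-degree-$1$ game between \texttt{CleverMaker} and \texttt{RandomBreaker} is $n$.
   Context: Maker-Breaker games on the board $E(K_n)$: two players alternately claim previously unclaimed (free) edges of the complete graph $K_n$; in a $(1:b)$-biased game Maker claims $1$ edge per turn and Breaker claims $b$ edges per turn, Maker moves first. Maker wins if his graph contains a member of the winning family, otherwise Breaker wins. The perfect matching game: Maker wins if his graph contains a perfect matching of $K_n$. The minimum-degree-$1$ game: Maker wins if his graph has minimum degree at least $1$ on all $n$ vertices. In the half-random game between \texttt{CleverMaker} and \texttt{RandomBreaker}, Breaker (\texttt{RandomBreaker}) claims in each of her moves an edge chosen uniformly at random among all currently free edges, while Maker (\texttt{CleverMaker}) follows a (deterministic) strategy of his choice. A function $k:\mathbb{N}_0\to\mathbb{N}_0$ is a sharp threshold bias of the $(1:b)$ half-random game if for every $\epsilon>0$: (a) \texttt{RandomBreaker} wins the $(1:(1+\epsilon)k(n))$ game with probability tending to $1$ against any strategy of \texttt{CleverMaker}, and (b) \texttt{CleverMaker} has a strategy against which \texttt{RandomBreaker} loses the $(1:(1-\epsilon)k(n))$ game with probability tending to $1$. Games and strategies are understood as sequences indexed by $n$;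 biases are rounded to integers.
   Formalization: The parameter ε (and the probability tolerance) ranges over positive rationals instead of positive reals; the perfect matching game is considered for even n only, since K_n has no perfect matching for odd n. -}

module Defs where

open import Data.Nat using (ℕ; zero; suc; _<?_)
open import Data.Fin using (Fin; toℕ)
open import Data.Fin.Properties using () renaming (_≟_ to _≟F_)
open import Data.Bool using (Bool; true; false)
open import Data.Maybe using (Maybe; just; nothing)
open import Data.Product using (Σ; ∃; _×_; _,_; proj₁; proj₂)
open import Data.Product.Properties using (≡-dec)
open import Data.Sum using (_⊎_)
open import Data.List using (List; []; _∷_; _++_; [_]; filter; cartesianProduct; allFin; length; map; concatMap; foldr)
open import Data.List.Relation.Unary.All using (All)
open import Data.List.Relation.Unary.Any using (Any)
open import Data.List.Relation.Unary.AllPairs using (AllPairs)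
open import Data.List.Membership.Propositional using (_∈_)
open import Data.List.Relation.Binary.Sublist.Propositional using (_⊆_)
open import Data.Integer using (ℤ; +_; -[1+_])
open import Data.Rational using (ℚ; _/_; _+_; _*_; _-_; _≤_; 0ℚ; 1ℚ; floor)
open import Relation.Binary.PropositionalEquality using (_≡_)
open import Relation.Binary.Definitions using (DecidableEquality)
open import Relation.Nullary using (¬_; yes; no; ¬?)

-- The board E(K_n): edges {i,j} of K_n, represented as pairs (i , j)
-- with toℕ i < toℕ j (only such pairs occur in allEdges).

Edge : ℕ → Set
Edge n = Fin n × Fin n

_≟E_ : ∀ {n} → DecidableEquality (Edge n)
_≟E_ = ≡-dec _≟F_ _≟F_

allEdges : (n : ℕ) → List (Edge n)
allEdges n = filter (λ e → toℕ (proj₁ e) <? toℕ (proj₂ e))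
                    (cartesianProduct (allFin n) (allFin n))

module _ {n : ℕ} where
  open import Data.List.Membership.DecPropositional (_≟E_ {n}) using (_∈?_)

  free : List (Edge n) → List (Edge n) → List (Edge n)
  free M B = filter (λ e → ¬? (e ∈? (M ++ B))) (allEdges n)

  isFree? : (e : Edge n) → (M B : List (Edge n)) → _
  isFree? e M B = e ∈? free M B

Incident : ∀ {n} → Fin n → Edge n → Set
Incident v e = v ≡ proj₁ e ⊎ v ≡ proj₂ e

Disjoint : ∀ {n} → Edge n → Edge n → Set
Disjoint e f = ¬ (∃ λ v → Incident v e × Incident v f)

HasPerfectMatching : (n : ℕ) → List (Edge n) → Set
HasPerfectMatching n G =
  Σ (List (Edge n)) λ Mt →
    All (_∈ G) Mt × AllPairs Disjoint Mt × (∀ (v : Fin n) → Any (Incident v) Mt)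

MinDegreeOne : (n : ℕ) → List (Edge n) → Set
MinDegreeOne n G = ∀ (v : Fin n) → Any (Incident v) G

-- A deterministic CleverMaker strategy: given Maker's claimed edges (in
-- order of claiming) and Breaker's claimed edges (in order), choose an
-- edge.  'nothing' or an edge that is not free is an illegal move, which
-- ends the game as a loss for Maker.
Strategy : ℕ → Set
Strategy n = List (Edge n) → List (Edge n) → Maybe (Edge n)

record Outcome (n : ℕ) : Set where
  constructor outcome
  field
    legal   : Bool
    maker   : List (Edge n)   -- Maker's edges, in the order claimed
    breaker : List (Edge n)   -- Breaker's edges, in the order claimed
open Outcome public

Dist : ℕ → Set
Dist n = List (ℚ × Outcome n)

scale : ∀ {n} → ℚ → Dist n → Dist n
scale q = map (λ x → (q * proj₁ x , proj₂ x))

end : ∀ {n} → Bool → List (Edge n) → List (Edge n) → Dist n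
end l M B = [ (1ℚ , outcome l M B) ]

module _ {n : ℕ} (b : ℕ) (σ : Strategy n) where
  mutual
    -- Maker to move; the fuel bounds the number of remaining claims.
    makerTurn : ℕ → List (Edge n) → List (Edge n) → Dist n
    makerTurn zero M B = end true M B
    makerTurn (suc f) M B with free M B
    ... | [] = end true M B
    ... | _ ∷ _ with σ M B
    ...   | nothing = end false M B
    ...   | just e with isFree? e M B
    ...     | yes _ = breakerTurn f b (M ++ [ e ]) B
    ...     | no _  = end false M B

    breakerTurn : ℕ → ℕ → List (Edge n) → List (Edge n) → Dist n
    breakerTurn f zero M B = makerTurn f M B
    breakerTurn zero (suc r) M B = end true M B
    breakerTurn (suc f) (suc r) M B with free M B
    ... | [] = end true M B
    ... | x ∷ xs =
      concatMap (λ e → scale ((+ 1) / suc (length xs))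
                             (breakerTurn f r M (B ++ [ e ])))
                (x ∷ xs)

game : (n b : ℕ) → Strategy n → Dist n
game n b σ = makerTurn b σ (length (allEdges n)) [] []

totalWeight : ∀ {n} → Dist n → ℚ
totalWeight = foldr (λ x acc → proj₁ x + acc) 0ℚ

PrAtLeast : ∀ {n} → Dist n → (Outcome n → Set) → ℚ → Set
PrAtLeast {n} D P p =
  Σ (Dist n) λ S → S ⊆ D × All (λ x → P (proj₂ x)) S × p ≤ totalWeight S

ℤ→ℕ : ℤ → ℕ
ℤ→ℕ (+ m) = m
ℤ→ℕ -[1+ _ ] = 0

fromℕℚ : ℕ → ℚ
fromℕℚ m = (+ m) / 1

biasDown : ℚ → ℕ → ℕ
biasDown ε k = ℤ→ℕ (floor ((1ℚ - ε) * fromℕℚ k))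

biasUp : ℚ → ℕ → ℕ
biasUp ε k = ℤ→ℕ (floor ((1ℚ + ε) * fromℕℚ k))

MakerWinsPM : (n : ℕ) → Outcome n → Set
MakerWinsPM n o = legal o ≡ true × HasPerfectMatching n (maker o)

MakerWinsMinDeg1 : (n : ℕ) → Outcome n → Set
MakerWinsMinDeg1 n o = legal o ≡ true × MinDegreeOne n (maker o)

SharpThreshold : (Dom : ℕ → Set) (Win : (n : ℕ) → Outcome n → Set) (k : ℕ → ℕ) → Set
SharpThreshold Dom Win k =
  ∀ (ε : ℚ) → 0ℚ Data.Rational.< ε →
    ( ((σ : (n : ℕ) → Strategy n) → ∀ (δ : ℚ) → 0ℚ Data.Rational.< δ →
        ∃ λ N → ∀ n → N Data.Nat.≤ n → Dom n →
          PrAtLeast (game n (biasUp ε (k n)) (σ n)) (λ o → ¬ Win n o) (1ℚ - δ))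
    × (Σ ((n : ℕ) → Strategy n) λ σ → ∀ (δ : ℚ) → 0ℚ Data.Rational.< δ →
        ∃ λ N → ∀ n → N Data.Nat.≤ n → Dom n →
          PrAtLeast (game n (biasDown ε (k n)) (σ n)) (Win n) (1ℚ - δ)) )

{-# OPTIONS --safe #-}
module Submission where

-- Above the threshold a counting argument suffices: with bias (1+ε)n Maker makes fewer than n/2
-- claims in the whole game, so some vertex stays isolated.
--
-- Below the threshold Maker first claims a fixed gadget, the square of a path on R = O(log n)
-- vertices, and then plays greedily for a matching of the other vertices.  When at most
-- h = O(log n) of them are left and have no free edge among themselves, he attaches each of them
-- to a slot, an even vertex of the gadget, never using two slots of the same block.  Deleting even
-- vertices from the path leaves neighbours at distance at most 2, so an even number of surviving
-- gadget vertices is matched along gadget edges.  This takes n/2 + O(log n) claims.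
--
-- Maker can only be stopped if Breaker claims a gadget edge early, or all edges between two sets
-- of h/2 vertices, or all edges from a vertex to h blocks of slots.  For a fixed edge set A let a
-- be its number of free edges and F the number of all free edges; ((F - f)/F)^a, or 0 once Maker
-- owns an edge of A, is a supermartingale until F drops to f, by Bernoulli's inequality.  It is 1
-- if Breaker owns A.  Hence the sum of the initial values over all these sets bounds the
-- probability of failure.  Initially (F - f)/F is bounded away from 1, so with blocks of constant size
-- the sum is O(log² n / n).

open import Defs
open import Data.Nat using (NonZero; nonZero; ℕ; zero; suc; _≤_; _<_; _+_; _*_; _∸_; _^_; _/_; z≤n; s≤s; ⌊_/2⌋)
import Data.Nat.Properties as ℕₚ
import Data.Integer as ℤ
import Data.Integer.Properties as ℤₚ
import Data.Rational as ℚ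
import Data.Rational.Properties as ℚₚ
import Data.Rational.Unnormalised as ℚᵘ
import Data.Rational.Unnormalised.Properties as ℚᵘₚ
open import Data.Rational.Solver using (module +-*-Solver)
open import Data.Rational using (ℚ; 0ℚ; 1ℚ; _-_)
open import Relation.Binary.PropositionalEquality using (_≡_; _≢_; refl; sym; trans; cong; cong₂; subst; subst₂; module ≡-Reasoning)
open import Data.Product using (Σ; ∃; _×_; _,_; proj₁; proj₂)
import Data.Integer.DivMod as ℤD
open import Data.Bool using (Bool; true; false; if_then_else_)
open import Data.Bool.ListAction using (any)
import Data.Bool
open import Data.Empty using (⊥; ⊥-elim)
open import Data.Sum using (_⊎_; inj₁; inj₂)
open import Data.List using (List; []; _∷_; _++_; [_]; length; map; concatMap; concat; filter; cartesianProduct; allFin; take; drop; upTo; head; applyUpTo)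
import Data.List.Properties as Listₚ
open import Data.List.Membership.Propositional using (_∈_; _∉_; find)
import Data.List.Membership.Propositional.Properties as ∈ₚ
open import Data.List.Relation.Unary.All as All using (All; []; _∷_)
import Data.List.Relation.Unary.All.Properties as Allₚ
open import Data.List.Relation.Unary.Any as Any using (Any; here; there)
import Data.List.Relation.Unary.Any.Properties as Anyₚ
open import Data.List.Relation.Unary.AllPairs as AllPairs using (AllPairs; []; _∷_)
open import Data.List.Relation.Unary.Unique.Propositional using (Unique)
import Data.List.Relation.Unary.Unique.Propositional.Properties as Uniqueₚ
open import Relation.Nullary using (¬_; yes; no; ¬?; Dec)
open import Relation.Unary using (Pred; Decidable)
open import Relation.Binary.Definitions using (DecidableEquality; tri<; tri≈; tri>)
open import Function using (_∘_; id)
open import Level using (0ℓ)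
open import Data.Fin using (Fin; toℕ; fromℕ<)
open import Data.Maybe using (just; nothing)
open import Data.List.Relation.Binary.Sublist.Propositional using (minimum; ⊆-refl; _⊆_) renaming ([] to ⊆[]; _∷ʳ_ to _⊆∷ʳ_; _∷_ to _⊆∷_)
import Data.List.Relation.Binary.Sublist.Propositional as Sublist
import Data.List.Relation.Binary.Sublist.Propositional.Properties as Sublistₚ
open import Data.Nat.Solver using () renaming (module +-*-Solver to ℕ-+-*-Solver)
import Data.List.Relation.Unary.AllPairs.Properties as AllPairsₚ
import Data.Fin.Properties as Finₚ
open import Data.Nat.Divisibility using (_∣_; _∣?_; divides)
import Data.Nat.Divisibility as Div
open import Relation.Nullary.Decidable using (_×-dec_; _⊎-dec_; ⌊_⌋)
import Data.Nat.DivMod as DivMod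
import Data.Sum
import Data.List.Membership.DecPropositional as DecMembership
open import Data.Nat.Logarithm using (⌊log₂_⌋; ⌊log₂⌋-mono-≤; ⌊log₂⌊n/2⌋⌋≡⌊log₂n⌋∸1; ⌊log₂[2^n]⌋≡n)
open import Data.Unit using (⊤)

-- Rational arithmetic

-- The gadget counts towards the move bound, so it may have only O(log n) edges, yet it must keep a
-- perfect matching after losing any choice of slots; the square of a path manages with two edges
-- per vertex where a clique would need log² n. Blocks serve the union bound: the number of
-- arbitrary sets of hD slots can grow exponentially in hD, as does the gain from q^(hD), where q =
-- (F - f)/F, so enlarging D would not help. With whole blocks there are at most 2^r = 4^h choices,
-- against q^(hD) ≤ 8^-h. Here 1/(m+1) ≤ ε, q ≤ 1 - 1/(4m+4) because Maker's rounds use up at most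
-- that share of the board, and D = 7(4m+4) gives q^D ≤ 1/8. A gadget edge is a single edge, whose
-- bound is q itself; this is small only for an earlier horizon, the end of the gadget phase, where
-- q = O(log n / n). No failure event is formalised: induction along the game tree shows that Maker
-- wins with probability at least 1 minus the current danger. This is void if the danger is at least
-- 1; otherwise each listed set without an edge of Maker still has a free edge, which yields the
-- next move.

abstract
  -- Abstract, so that conversion checking never unfolds the gcd normalisation of rationals; `ι m`
  -- is an atom for the ring solver.
  ι : ℕ → ℚ
  ι = fromℕℚ

  fromℕℚ≡ι : ∀ m → fromℕℚ m ≡ ι m
  fromℕℚ≡ι m = refl

  ι-0 : ι 0 ≡ 0ℚ
  ι-0 = refl

  ι-1 : ι 1 ≡ 1ℚ
  ι-1 = refl

  toℚᵘ-ι : ∀ m → ℚ.toℚᵘ (ι m) ℚᵘ.≃ ℚᵘ.mkℚᵘ (ℤ.+ m) 0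
  toℚᵘ-ι m = ℚₚ.toℚᵘ-fromℚᵘ (ℚᵘ.mkℚᵘ (ℤ.+ m) 0)

ι-+ : ∀ a b → ι (a + b) ≡ ι a ℚ.+ ι b
ι-+ a b = ℚₚ.toℚᵘ-injective (ℚᵘₚ.≃-trans (toℚᵘ-ι (a + b)) (ℚᵘₚ.≃-sym
  (ℚᵘₚ.≃-trans (ℚₚ.toℚᵘ-homo-+ (ι a) (ι b))
  (ℚᵘₚ.≃-trans (ℚᵘₚ.+-cong (toℚᵘ-ι a) (toℚᵘ-ι b))
    (ℚᵘ.*≡* (cong (ℤ._* ℤ.1ℤ) (cong₂ ℤ._+_ (ℤₚ.*-identityʳ (ℤ.+ a)) (ℤₚ.*-identityʳ (ℤ.+ b)))))))))

ι-* : ∀ a b → ι (a * b) ≡ ι a ℚ.* ι b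
ι-* a b = ℚₚ.toℚᵘ-injective (ℚᵘₚ.≃-trans (toℚᵘ-ι (a * b)) (ℚᵘₚ.≃-sym
  (ℚᵘₚ.≃-trans (ℚₚ.toℚᵘ-homo-* (ι a) (ι b))
  (ℚᵘₚ.≃-trans (ℚᵘₚ.*-cong (toℚᵘ-ι a) (toℚᵘ-ι b))
    (ℚᵘ.*≡* (cong (ℤ._* ℤ.1ℤ) (sym (ℤₚ.pos-* a b))))))))

ι-mono : ∀ {a b} → a ≤ b → ι a ℚ.≤ ι b
ι-mono {a} {b} a≤b = ℚₚ.toℚᵘ-cancel-≤ (ℚᵘₚ.≤-respˡ-≃ (ℚᵘₚ.≃-sym (toℚᵘ-ι a))
  (ℚᵘₚ.≤-respʳ-≃ (ℚᵘₚ.≃-sym (toℚᵘ-ι b))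
    (ℚᵘ.*≤* (ℤₚ.*-monoʳ-≤-nonNeg ℤ.1ℤ (ℤ.+≤+ a≤b)))))

ι-mono-< : ∀ {a b} → a < b → ι a ℚ.< ι b
ι-mono-< {a} {b} a<b = ℚₚ.toℚᵘ-cancel-< (ℚᵘₚ.<-respˡ-≃ (ℚᵘₚ.≃-sym (toℚᵘ-ι a))
  (ℚᵘₚ.<-respʳ-≃ (ℚᵘₚ.≃-sym (toℚᵘ-ι b))
    (ℚᵘ.*<* (ℤₚ.*-monoʳ-<-pos ℤ.1ℤ (ℤ.+<+ a<b)))))

ι-cancel-≤ : ∀ {a b} → ι a ℚ.≤ ι b → a ≤ b
ι-cancel-≤ {a} {b} h = ℕₚ.≮⇒≥ λ b<a → ℚₚ.<-irrefl refl (ℚₚ.≤-<-trans h (ι-mono-< b<a))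

ι-cancel-< : ∀ {a b} → ι a ℚ.< ι b → a < b
ι-cancel-< {a} {b} h = ℕₚ.≰⇒> λ b≤a → ℚₚ.<-irrefl refl (ℚₚ.≤-<-trans (ι-mono b≤a) h)

ι≥0 : ∀ a → 0ℚ ℚ.≤ ι a
ι≥0 a = subst (ℚ._≤ ι a) ι-0 (ι-mono {0} {a} z≤n)

0≤1 : 0ℚ ℚ.≤ 1ℚ
0≤1 = subst (0ℚ ℚ.≤_) ι-1 (ι≥0 1)

ι>0 : ∀ a → 0ℚ ℚ.< ι (suc a)
ι>0 a = subst (ℚ._< ι (suc a)) ι-0 (ι-mono-< (s≤s z≤n))

ι-suc : ∀ a → ι (suc a) ≡ 1ℚ ℚ.+ ι a
ι-suc a = trans (ι-+ 1 a) (cong (ℚ._+ ι a) ι-1)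

*-monoˡ : ∀ {r p q} → 0ℚ ℚ.≤ r → p ℚ.≤ q → r ℚ.* p ℚ.≤ r ℚ.* q
*-monoˡ {r} 0≤r = ℚₚ.*-monoˡ-≤-nonNeg r {{ℚ.nonNegative 0≤r}}

*-monoʳ : ∀ {r p q} → 0ℚ ℚ.≤ r → p ℚ.≤ q → p ℚ.* r ℚ.≤ q ℚ.* r
*-monoʳ {r} 0≤r = ℚₚ.*-monoʳ-≤-nonNeg r {{ℚ.nonNegative 0≤r}}

*≥0 : ∀ {p q} → 0ℚ ℚ.≤ p → 0ℚ ℚ.≤ q → 0ℚ ℚ.≤ p ℚ.* q
*≥0 {p} {q} 0≤p 0≤q = subst (ℚ._≤ p ℚ.* q) (ℚₚ.*-zeroʳ p) (*-monoˡ 0≤p 0≤q)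

*-mono₂ : ∀ {p q r s} → 0ℚ ℚ.≤ p → 0ℚ ℚ.≤ s → p ℚ.≤ q → r ℚ.≤ s → p ℚ.* r ℚ.≤ q ℚ.* s
*-mono₂ 0≤p 0≤s p≤q r≤s = ℚₚ.≤-trans (*-monoˡ 0≤p r≤s) (*-monoʳ 0≤s p≤q)

≤-+≥0 : ∀ {p d} → 0ℚ ℚ.≤ d → p ℚ.≤ p ℚ.+ d
≤-+≥0 {p} {d} 0≤d = subst (ℚ._≤ p ℚ.+ d) (ℚₚ.+-identityʳ p) (ℚₚ.+-monoʳ-≤ p 0≤d)

p≤q⇒0≤q-p : ∀ {p q} → p ℚ.≤ q → 0ℚ ℚ.≤ q - p
p≤q⇒0≤q-p {p} {q} p≤q = subst (ℚ._≤ q - p) (ℚₚ.+-inverseʳ p) (ℚₚ.+-monoˡ-≤ (ℚ.- p) p≤q)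

0≤q-p⇒p≤q : ∀ {p q} → 0ℚ ℚ.≤ q - p → p ℚ.≤ q
0≤q-p⇒p≤q {p} {q} h = subst (p ℚ.≤_) eq (≤-+≥0 h)
  where
  open +-*-Solver
  eq : p ℚ.+ (q - p) ≡ q
  eq = solve 2 (λ p q → p :+ (q :- p) := q) refl p q

ι-cancel-*ˡ : ∀ {p q} a → ι (suc a) ℚ.* p ℚ.≤ ι (suc a) ℚ.* q → p ℚ.≤ q
ι-cancel-*ˡ a = ℚₚ.*-cancelˡ-≤-pos (ι (suc a)) {{ℚ.positive (ι>0 a)}}

pow : ℚ → ℕ → ℚ
pow x zero    = 1ℚ
pow x (suc a) = x ℚ.* pow x a

pow≥0 : ∀ {x} a → 0ℚ ℚ.≤ x → 0ℚ ℚ.≤ pow x a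
pow≥0 zero    0≤x = 0≤1
pow≥0 (suc a) 0≤x = *≥0 0≤x (pow≥0 a 0≤x)

pow≤1 : ∀ {x} a → 0ℚ ℚ.≤ x → x ℚ.≤ 1ℚ → pow x a ℚ.≤ 1ℚ
pow≤1 zero    0≤x x≤1 = ℚₚ.≤-refl
pow≤1 (suc a) 0≤x x≤1 = *-mono₂ 0≤x 0≤1 x≤1 (pow≤1 a 0≤x x≤1)

pow-mono : ∀ {x y} a → 0ℚ ℚ.≤ x → x ℚ.≤ y → pow x a ℚ.≤ pow y a
pow-mono zero    0≤x x≤y = ℚₚ.≤-refl
pow-mono (suc a) 0≤x x≤y = *-mono₂ 0≤x (pow≥0 a (ℚₚ.≤-trans 0≤x x≤y)) x≤y (pow-mono a 0≤x x≤y)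

pow-+ : ∀ x a b → pow x (a + b) ≡ pow x a ℚ.* pow x b
pow-+ x zero    b = sym (ℚₚ.*-identityˡ _)
pow-+ x (suc a) b = trans (cong (x ℚ.*_) (pow-+ x a b)) (sym (ℚₚ.*-assoc x (pow x a) (pow x b)))

pow-anti : ∀ {x} {a b} → 0ℚ ℚ.≤ x → x ℚ.≤ 1ℚ → a ≤ b → pow x b ℚ.≤ pow x a
pow-anti {x} {a} {b} 0≤x x≤1 a≤b = subst (λ c → pow x c ℚ.≤ pow x a) (ℕₚ.m+[n∸m]≡n a≤b)
  (subst (ℚ._≤ pow x a) (sym (pow-+ x a (b ∸ a)))
    (subst (pow x a ℚ.* pow x (b ∸ a) ℚ.≤_) (ℚₚ.*-identityʳ _)
      (*-monoˡ (pow≥0 a 0≤x) (pow≤1 (b ∸ a) 0≤x x≤1))))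

-- Homogeneous form, without division by x, which is 0 when F = f. Multiplying the induction
-- hypothesis by x + d leaves the surplus (a+1) d² x^a.
bernoulli : ∀ {x d} a → 0ℚ ℚ.≤ x → 0ℚ ℚ.≤ d →
  pow x (suc a) ℚ.+ ι (suc a) ℚ.* d ℚ.* pow x a ℚ.≤ pow (x ℚ.+ d) (suc a)
bernoulli {x} {d} zero 0≤x 0≤d rewrite ι-1 = ℚₚ.≤-reflexive
  (solve 2 (λ x d → x :* con 1ℚ :+ con 1ℚ :* d :* con 1ℚ := (x :+ d) :* con 1ℚ) refl x d)
  where open +-*-Solver
bernoulli {x} {d} (suc a) 0≤x 0≤d = ℚₚ.≤-trans
  (subst (pow x (suc (suc a)) ℚ.+ ι (suc (suc a)) ℚ.* d ℚ.* pow x (suc a) ℚ.≤_) eq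
    (≤-+≥0 (*≥0 (*≥0 (*≥0 0≤d 0≤d) (ι≥0 (suc a))) (pow≥0 a 0≤x))))
  (*-monoˡ (ℚₚ.≤-trans 0≤x (≤-+≥0 0≤d)) (bernoulli a 0≤x 0≤d))
  where
  open +-*-Solver
  eq : pow x (suc (suc a)) ℚ.+ ι (suc (suc a)) ℚ.* d ℚ.* pow x (suc a)
         ℚ.+ d ℚ.* d ℚ.* ι (suc a) ℚ.* pow x a
     ≡ (x ℚ.+ d) ℚ.* (pow x (suc a) ℚ.+ ι (suc a) ℚ.* d ℚ.* pow x a)
  eq rewrite ι-suc (suc a) =
    solve 4 (λ x d k y → x :* (x :* y) :+ (con 1ℚ :+ k) :* d :* (x :* y) :+ d :* d :* k :* y
                       := (x :+ d) :* (x :* y :+ k :* d :* y)) refl x d (ι (suc a)) (pow x a)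

-- A rational substitute for exponential decay: (1 - p)(1 + (a+1)p) = 1 + ap - (a+1)p².
pow-decay : ∀ {x p} a → 0ℚ ℚ.≤ x → 0ℚ ℚ.≤ p → x ℚ.≤ 1ℚ - p → pow x a ℚ.* (1ℚ ℚ.+ ι a ℚ.* p) ℚ.≤ 1ℚ
pow-decay {x} {p} zero 0≤x 0≤p x≤ rewrite ι-0 = ℚₚ.≤-reflexive
  (solve 1 (λ p → con 1ℚ :* (con 1ℚ :+ con 0ℚ :* p) := con 1ℚ) refl p)
  where open +-*-Solver
pow-decay {x} {p} (suc a) 0≤x 0≤p x≤ = ℚₚ.≤-trans
  (subst (ℚ._≤ pow x a ℚ.* ((1ℚ - p) ℚ.* (1ℚ ℚ.+ ι (suc a) ℚ.* p))) eq₁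
    (*-monoˡ (pow≥0 a 0≤x) (*-monoʳ (ℚₚ.≤-trans 0≤1 (≤-+≥0 (*≥0 (ι≥0 (suc a)) 0≤p))) x≤)))
  (ℚₚ.≤-trans (*-monoˡ (pow≥0 a 0≤x)
      (subst ((1ℚ - p) ℚ.* (1ℚ ℚ.+ ι (suc a) ℚ.* p) ℚ.≤_) eq₂ (≤-+≥0 (*≥0 (*≥0 0≤p 0≤p) (ι≥0 (suc a))))))
    (pow-decay a 0≤x 0≤p x≤))
  where
  open +-*-Solver
  eq₁ : pow x a ℚ.* (x ℚ.* (1ℚ ℚ.+ ι (suc a) ℚ.* p)) ≡ pow x (suc a) ℚ.* (1ℚ ℚ.+ ι (suc a) ℚ.* p)
  eq₁ = solve 3 (λ x y z → y :* (x :* z) := x :* y :* z) refl x (pow x a) (1ℚ ℚ.+ ι (suc a) ℚ.* p)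
  eq₂ : (1ℚ - p) ℚ.* (1ℚ ℚ.+ ι (suc a) ℚ.* p) ℚ.+ p ℚ.* p ℚ.* ι (suc a) ≡ 1ℚ ℚ.+ ι a ℚ.* p
  eq₂ rewrite ι-suc a = solve 2 (λ p k → (con 1ℚ :- p) :* (con 1ℚ :+ (con 1ℚ :+ k) :* p) :+ p :* p :* (con 1ℚ :+ k)
                                  := con 1ℚ :+ k :* p) refl p (ι a)

floor-lower : ∀ p {k} → ℚ.floor p ≡ ℤ.+ k → ι k ℚ.≤ p
floor-lower p@(ℚ.mkℚ num d-1 _) {k} eq = ℚₚ.toℚᵘ-cancel-≤ (ℚᵘₚ.≤-respˡ-≃ (ℚᵘₚ.≃-sym (toℚᵘ-ι k))
  (ℚᵘ.*≤* (transport (ℤₚ.≤-trans (ℤD.[n/d]*d≤n num d) (ℤₚ.≤-reflexive (sym (ℤₚ.*-identityʳ num)))))))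
  where
  d : ℤ.ℤ
  d = ℤ.+ suc d-1
  transport : (ℚ.floor p ℤ.* d) ℤ.≤ num ℤ.* ℤ.1ℤ → (ℤ.+ k ℤ.* d) ℤ.≤ num ℤ.* ℤ.1ℤ
  transport = subst (λ z → z ℤ.* d ℤ.≤ num ℤ.* ℤ.1ℤ) eq

ℤ→ℕ-≥ : ∀ z → z ℤ.≤ ℤ.+ ℤ→ℕ z
ℤ→ℕ-≥ (ℤ.+ n)      = ℤₚ.≤-refl
ℤ→ℕ-≥ ℤ.-[1+ n ] = ℤ.-≤+

floor-upper : ∀ p → p ℚ.< ι (suc (ℤ→ℕ (ℚ.floor p)))
floor-upper p@(ℚ.mkℚ num d-1 _) = ℚₚ.toℚᵘ-cancel-< (ℚᵘₚ.<-respʳ-≃ (ℚᵘₚ.≃-sym (toℚᵘ-ι (suc (ℤ→ℕ z))))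
  (ℚᵘ.*<* (ℤₚ.≤-<-trans (ℤₚ.≤-reflexive (trans (ℤₚ.*-identityʳ num) (ℤD.a≡a%n+[a/n]*n num d)))
    (ℤₚ.<-≤-trans (ℤₚ.+-monoˡ-< (z ℤ.* d) (ℤ.+<+ (ℤD.n%d<d num d)))
      (ℤₚ.≤-trans (ℤₚ.≤-reflexive (sym (ℤₚ.suc-* z d)))
        (ℤₚ.*-monoʳ-≤-nonNeg d (ℤₚ.+-monoʳ-≤ ℤ.1ℤ (ℤ→ℕ-≥ z))))))))
  where
  d = ℤ.+ suc d-1
  z = num ℤD./ d

-- The denominator of ε serves as m + 1. Replacing ε by 1/(m+1) turns the bounds on the bias into
-- inequalities between naturals.
reciprocal-below : ∀ ε → 0ℚ ℚ.< ε → ∃ λ m → 1ℚ ℚ.≤ ι (suc m) ℚ.* ε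
reciprocal-below ε@(ℚ.mkℚ (ℤ.+ zero) d-1 _) 0<ε with ℚₚ.drop-*<* 0<ε
... | ℤ.+<+ ()
reciprocal-below ε@(ℚ.mkℚ ℤ.-[1+ _ ] d-1 _) 0<ε with ℚₚ.drop-*<* 0<ε
... | ()
reciprocal-below ε@(ℚ.mkℚ (ℤ.+ suc p) d-1 _) 0<ε = d-1 , ℚₚ.toℚᵘ-cancel-≤
  (ℚᵘₚ.≤-respʳ-≃ (ℚᵘₚ.≃-sym (ℚᵘₚ.≃-trans (ℚₚ.toℚᵘ-homo-* (ι (suc d-1)) ε) (ℚᵘₚ.*-congʳ {ℚ.toℚᵘ ε} (toℚᵘ-ι (suc d-1)))))
    (ℚᵘ.*≤* (ℤ.+≤+ (ℕₚ.≤-trans (ℕₚ.≤-reflexive (trans (cong (_+ 0) (ℕₚ.+-identityʳ (suc d-1))) (ℕₚ.+-identityʳ (suc d-1))))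
       (ℕₚ.≤-trans (ℕₚ.m≤m*n (suc d-1) (suc p)) (ℕₚ.≤-reflexive (sym (ℕₚ.*-identityʳ _))))))))

biasDown-≤ : ∀ ε m n → 1ℚ ℚ.≤ ι (suc m) ℚ.* ε → suc m * biasDown ε n ≤ m * n
biasDown-≤ ε m n h rewrite fromℕℚ≡ι n with ℚ.floor ((1ℚ - ε) ℚ.* ι n) in eq
-- A negative floor occurs only for ε > 1; the bias is then rounded to 0.
... | ℤ.-[1+ _ ] = subst (_≤ m * n) (sym (ℕₚ.*-zeroʳ (suc m))) z≤n
... | ℤ.+ k = ι-cancel-≤ (ℚₚ.≤-trans (ℚₚ.≤-reflexive (ι-* (suc m) k))
    (ℚₚ.≤-trans (*-monoˡ (ι≥0 (suc m)) (floor-lower ((1ℚ - ε) ℚ.* ι n) eq))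
    (ℚₚ.≤-trans (0≤q-p⇒p≤q (subst (0ℚ ℚ.≤_) eq′ (*≥0 (p≤q⇒0≤q-p h) (ι≥0 n)))) (ℚₚ.≤-reflexive (sym (ι-* m n))))))
  where
  open +-*-Solver
  eq′ : (ι (suc m) ℚ.* ε - 1ℚ) ℚ.* ι n ≡ ι m ℚ.* ι n - ι (suc m) ℚ.* ((1ℚ - ε) ℚ.* ι n)
  eq′ rewrite ι-suc m = solve 3 (λ m e n → ((con 1ℚ :+ m) :* e :- con 1ℚ) :* n
    := m :* n :- (con 1ℚ :+ m) :* ((con 1ℚ :- e) :* n)) refl (ι m) ε (ι n)

-- The unit lost by the floor is regained because a round consists of b + 1 claims, Maker's own
-- included.
biasUp-> : ∀ ε m n → 1ℚ ℚ.≤ ι (suc m) ℚ.* ε → suc (suc m) * n < suc m * suc (biasUp ε n)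
biasUp-> ε m n h rewrite fromℕℚ≡ι n = ι-cancel-< (ℚₚ.≤-<-trans
    (0≤q-p⇒p≤q (subst (0ℚ ℚ.≤_) eq′ (*≥0 (p≤q⇒0≤q-p h) (ι≥0 n))))
    (subst (ι (suc m) ℚ.* ((1ℚ ℚ.+ ε) ℚ.* ι n) ℚ.<_) (sym (ι-* (suc m) _))
      (ℚₚ.*-monoʳ-<-pos (ι (suc m)) {{ℚ.positive (ι>0 m)}} (floor-upper ((1ℚ ℚ.+ ε) ℚ.* ι n)))))
  where
  open +-*-Solver
  eq′ : (ι (suc m) ℚ.* ε - 1ℚ) ℚ.* ι n ≡ ι (suc m) ℚ.* ((1ℚ ℚ.+ ε) ℚ.* ι n) - ι (suc (suc m) * n)
  eq′ rewrite ι-* (suc (suc m)) n | ι-suc (suc m) = solve 3 (λ m e n → (m :* e :- con 1ℚ) :* n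
    := m :* ((con 1ℚ :+ e) :* n) :- (con 1ℚ :+ m) :* n) refl (ι (suc m)) ε (ι n)

-- Lists and finite sums

module _ {A : Set} where

  length-⊆ : {xs ys : List A} → Unique xs → (∀ {x} → x ∈ xs → x ∈ ys) → length xs ≤ length ys
  length-⊆ {[]} [] sub = z≤n
  length-⊆ {x ∷ xs} (x∉ ∷ u) sub with ∈ₚ.∈-∃++ (sub (here refl))
  ... | as , bs , refl = subst (suc (length xs) ≤_)
    (trans (cong suc (Listₚ.length-++ as)) (trans (sym (ℕₚ.+-suc (length as) (length bs))) (sym (Listₚ.length-++ as))))
    (s≤s (length-⊆ u sub′))
    where
    sub′ : ∀ {y} → y ∈ xs → y ∈ as ++ bs
    sub′ y∈ with ∈ₚ.∈-++⁻ as (sub (there y∈))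
    ... | inj₁ y∈as           = ∈ₚ.∈-++⁺ˡ y∈as
    ... | inj₂ (there y∈bs)   = ∈ₚ.∈-++⁺ʳ as y∈bs
    ... | inj₂ (here refl)    = ⊥-elim (All.lookup x∉ y∈ refl)

  -- An equality of lists, order included: it allows `free` after a claim to be rewritten as a
  -- deletion.
  filter-∩ : {P Q R : Pred A 0ℓ} (P? : Decidable P) (Q? : Decidable Q) (R? : Decidable R) →
    (∀ {x} → P x → Q x × R x) → (∀ {x} → Q x → R x → P x) →
    ∀ xs → filter P? xs ≡ filter R? (filter Q? xs)
  filter-∩ P? Q? R? to from [] = refl
  filter-∩ P? Q? R? to from (x ∷ xs) with P? x | Q? x
  ... | yes p | no ¬q = ⊥-elim (¬q (proj₁ (to p)))
  ... | no ¬p | no ¬q = filter-∩ P? Q? R? to from xs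
  ... | yes p | yes q with R? x
  ...   | yes r = cong (x ∷_) (filter-∩ P? Q? R? to from xs)
  ...   | no ¬r = ⊥-elim (¬r (proj₂ (to p)))
  filter-∩ P? Q? R? to from (x ∷ xs) | no ¬p | yes q with R? x
  ...   | yes r = ⊥-elim (¬p (from q r))
  ...   | no ¬r = filter-∩ P? Q? R? to from xs

  count : (A → Bool) → List A → ℕ
  count p []       = 0
  count p (x ∷ xs) = if p x then suc (count p xs) else count p xs

  count-≤ : ∀ p xs → count p xs ≤ length xs
  count-≤ p []       = z≤n
  count-≤ p (x ∷ xs) with p x
  ... | true  = s≤s (count-≤ p xs)
  ... | false = ℕₚ.m≤n⇒m≤1+n (count-≤ p xs)

  count≢0 : ∀ p xs → count p xs ≢ 0 → ∃ λ x → x ∈ xs × p x ≡ true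
  count≢0 p []       c≢0 = ⊥-elim (c≢0 refl)
  count≢0 p (x ∷ xs) c≢0 with p x in eq
  ... | true  = x , here refl , eq
  ... | false with count≢0 p xs c≢0
  ...   | y , y∈ , py = y , there y∈ , py

  any-false : ∀ (p : A → Bool) xs → (∀ {x} → x ∈ xs → p x ≡ false) → any p xs ≡ false
  any-false p []       h = refl
  any-false p (x ∷ xs) h rewrite h {x} (here refl) = any-false p xs (h ∘ there)

  any-++-false : ∀ (p : A → Bool) xs ys → any p (xs ++ ys) ≡ false → any p xs ≡ false
  any-++-false p []       ys h = refl
  any-++-false p (x ∷ xs) ys h with p x
  ... | false = any-++-false p xs ys h

  any-∈ : ∀ (p : A → Bool) xs {x} → x ∈ xs → any p xs ≡ false → p x ≡ false
  any-∈ p (y ∷ ys) (here refl) h with p y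
  ... | false = refl
  any-∈ p (y ∷ ys) (there x∈) h with p y
  ... | false = any-∈ p ys x∈ h

  count-filter-≥ : ∀ p {xs zs} → Unique zs → (∀ {z} → z ∈ zs → z ∈ xs) → (∀ {z} → z ∈ zs → p z ≡ true) →
    length zs ≤ count p xs
  count-filter-≥ p {xs} {zs} u sub h = subst (length zs ≤_) (len xs)
      (length-⊆ u λ z∈ → ∈ₚ.∈-filter⁺ (λ x → p x Data.Bool.≟ true) (sub z∈) (h z∈))
    where
    len : ∀ xs → length (filter (λ x → p x Data.Bool.≟ true) xs) ≡ count p xs
    len [] = refl
    len (x ∷ xs) with p x
    ... | true  = cong suc (len xs)
    ... | false = len xs

  module Deletion (_≟_ : DecidableEquality A) where

    delete : A → List A → List A
    delete e = filter (λ x → ¬? (x ≟ e))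

    delete-∉ : ∀ {e xs} → e ∉ xs → delete e xs ≡ xs
    delete-∉ {e} {xs} e∉ = Listₚ.filter-all (λ x → ¬? (x ≟ e)) (All.tabulate λ { x∈ refl → e∉ x∈ })

    length-delete : ∀ {e xs} → Unique xs → e ∈ xs → length xs ≡ suc (length (delete e xs))
    length-delete {e} {x ∷ xs} (x∉ ∷ u) e∈ with x ≟ e
    ... | yes refl = cong (suc ∘ length) (sym (delete-∉ (Uniqueₚ.Unique[x∷xs]⇒x∉xs (x∉ ∷ u))))
    length-delete {e} {x ∷ xs} (x∉ ∷ u) (here refl) | no x≢e = ⊥-elim (x≢e refl)
    length-delete {e} {x ∷ xs} (x∉ ∷ u) (there e∈)  | no x≢e = cong suc (length-delete u e∈)

    count-delete-false : ∀ p {e} xs → p e ≡ false → count p (delete e xs) ≡ count p xs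
    count-delete-false p [] pe = refl
    count-delete-false p {e} (x ∷ xs) pe with x ≟ e
    ... | yes refl rewrite pe = count-delete-false p xs pe
    ... | no _ with p x
    ...   | true  = cong suc (count-delete-false p xs pe)
    ...   | false = count-delete-false p xs pe

    count-delete-true : ∀ p {e xs} → Unique xs → e ∈ xs → p e ≡ true → count p xs ≡ suc (count p (delete e xs))
    count-delete-true p {e} {x ∷ xs} (x∉ ∷ u) e∈ pe with x ≟ e
    ... | yes refl rewrite pe = cong (suc ∘ count p) (sym (delete-∉ (Uniqueₚ.Unique[x∷xs]⇒x∉xs (x∉ ∷ u))))
    count-delete-true p {e} {x ∷ xs} (x∉ ∷ u) (here refl) pe | no x≢e = ⊥-elim (x≢e refl)
    count-delete-true p {e} {x ∷ xs} (x∉ ∷ u) (there e∈) pe  | no x≢e with p x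
    ... | true  = cong suc (count-delete-true p u e∈ pe)
    ... | false = count-delete-true p u e∈ pe

module _ {A : Set} where
  ∑ : List A → (A → ℚ) → ℚ
  ∑ []       f = 0ℚ
  ∑ (x ∷ xs) f = f x ℚ.+ ∑ xs f

  ∑-mono : ∀ xs {f g} → (∀ {x} → x ∈ xs → f x ℚ.≤ g x) → ∑ xs f ℚ.≤ ∑ xs g
  ∑-mono []       h = ℚₚ.≤-refl
  ∑-mono (x ∷ xs) h = ℚₚ.+-mono-≤ (h (here refl)) (∑-mono xs (h ∘ there))

  ∑-+ : ∀ xs f g → ∑ xs (λ x → f x ℚ.+ g x) ≡ ∑ xs f ℚ.+ ∑ xs g
  ∑-+ []       f g = refl
  ∑-+ (x ∷ xs) f g = trans (cong (f x ℚ.+ g x ℚ.+_) (∑-+ xs f g))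
    (solve 4 (λ a b c d → a :+ b :+ (c :+ d) := a :+ c :+ (b :+ d)) refl (f x) (g x) (∑ xs f) (∑ xs g))
    where open +-*-Solver

  ∑-const : ∀ xs c → ∑ xs (λ _ → c) ≡ ι (length xs) ℚ.* c
  ∑-const []       c rewrite ι-0 = sym (ℚₚ.*-zeroˡ c)
  ∑-const (x ∷ xs) c rewrite ι-suc (length xs) | ∑-const xs c =
    solve 2 (λ c k → c :+ k :* c := (con 1ℚ :+ k) :* c) refl c (ι (length xs))
    where open +-*-Solver

  ∑-complement : ∀ xs f → ∑ xs (λ x → 1ℚ - f x) ≡ ι (length xs) - ∑ xs f
  ∑-complement []       f rewrite ι-0 = refl
  ∑-complement (x ∷ xs) f rewrite ι-suc (length xs) | ∑-complement xs f =
    solve 3 (λ a b c → con 1ℚ :- a :+ (b :- c) := con 1ℚ :+ b :- (a :+ c)) refl (f x) (ι (length xs)) (∑ xs f)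
    where open +-*-Solver

  ∑-≥0 : ∀ xs {f} → (∀ x → 0ℚ ℚ.≤ f x) → 0ℚ ℚ.≤ ∑ xs f
  ∑-≥0 []       h = ℚₚ.≤-refl
  ∑-≥0 (x ∷ xs) h = ℚₚ.+-mono-≤ (h x) (∑-≥0 xs h)

  ∑-∈ : ∀ xs {f} → (∀ x → 0ℚ ℚ.≤ f x) → ∀ {x} → x ∈ xs → f x ℚ.≤ ∑ xs f
  ∑-∈ (x ∷ xs) {f} h (here refl) = ≤-+≥0 (∑-≥0 xs h)
  ∑-∈ (y ∷ xs) {f} h {x} (there x∈) = ℚₚ.≤-trans (∑-∈ xs h x∈)
    (subst (∑ xs f ℚ.≤_) (ℚₚ.+-comm (∑ xs f) (f y)) (≤-+≥0 (h y)))

  -- Meant for the average over Breaker's choices, split by whether the claimed edge lies in the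
  -- threatened set. The difference is taken in ℚ to avoid truncation.
  ∑-by-count : ∀ p xs {f u v} →
    (∀ {x} → x ∈ xs → p x ≡ true → f x ℚ.≤ u) → (∀ {x} → x ∈ xs → p x ≡ false → f x ℚ.≤ v) →
    ∑ xs f ℚ.≤ ι (count p xs) ℚ.* u ℚ.+ (ι (length xs) - ι (count p xs)) ℚ.* v
  ∑-by-count p [] {f} {u} {v} hu hv rewrite ι-0 = ℚₚ.≤-reflexive
    (solve 2 (λ u v → con 0ℚ := con 0ℚ :* u :+ (con 0ℚ :- con 0ℚ) :* v) refl u v)
    where open +-*-Solver
  ∑-by-count p (x ∷ xs) {f} {u} {v} hu hv with p x in eq
  ... | true = ℚₚ.≤-trans (ℚₚ.+-mono-≤ (hu (here refl) eq) (∑-by-count p xs (hu ∘ there) (hv ∘ there)))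
      (ℚₚ.≤-reflexive eq′)
    where
    open +-*-Solver
    eq′ : _ ≡ ι (suc (count p xs)) ℚ.* u ℚ.+ (ι (suc (length xs)) - ι (suc (count p xs))) ℚ.* v
    eq′ rewrite ι-suc (length xs) | ι-suc (count p xs) =
      solve 4 (λ u v c l → u :+ (c :* u :+ (l :- c) :* v) := (con 1ℚ :+ c) :* u :+ (con 1ℚ :+ l :- (con 1ℚ :+ c)) :* v)
        refl u v (ι (count p xs)) (ι (length xs))
  ... | false = ℚₚ.≤-trans (ℚₚ.+-mono-≤ (hv (here refl) eq) (∑-by-count p xs (hu ∘ there) (hv ∘ there)))
      (ℚₚ.≤-reflexive eq′)
    where
    open +-*-Solver
    eq′ : _ ≡ ι (count p xs) ℚ.* u ℚ.+ (ι (suc (length xs)) - ι (count p xs)) ℚ.* v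
    eq′ rewrite ι-suc (length xs) =
      solve 4 (λ u v c l → v :+ (c :* u :+ (l :- c) :* v) := c :* u :+ (con 1ℚ :+ l :- c) :* v)
        refl u v (ι (count p xs)) (ι (length xs))

-- Breaker's supermartingale

-- (F - f) / F: the probability that Breaker claims a given edge while the number of free edges
-- drops from F to f, if every one of these claims is hers.
abstract
  hit : ℕ → ℕ → ℚ
  hit f zero    = 0ℚ
  hit f (suc F) = (ℤ.+ (suc F ∸ f)) ℚ./ suc F

  hit-spec : ∀ f F → ι F ℚ.* hit f F ≡ ι (F ∸ f)
  hit-spec f zero = trans (ℚₚ.*-zeroʳ (ι 0)) (trans (sym ι-0) (cong ι (sym (ℕₚ.0∸n≡0 f))))
  hit-spec f (suc F) = ℚₚ.toℚᵘ-injective (ℚᵘₚ.≃-trans (ℚₚ.toℚᵘ-homo-* (ι (suc F)) (hit f (suc F)))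
    (ℚᵘₚ.≃-trans (ℚᵘₚ.*-cong (toℚᵘ-ι (suc F)) (ℚₚ.toℚᵘ-fromℚᵘ (ℚᵘ.mkℚᵘ (ℤ.+ (suc F ∸ f)) F)))
    (ℚᵘₚ.≃-trans (ℚᵘ.*≡* eq) (ℚᵘₚ.≃-sym (toℚᵘ-ι (suc F ∸ f))))))
    where
    a : ℕ
    a = suc F ∸ f
    eq : ℤ.+ suc F ℤ.* ℤ.+ a ℤ.* ℤ.+ 1 ≡ ℤ.+ a ℤ.* ℤ.+ suc (F + 0)
    eq rewrite ℕₚ.+-identityʳ F = trans (ℤₚ.*-identityʳ _) (ℤₚ.*-comm (ℤ.+ suc F) (ℤ.+ a))

  hit≥0 : ∀ f F → 0ℚ ℚ.≤ hit f F
  hit≥0 f zero    = ℚₚ.≤-refl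
  hit≥0 f (suc F) = ι-cancel-*ˡ F (subst (ℚ._≤ ι (suc F) ℚ.* hit f (suc F)) (sym (ℚₚ.*-zeroʳ (ι (suc F))))
    (subst (0ℚ ℚ.≤_) (sym (hit-spec f (suc F))) (ι≥0 (suc F ∸ f))))

  hit≤1 : ∀ f F → hit f F ℚ.≤ 1ℚ
  hit≤1 f zero    = 0≤1
  hit≤1 f (suc F) = ι-cancel-*ˡ F (subst (ι (suc F) ℚ.* hit f (suc F) ℚ.≤_) (sym (ℚₚ.*-identityʳ (ι (suc F))))
    (subst (ℚ._≤ ι (suc F)) (sym (hit-spec f (suc F))) (ι-mono (ℕₚ.m∸n≤m (suc F) f))))

  hit-suc : ∀ f F → hit f (suc F) ≡ (ℤ.+ (suc F ∸ f)) ℚ./ suc F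
  hit-suc f F = refl

-- F times `hit f F` is F - f, which grows by one together with F.
hit-step : ∀ {f F} → f ≤ F → ι (suc F) ℚ.* (hit f (suc F) - hit f F) ≡ 1ℚ - hit f F
hit-step {f} {F} f≤F = begin
  ι (suc F) ℚ.* (hit f (suc F) - x)             ≡⟨ lem₁ (ι (suc F)) (hit f (suc F)) x ⟩
  ι (suc F) ℚ.* hit f (suc F) - ι (suc F) ℚ.* x ≡⟨ cong₂ (λ u v → u - v ℚ.* x) eq (ι-suc F) ⟩
  1ℚ ℚ.+ ι F ℚ.* x - (1ℚ ℚ.+ ι F) ℚ.* x         ≡⟨ lem₂ (ι F) x ⟩
  1ℚ - x ∎
  where
  open ≡-Reasoning
  open +-*-Solver
  x = hit f F
  lem₁ : ∀ a b c → a ℚ.* (b - c) ≡ a ℚ.* b - a ℚ.* c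
  lem₁ = solve 3 (λ a b c → a :* (b :- c) := a :* b :- a :* c) refl
  lem₂ : ∀ a c → 1ℚ ℚ.+ a ℚ.* c - (1ℚ ℚ.+ a) ℚ.* c ≡ 1ℚ - c
  lem₂ = solve 2 (λ a c → con 1ℚ :+ a :* c :- (con 1ℚ :+ a) :* c := con 1ℚ :- c) refl
  eq : ι (suc F) ℚ.* hit f (suc F) ≡ 1ℚ ℚ.+ ι F ℚ.* x
  eq = trans (hit-spec f (suc F)) (trans (cong ι (ℕₚ.+-∸-assoc 1 f≤F))
         (trans (ι-suc (F ∸ f)) (cong (1ℚ ℚ.+_) (sym (hit-spec f F)))))

hit-mono : ∀ {f F} → f ≤ F → hit f F ℚ.≤ hit f (suc F)
hit-mono {f} {F} f≤F = 0≤q-p⇒p≤q (ι-cancel-*ˡ F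
  (subst₂ ℚ._≤_ (sym (ℚₚ.*-zeroʳ (ι (suc F)))) (sym (hit-step f≤F)) (p≤q⇒0≤q-p (hit≤1 f F))))

-- The averaged Breaker step: of F+1 free edges, a+1 lie in the set and claiming one of them lowers
-- the exponent. By `hit-step` the left side equals (F+1)(x^(a+1) + (a+1) d x^a) with x = `hit f F`
-- and d its increment, so Bernoulli's inequality applies.
hit-bernoulli : ∀ {f F} a → f ≤ F →
  ι (suc a) ℚ.* pow (hit f F) a ℚ.+ (ι (suc F) - ι (suc a)) ℚ.* pow (hit f F) (suc a)
    ℚ.≤ ι (suc F) ℚ.* pow (hit f (suc F)) (suc a)
hit-bernoulli {f} {F} a f≤F = ℚₚ.≤-trans (ℚₚ.≤-reflexive eq)
  (subst (λ z → ι (suc F) ℚ.* (pow x (suc a) ℚ.+ ι (suc a) ℚ.* d ℚ.* pow x a) ℚ.≤ ι (suc F) ℚ.* pow z (suc a)) x+d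
    (*-monoˡ (ι≥0 (suc F)) (bernoulli a (hit≥0 f F) (p≤q⇒0≤q-p (hit-mono f≤F)))))
  where
  open +-*-Solver
  x = hit f F
  d = hit f (suc F) - x
  x+d : x ℚ.+ d ≡ hit f (suc F)
  x+d = solve 2 (λ x y → x :+ (y :- x) := y) refl x (hit f (suc F))
  lem₁ : ∀ k N x y → k ℚ.* y ℚ.+ (N - k) ℚ.* (x ℚ.* y) ≡ N ℚ.* (x ℚ.* y) ℚ.+ k ℚ.* (1ℚ - x) ℚ.* y
  lem₁ = solve 4 (λ k N x y → k :* y :+ (N :- k) :* (x :* y) := N :* (x :* y) :+ k :* (con 1ℚ :- x) :* y) refl
  lem₂ : ∀ k N z y d → N ℚ.* z ℚ.+ k ℚ.* (N ℚ.* d) ℚ.* y ≡ N ℚ.* (z ℚ.+ k ℚ.* d ℚ.* y)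
  lem₂ = solve 5 (λ k N z y d → N :* z :+ k :* (N :* d) :* y := N :* (z :+ k :* d :* y)) refl
  eq : _ ≡ ι (suc F) ℚ.* (pow x (suc a) ℚ.+ ι (suc a) ℚ.* d ℚ.* pow x a)
  eq = trans (lem₁ (ι (suc a)) (ι (suc F)) x (pow x a))
    (trans (cong (λ z → ι (suc F) ℚ.* pow x (suc a) ℚ.+ ι (suc a) ℚ.* z ℚ.* pow x a) (sym (hit-step f≤F)))
      (lem₂ (ι (suc a)) (ι (suc F)) (pow x (suc a)) (pow x a) d))

module _ {n : ℕ} where
  open Deletion (_≟E_ {n}) public

  private
    Edges = List (Edge n)

  allEdges-unique : Unique (allEdges n)
  allEdges-unique = Uniqueₚ.filter⁺ _ (Uniqueₚ.cartesianProduct⁺ (Uniqueₚ.allFin⁺ n) (Uniqueₚ.allFin⁺ n))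

  free-unique : ∀ M B → Unique (free {n} M B)
  free-unique M B = Uniqueₚ.filter⁺ _ allEdges-unique

  ∈-free⁻ : ∀ {M B e} → e ∈ free M B → e ∈ allEdges n × e ∉ M × e ∉ B
  ∈-free⁻ {M} e∈ with ∈ₚ.∈-filter⁻ _ e∈
  ... | e∈all , e∉ = e∈all , (λ h → e∉ (∈ₚ.∈-++⁺ˡ h)) , (λ h → e∉ (∈ₚ.∈-++⁺ʳ M h))

  free-breaker : ∀ M B e → free M (B ++ [ e ]) ≡ delete e (free M B)
  free-breaker M B e = filter-∩ _ _ _ to from (allEdges n)
    where
    to : ∀ {x} → x ∉ M ++ (B ++ [ e ]) → x ∉ M ++ B × x ≢ e
    to {x} h = (λ x∈ → h (subst (x ∈_) (Listₚ.++-assoc M B [ e ]) (∈ₚ.∈-++⁺ˡ x∈)))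
           , λ { refl → h (∈ₚ.∈-++⁺ʳ M (∈ₚ.∈-++⁺ʳ B (here refl))) }
    from : ∀ {x} → x ∉ M ++ B → x ≢ e → x ∉ M ++ (B ++ [ e ])
    from {x} h x≢e x∈ with ∈ₚ.∈-++⁻ (M ++ B) (subst (x ∈_) (sym (Listₚ.++-assoc M B [ e ])) x∈)
    ... | inj₁ x∈MB        = h x∈MB
    ... | inj₂ (here refl) = x≢e refl

  free-maker : ∀ M B e → free (M ++ [ e ]) B ≡ delete e (free M B)
  free-maker M B e = filter-∩ _ _ _ to from (allEdges n)
    where
    to : ∀ {x} → x ∉ (M ++ [ e ]) ++ B → x ∉ M ++ B × x ≢ e
    to {x} h = (λ x∈ → h (lem x∈)) , λ { refl → h (∈ₚ.∈-++⁺ˡ (∈ₚ.∈-++⁺ʳ M (here refl))) }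
      where
      lem : x ∈ M ++ B → x ∈ (M ++ [ e ]) ++ B
      lem x∈ with ∈ₚ.∈-++⁻ M x∈
      ... | inj₁ x∈M = ∈ₚ.∈-++⁺ˡ (∈ₚ.∈-++⁺ˡ x∈M)
      ... | inj₂ x∈B = ∈ₚ.∈-++⁺ʳ (M ++ [ e ]) x∈B
    from : ∀ {x} → x ∉ M ++ B → x ≢ e → x ∉ (M ++ [ e ]) ++ B
    from {x} h x≢e x∈ with ∈ₚ.∈-++⁻ (M ++ [ e ]) x∈
    ... | inj₂ x∈B = h (∈ₚ.∈-++⁺ʳ M x∈B)
    ... | inj₁ x∈Me with ∈ₚ.∈-++⁻ M x∈Me
    ...   | inj₁ x∈M = h (∈ₚ.∈-++⁺ˡ x∈M)
    ...   | inj₂ (here refl) = x≢e refl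

  -- An upper bound for the probability that Breaker claims all of A before only f edges are free.
  -- Edges are drawn without replacement, so the events for the single edges are negatively correlated.
  threat : ℕ → (Edge n → Bool) → Edges → Edges → ℚ
  threat f A M B = if any A M then 0ℚ else pow (hit f (length (free M B))) (count A (free M B))

  threat≥0 : ∀ f A M B → 0ℚ ℚ.≤ threat f A M B
  threat≥0 f A M B with any A M
  ... | true  = ℚₚ.≤-refl
  ... | false = pow≥0 (count A (free M B)) (hit≥0 f (length (free M B)))

  -- The supermartingale inequality, multiplied by the number of free edges. Both sides are 0 once
  -- Maker owns an edge of A.
  threat-breaker : ∀ {f F} A M B → length (free M B) ≡ suc F → f ≤ F →
    ∑ (free M B) (λ e → threat f A M (B ++ [ e ])) ℚ.≤ ι (suc F) ℚ.* threat f A M B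
  threat-breaker {f} {F} A M B len f≤F with any A M
  ... | true = ℚₚ.≤-reflexive (trans (∑-const (free M B) 0ℚ) (trans (ℚₚ.*-zeroʳ (ι (length (free M B)))) (sym (ℚₚ.*-zeroʳ (ι (suc F))))))
  ... | false rewrite len = go (count A (free M B)) refl
    where
    xs = free M B
    x = hit f F
    after : ∀ {e} → e ∈ xs → length (free M (B ++ [ e ])) ≡ F
    after {e} e∈ = trans (cong length (free-breaker M B e))
      (ℕₚ.suc-injective (trans (sym (length-delete (free-unique M B) e∈)) len))
    count-false : ∀ {e} → A e ≡ false → count A (free M (B ++ [ e ])) ≡ count A xs
    count-false {e} Ae = trans (cong (count A) (free-breaker M B e)) (count-delete-false A xs Ae)
    count-true : ∀ {e} → e ∈ xs → A e ≡ true → suc (count A (free M (B ++ [ e ]))) ≡ count A xs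
    count-true {e} e∈ Ae = trans (cong (suc ∘ count A) (free-breaker M B e)) (sym (count-delete-true A (free-unique M B) e∈ Ae))
    φ : Edge n → ℚ
    φ e = pow (hit f (length (free M (B ++ [ e ])))) (count A (free M (B ++ [ e ])))
    case-false : ∀ {e} → e ∈ xs → A e ≡ false → φ e ℚ.≤ pow x (count A xs)
    case-false e∈ Ae = ℚₚ.≤-reflexive (cong₂ (λ F → pow (hit f F)) (after e∈) (count-false Ae))
    go : ∀ c → count A xs ≡ c → ∑ xs φ ℚ.≤ ι (suc F) ℚ.* pow (hit f (suc F)) c
    -- A is exhausted: the threat no longer depends on the number of free edges and stays 1.
    go zero c≡ = ℚₚ.≤-trans (∑-by-count A xs {φ} {1ℚ} (λ e∈ Ae → ⊥-elim (suc≢0 (trans (count-true e∈ Ae) c≡))) case-false)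
        (ℚₚ.≤-reflexive eq)
      where
      suc≢0 : ∀ {k} → suc k ≢ 0
      suc≢0 ()
      open +-*-Solver
      eq : ι (count A xs) ℚ.* 1ℚ ℚ.+ (ι (length xs) - ι (count A xs)) ℚ.* pow x (count A xs) ≡ ι (suc F) ℚ.* 1ℚ
      eq rewrite c≡ | len | ι-0 = solve 1 (λ l → con 0ℚ :* con 1ℚ :+ (l :- con 0ℚ) :* con 1ℚ := l :* con 1ℚ) refl (ι (suc F))
    go (suc a) c≡ = ℚₚ.≤-trans (∑-by-count A xs {φ} {pow x a} {pow x (suc a)}
          (λ e∈ Ae → ℚₚ.≤-reflexive (cong₂ (λ F → pow (hit f F)) (after e∈) (ℕₚ.suc-injective (trans (count-true e∈ Ae) c≡))))
          (λ {e} e∈ Ae → subst (λ c → φ e ℚ.≤ pow x c) c≡ (case-false e∈ Ae)))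
        (transport (hit-bernoulli a f≤F))
      where
      transport : ι (suc a) ℚ.* pow x a ℚ.+ (ι (suc F) - ι (suc a)) ℚ.* pow x (suc a) ℚ.≤ ι (suc F) ℚ.* pow (hit f (suc F)) (suc a) →
        ι (count A xs) ℚ.* pow x a ℚ.+ (ι (length xs) - ι (count A xs)) ℚ.* pow x (suc a) ℚ.≤ ι (suc F) ℚ.* pow (hit f (suc F)) (suc a)
      transport h rewrite c≡ | len = h

  -- A claim inside A kills the threat. A claim outside keeps the exponent and lowers the base,
  -- since fewer free edges are left before the horizon.
  threat-maker : ∀ {f F e} A M B → length (free M B) ≡ suc F → f ≤ F → e ∈ free M B →
    threat f A (M ++ [ e ]) B ℚ.≤ threat f A M B
  threat-maker {f} {F} {e} A M B len f≤F e∈ with any A (M ++ [ e ]) in eq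
  ... | true = threat≥0 f A M B
  ... | false rewrite any-++-false A M [ e ] eq | free-maker M B e | len
                    | count-delete-false A {e} (free M B) (any-∈ A (M ++ [ e ]) (∈ₚ.∈-++⁺ʳ M (here refl)) eq)
                    | ℕₚ.suc-injective (trans (sym (length-delete (free-unique M B) e∈)) len)
                    = pow-mono (count A (free M B)) (hit≥0 f F) (hit-mono f≤F)

  danger : ℕ → List (Edge n → Bool) → Edges → Edges → ℚ
  danger f 𝒜 M B = ∑ 𝒜 (λ A → threat f A M B)

  danger-breaker : ∀ {f F} 𝒜 M B → length (free M B) ≡ suc F → f ≤ F →
    ∑ (free M B) (λ e → danger f 𝒜 M (B ++ [ e ])) ℚ.≤ ι (suc F) ℚ.* danger f 𝒜 M B
  danger-breaker {F = F} [] M B len f≤F = ℚₚ.≤-reflexive (trans (∑-const (free M B) 0ℚ) (trans (ℚₚ.*-zeroʳ (ι (length (free M B)))) (sym (ℚₚ.*-zeroʳ (ι (suc F))))))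
  danger-breaker {f} {F} (A ∷ 𝒜) M B len f≤F = ℚₚ.≤-trans
    (ℚₚ.≤-reflexive (∑-+ (free M B) (λ e → threat f A M (B ++ [ e ])) (λ e → danger f 𝒜 M (B ++ [ e ]))))
    (ℚₚ.≤-trans (ℚₚ.+-mono-≤ (threat-breaker A M B len f≤F) (danger-breaker 𝒜 M B len f≤F))
      (ℚₚ.≤-reflexive (sym (ℚₚ.*-distribˡ-+ (ι (suc F)) (threat f A M B) (danger f 𝒜 M B)))))

  danger-maker : ∀ {f F e} 𝒜 M B → length (free M B) ≡ suc F → f ≤ F → e ∈ free M B →
    danger f 𝒜 (M ++ [ e ]) B ℚ.≤ danger f 𝒜 M B
  danger-maker 𝒜 M B len f≤F e∈ = ∑-mono 𝒜 λ {A} _ → threat-maker A M B len f≤F e∈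

  -- An edge set that Breaker has exhausted contributes q^0 = 1 to the danger.
  danger<1⇒free : ∀ {f 𝒜 M B A} → danger f 𝒜 M B ℚ.< 1ℚ → A ∈ 𝒜 → any A M ≡ false →
    ∃ λ e → e ∈ free M B × A e ≡ true
  danger<1⇒free {f} {𝒜} {M} {B} {A} d<1 A∈ ¬AM = count≢0 A (free M B) λ c≡0 →
    ℚₚ.<-irrefl refl (ℚₚ.≤-<-trans (one c≡0) (ℚₚ.≤-<-trans (∑-∈ 𝒜 (λ A → threat≥0 f A M B) A∈) d<1))
    where
    one : count A (free M B) ≡ 0 → 1ℚ ℚ.≤ threat f A M B
    one c≡0 rewrite ¬AM | c≡0 = ℚₚ.≤-refl

-- The game tree

1/suc-inverse : ∀ k → ι (suc k) ℚ.* ((ℤ.+ 1) ℚ./ suc k) ≡ 1ℚ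
-- 1/(k+1) is `hit k (suc k)`, so `hit-spec` applies and no normalised fraction needs to be
-- unfolded.
1/suc-inverse k = trans (cong (λ a → ι (suc k) ℚ.* ((ℤ.+ a) ℚ./ suc k)) (sym (ℕₚ.m+n∸n≡m 1 k)))
  (trans (cong (ι (suc k) ℚ.*_) (sym (hit-suc k k))) (trans (hit-spec k (suc k)) (trans (cong ι (ℕₚ.m+n∸n≡m 1 k)) ι-1)))

1/suc≥0 : ∀ k → 0ℚ ℚ.≤ (ℤ.+ 1) ℚ./ suc k
1/suc≥0 k = subst (λ a → 0ℚ ℚ.≤ (ℤ.+ a) ℚ./ suc k) (ℕₚ.m+n∸n≡m 1 k) (subst (0ℚ ℚ.≤_) (hit-suc k k) (hit≥0 k (suc k)))

length-snoc : ∀ {A : Set} (xs : List A) x → length (xs ++ [ x ]) ≡ suc (length xs)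
length-snoc xs x = trans (Listₚ.length-++ xs) (ℕₚ.+-comm (length xs) 1)

-- Maker's claim books a whole round of b + 1 claims at once, so b of them are still owed.
claim-count : ∀ {N} f l b → suc f + l * suc b ≡ N → f + suc l * suc b ≡ N + b
claim-count f l b refl = solve 3 (λ f l b → f :+ (con 1 :+ l) :* (con 1 :+ b) := con 1 :+ f :+ l :* (con 1 :+ b) :+ b) refl f l b
  where open ℕ-+-*-Solver

module _ {n : ℕ} where

  totalWeight-++ : ∀ (D E : Dist n) → totalWeight (D ++ E) ≡ totalWeight D ℚ.+ totalWeight E
  totalWeight-++ []      E = sym (ℚₚ.+-identityˡ _)
  totalWeight-++ ((q , _) ∷ D) E = trans (cong (q ℚ.+_) (totalWeight-++ D E)) (sym (ℚₚ.+-assoc q (totalWeight D) (totalWeight E)))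

  totalWeight-scale : ∀ q (D : Dist n) → totalWeight (scale q D) ≡ q ℚ.* totalWeight D
  totalWeight-scale q []            = sym (ℚₚ.*-zeroʳ q)
  totalWeight-scale q ((p , _) ∷ D) = trans (cong (q ℚ.* p ℚ.+_) (totalWeight-scale q D)) (sym (ℚₚ.*-distribˡ-+ q p (totalWeight D)))

  totalWeight-mixture : ∀ {A : Set} c (D : A → Dist n) xs →
    totalWeight (concatMap (λ e → scale c (D e)) xs) ≡ c ℚ.* ∑ xs (λ e → totalWeight (D e))
  totalWeight-mixture c D []       = sym (ℚₚ.*-zeroʳ c)
  totalWeight-mixture c D (x ∷ xs) = trans (totalWeight-++ (scale c (D x)) _)
    (trans (cong₂ ℚ._+_ (totalWeight-scale c (D x)) (totalWeight-mixture c D xs)) (sym (ℚₚ.*-distribˡ-+ c _ _)))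

  module _ {P : Outcome n → Set} where

    Pr-weaken : ∀ {D p q} → p ℚ.≤ q → PrAtLeast D P q → PrAtLeast D P p
    Pr-weaken p≤q (S , S⊆D , allP , q≤) = S , S⊆D , allP , ℚₚ.≤-trans p≤q q≤

    Pr-map : ∀ {D p} {Q : Outcome n → Set} → (∀ {o} → P o → Q o) → PrAtLeast D P p → PrAtLeast D Q p
    Pr-map P⇒Q (S , S⊆D , allP , p≤) = S , S⊆D , All.map P⇒Q allP , p≤

    Pr-trivial : ∀ {D p} → p ℚ.≤ 0ℚ → PrAtLeast D P p
    Pr-trivial {D} p≤0 = [] , minimum D , [] , p≤0

    Pr-certain : ∀ {D} → totalWeight D ≡ 1ℚ → All (P ∘ proj₂) D → PrAtLeast D P 1ℚ
    Pr-certain {D} tw allP = D , ⊆-refl , allP , ℚₚ.≤-reflexive (sym tw)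

    Pr-mixture : ∀ {A : Set} {c} {D : A → Dist n} {φ : A → ℚ} → 0ℚ ℚ.≤ c → ∀ xs →
      (∀ {e} → e ∈ xs → PrAtLeast (D e) P (φ e)) →
      PrAtLeast (concatMap (λ e → scale c (D e)) xs) P (c ℚ.* ∑ xs φ)
    Pr-mixture {c = c} 0≤c [] h = Pr-trivial (ℚₚ.≤-reflexive (ℚₚ.*-zeroʳ c))
    Pr-mixture {c = c} {D} {φ} 0≤c (x ∷ xs) h with h (here refl) | Pr-mixture {c = c} {D} {φ} 0≤c xs (h ∘ there)
    ... | S , S⊆D , allP , p≤ | S′ , S′⊆D , allP′ , p≤′ = scale c S ++ S′
      , Sublistₚ.++⁺ (Sublistₚ.map⁺ _ S⊆D) S′⊆D
      , Allₚ.++⁺ (Allₚ.map⁺ allP) allP′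
      , subst₂ ℚ._≤_ (sym (ℚₚ.*-distribˡ-+ c (φ x) (∑ xs φ)))
          (trans (cong (ℚ._+ totalWeight S′) (sym (totalWeight-scale c S))) (sym (totalWeight-++ (scale c S) S′)))
          (ℚₚ.+-mono-≤ (*-monoˡ 0≤c p≤) p≤′)

  module _ (b : ℕ) (σ : Strategy n) where

    mutual
      maker-totalWeight : ∀ f M B → totalWeight (makerTurn b σ f M B) ≡ 1ℚ
      maker-totalWeight zero M B = refl
      maker-totalWeight (suc f) M B with free M B
      ... | [] = refl
      ... | _ ∷ _ with σ M B
      ...   | nothing = refl
      ...   | just e with isFree? e M B
      ...     | yes _ = breaker-totalWeight f b (M ++ [ e ]) B
      ...     | no _  = refl

      breaker-totalWeight : ∀ f r M B → totalWeight (breakerTurn b σ f r M B) ≡ 1ℚ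
      breaker-totalWeight f zero M B = maker-totalWeight f M B
      breaker-totalWeight zero (suc r) M B = refl
      breaker-totalWeight (suc f) (suc r) M B with free M B
      ... | [] = refl
      ... | x ∷ xs = begin
        totalWeight (concatMap (λ e → scale c (breakerTurn b σ f r M (B ++ [ e ]))) (x ∷ xs))
          ≡⟨ totalWeight-mixture c (λ e → breakerTurn b σ f r M (B ++ [ e ])) (x ∷ xs) ⟩
        c ℚ.* ∑ (x ∷ xs) (λ e → totalWeight (breakerTurn b σ f r M (B ++ [ e ])))
          ≡⟨ cong (c ℚ.*_) (∑-ones (x ∷ xs)) ⟩
        c ℚ.* ι (suc (length xs)) ≡⟨ ℚₚ.*-comm c _ ⟩
        ι (suc (length xs)) ℚ.* c ≡⟨ 1/suc-inverse (length xs) ⟩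
        1ℚ ∎
        where
        open ≡-Reasoning
        c = (ℤ.+ 1) ℚ./ suc (length xs)
        ∑-ones : ∀ ys → ∑ ys (λ e → totalWeight (breakerTurn b σ f r M (B ++ [ e ]))) ≡ ι (length ys)
        ∑-ones []       = sym ι-0
        ∑-ones (y ∷ ys) = trans (cong₂ ℚ._+_ (breaker-totalWeight f r M (B ++ [ y ])) (∑-ones ys)) (sym (ι-suc (length ys)))

    All-mixture : ∀ {A : Set} {P : Outcome n → Set} c (D : A → Dist n) xs → (∀ e → All (P ∘ proj₂) (D e)) →
      All (P ∘ proj₂) (concatMap (λ e → scale c (D e)) xs)
    All-mixture c D []       h = []
    All-mixture c D (x ∷ xs) h = Allₚ.++⁺ (Allₚ.map⁺ (h x)) (All-mixture c D xs h)

    -- Every Maker claim but the last one is followed by b Breaker claims.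
    mutual
      maker-claims : ∀ {N} f M B → f + length M * suc b ≡ N →
        All (λ x → length (maker (proj₂ x)) * suc b ≤ N + b) (makerTurn b σ f M B)
      maker-claims zero M B h = claims-bound 0 M h ∷ []
      maker-claims (suc f) M B h with free M B
      ... | [] = claims-bound (suc f) M h ∷ []
      ... | _ ∷ _ with σ M B
      ...   | nothing = claims-bound (suc f) M h ∷ []
      ...   | just e with isFree? e M B
      ...     | no _  = claims-bound (suc f) M h ∷ []
      ...     | yes _ = breaker-claims f b (M ++ [ e ]) B ℕₚ.≤-refl eq
        where
        eq = trans (cong (λ k → f + k * suc b) (length-snoc M e)) (claim-count f (length M) b h)

      claims-bound : ∀ {N} f M → f + length {A = Edge n} M * suc b ≡ N → length M * suc b ≤ N + b
      claims-bound f M h = ℕₚ.m≤n⇒m≤n+o b (subst (length M * suc b ≤_) h (ℕₚ.m≤n+m _ f))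

      breaker-claims : ∀ {N} f r M B → r ≤ b → f + length M * suc b ≡ N + r →
        All (λ x → length (maker (proj₂ x)) * suc b ≤ N + b) (breakerTurn b σ f r M B)
      breaker-claims {N} f zero M B r≤b h = maker-claims f M B (trans h (ℕₚ.+-identityʳ N))
      breaker-claims {N} zero (suc r) M B r≤b h = ℕₚ.≤-trans (ℕₚ.≤-reflexive h) (ℕₚ.+-monoʳ-≤ N r≤b) ∷ []
      breaker-claims {N} (suc f) (suc r) M B r≤b h with free M B
      ... | [] = ℕₚ.≤-trans (ℕₚ.m≤n+m _ (suc f)) (ℕₚ.≤-trans (ℕₚ.≤-reflexive h) (ℕₚ.+-monoʳ-≤ N r≤b)) ∷ []
      ... | x ∷ xs = All-mixture ((ℤ.+ 1) ℚ./ suc (length xs)) (λ e → breakerTurn b σ f r M (B ++ [ e ])) (x ∷ xs) λ e → breaker-claims f r M (B ++ [ e ]) (ℕₚ.<⇒≤ r≤b)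
                       (ℕₚ.suc-injective (trans h (ℕₚ.+-suc N r)))

    -- The game goes on after Maker has reached his goal, so he must keep moving legally; the
    -- winning position survives as a prefix of his claims.
    Extends : List (Edge n) → Outcome n → Set
    Extends M₀ o = legal o ≡ true × ∃ λ rest → maker o ≡ M₀ ++ rest

    module _ (M₀ : List (Edge n))
             (move : ∀ rest B {x xs} → free (M₀ ++ rest) B ≡ x ∷ xs →
               ∃ λ e → σ (M₀ ++ rest) B ≡ just e × e ∈ free (M₀ ++ rest) B) where
      mutual
        maker-extends : ∀ f rest B → All (Extends M₀ ∘ proj₂) (makerTurn b σ f (M₀ ++ rest) B)
        maker-extends zero rest B = (refl , rest , refl) ∷ []
        maker-extends (suc f) rest B with free (M₀ ++ rest) B in eq
        ... | [] = (refl , rest , refl) ∷ []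
        ... | _ ∷ _ with move rest B eq
        ...   | e , σ≡ , e∈ rewrite σ≡ with isFree? e (M₀ ++ rest) B
        ...     | yes _ rewrite Listₚ.++-assoc M₀ rest [ e ] = breaker-extends f b (rest ++ [ e ]) B
        ...     | no e∉ = ⊥-elim (e∉ e∈)

        breaker-extends : ∀ f r rest B → All (Extends M₀ ∘ proj₂) (breakerTurn b σ f r (M₀ ++ rest) B)
        breaker-extends f zero rest B = maker-extends f rest B
        breaker-extends zero (suc r) rest B = (refl , rest , refl) ∷ []
        breaker-extends (suc f) (suc r) rest B with free (M₀ ++ rest) B
        ... | [] = (refl , rest , refl) ∷ []
        ... | x ∷ xs = All-mixture ((ℤ.+ 1) ℚ./ suc (length xs)) (λ e → breakerTurn b σ f r (M₀ ++ rest) (B ++ [ e ])) (x ∷ xs) λ e → breaker-extends f r rest (B ++ [ e ])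

    makerTurn-move : ∀ {F M B x xs e} → free M B ≡ x ∷ xs → σ M B ≡ just e → e ∈ free M B →
      makerTurn b σ (suc F) M B ≡ breakerTurn b σ F b (M ++ [ e ]) B
    makerTurn-move {F} {M} {B} {e = e} fr σ≡ e∈ with free M B in eq
    makerTurn-move {F} {M} {B} {e = e} refl σ≡ e∈ | x ∷ xs rewrite σ≡ with isFree? e M B
    ... | yes _ = refl
    ... | no e∉ = ⊥-elim (e∉ (subst (e ∈_) (sym eq) e∈))

    -- Optional stopping over one Breaker turn: the lower bound 1 - Ψ is carried backwards through r
    -- random claims. The condition f + r ≤ F keeps all of them above the horizon, where the
    -- supermartingale inequality is available.
    breaker-potential : ∀ {P f M} (Ψ : List (Edge n) → ℚ) →
      (∀ {F} B → length (free M B) ≡ suc F → f ≤ F → ∑ (free M B) (λ e → Ψ (B ++ [ e ])) ℚ.≤ ι (suc F) ℚ.* Ψ B) →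
      ∀ r F B → length (free M B) ≡ F → f + r ≤ F →
      (∀ F′ B′ → length (free M B′) ≡ F′ → F′ + r ≡ F → PrAtLeast (makerTurn b σ F′ M B′) P (1ℚ - Ψ B′)) →
      PrAtLeast (breakerTurn b σ F r M B) P (1ℚ - Ψ B)
    breaker-potential Ψ step zero F B len f≤ next = next F B len (ℕₚ.+-identityʳ F)
    breaker-potential {f = f} Ψ step (suc r) zero B len f≤ next with subst (_≤ 0) (ℕₚ.+-suc f r) f≤
    ... | ()
    breaker-potential {P} {f} {M} Ψ step (suc r) (suc F) B len f≤ next with free M B in eq
    ... | x ∷ xs = Pr-weaken ≤c (Pr-mixture (1/suc≥0 (length xs)) (x ∷ xs) λ {e} e∈ →
          breaker-potential Ψ step r F (B ++ [ e ]) (len′ (subst (e ∈_) (sym eq) e∈)) f≤′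
            λ F′ B′ len″ F′+r → next F′ B′ len″ (trans (ℕₚ.+-suc F′ r) (cong suc F′+r)))
      where
      f≤′ : f + r ≤ F
      f≤′ = ℕₚ.≤-pred (subst (_≤ suc F) (ℕₚ.+-suc f r) f≤)
      len₀ : length (free M B) ≡ suc F
      len₀ = trans (cong length eq) len
      len′ : ∀ {e} → e ∈ free M B → length (free M (B ++ [ e ])) ≡ F
      len′ {e} e∈ = ℕₚ.suc-injective (trans (trans (cong (suc ∘ length) (free-breaker M B e))
                      (sym (length-delete (free-unique M B) e∈))) len₀)
      c = (ℤ.+ 1) ℚ./ suc (length xs)
      S = ∑ (x ∷ xs) (λ e → Ψ (B ++ [ e ]))
      S≤ : S ℚ.≤ ι (suc (length xs)) ℚ.* Ψ B
      S≤ = transport (step B len₀ (ℕₚ.≤-trans (ℕₚ.m≤m+n f r) f≤′))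
        where
        transport : ∑ (free M B) (λ e → Ψ (B ++ [ e ])) ℚ.≤ ι (suc F) ℚ.* Ψ B → S ℚ.≤ ι (suc (length xs)) ℚ.* Ψ B
        transport h rewrite eq | len = h
      ≤c : 1ℚ - Ψ B ℚ.≤ c ℚ.* ∑ (x ∷ xs) (λ e → 1ℚ - Ψ (B ++ [ e ]))
      -- With N free edges and c = 1/N, 1 - Ψ equals c (N - N Ψ), and N Ψ bounds the sum over
      -- Breaker's choices.
      ≤c = ℚₚ.≤-trans (ℚₚ.≤-reflexive eq₁) (ℚₚ.≤-trans
        (*-monoˡ (1/suc≥0 (length xs)) (ℚₚ.+-monoʳ-≤ (ι (suc (length xs))) (ℚₚ.neg-antimono-≤ S≤)))
        (ℚₚ.≤-reflexive (cong (c ℚ.*_) (sym (∑-complement (x ∷ xs) (λ e → Ψ (B ++ [ e ])))))))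
        where
        open +-*-Solver
        eq₁ : 1ℚ - Ψ B ≡ c ℚ.* (ι (suc (length xs)) - ι (suc (length xs)) ℚ.* Ψ B)
        eq₁ = trans (cong (1ℚ -_) (sym (ℚₚ.*-identityˡ (Ψ B)))) (trans (cong₂ (λ u v → u - v ℚ.* Ψ B) (sym (1/suc-inverse (length xs))) (sym (1/suc-inverse (length xs))))
          (solve 3 (λ N c p → N :* c :- N :* c :* p := c :* (N :- N :* p)) refl (ι (suc (length xs))) c (Ψ B)))

-- Sublists, blocks and matchings along a path

module _ {A : Set} where

  AllPairs-⊆ : {R : A → A → Set} {xs ys : List A} → xs ⊆ ys → AllPairs R ys → AllPairs R xs
  AllPairs-⊆ ⊆[]         []       = []
  AllPairs-⊆ (y ⊆∷ʳ s)   (_ ∷ ps) = AllPairs-⊆ s ps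
  AllPairs-⊆ (refl ⊆∷ s) (p ∷ ps) = Sublistₚ.All-resp-⊆ s p ∷ AllPairs-⊆ s ps

  AllPairs-++⁻ : {R : A → A → Set} (xs : List A) {ys : List A} → AllPairs R (xs ++ ys) →
    ∀ {x y} → x ∈ xs → y ∈ ys → R x y
  AllPairs-++⁻ (x ∷ xs) (p ∷ _)  (here refl) y∈ = All.lookup p (∈ₚ.∈-++⁺ʳ xs y∈)
  AllPairs-++⁻ (x ∷ xs) (_ ∷ ps) (there x∈)  y∈ = AllPairs-++⁻ xs ps x∈ y∈

  concat-⊆ : {xss yss : List (List A)} → xss ⊆ yss → concat xss ⊆ concat yss
  concat-⊆ ⊆[]         = ⊆-refl
  concat-⊆ (ys ⊆∷ʳ s)  = Sublistₚ.++⁺ˡ ys (concat-⊆ s)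
  concat-⊆ (refl ⊆∷ s) = Sublistₚ.++⁺ ⊆-refl (concat-⊆ s)

  length-concat : ∀ d (xss : List (List A)) → All (λ xs → length xs ≡ d) xss → length (concat xss) ≡ length xss * d
  length-concat d []         []       = refl
  length-concat d (xs ∷ xss) (p ∷ ps) = trans (Listₚ.length-++ xs) (cong₂ _+_ p (length-concat d xss ps))

  choose : ℕ → List A → List (List A)
  choose zero    xs       = [] ∷ []
  choose (suc k) []       = []
  choose (suc k) (x ∷ xs) = map (x ∷_) (choose k xs) ++ choose (suc k) xs

  choose-⊆ : ∀ k xs {S} → S ∈ choose k xs → S ⊆ xs × length S ≡ k
  choose-⊆ zero    xs (here refl) = minimum xs , refl
  choose-⊆ (suc k) (x ∷ xs) S∈ with ∈ₚ.∈-++⁻ (map (x ∷_) (choose k xs)) S∈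
  ... | inj₂ S∈′ with choose-⊆ (suc k) xs S∈′
  ...   | s , l = x ⊆∷ʳ s , l
  choose-⊆ (suc k) (x ∷ xs) S∈ | inj₁ S∈′ with ∈ₚ.∈-map⁻ (x ∷_) S∈′
  ... | S′ , S′∈ , refl with choose-⊆ k xs S′∈
  ...   | s , l = refl ⊆∷ s , cong suc l

  ⊆⇒∈-choose : ∀ {S xs} → S ⊆ xs → S ∈ choose (length S) xs
  ⊆⇒∈-choose ⊆[] = here refl
  ⊆⇒∈-choose {[]} (y ⊆∷ʳ s) = here refl
  ⊆⇒∈-choose {_ ∷ S} {xs = x ∷ xs} (y ⊆∷ʳ s)   = ∈ₚ.∈-++⁺ʳ (map (x ∷_) (choose (length S) xs)) (⊆⇒∈-choose s)
  ⊆⇒∈-choose {_ ∷ S} (refl ⊆∷ s) = ∈ₚ.∈-++⁺ˡ (∈ₚ.∈-map⁺ _ (⊆⇒∈-choose s))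

  length-choose : ∀ k x (xs : List A) → length (choose (suc k) (x ∷ xs)) ≡ length (choose k xs) + length (choose (suc k) xs)
  length-choose k x xs = trans (Listₚ.length-++ (map (x ∷_) (choose k xs)))
    (cong (_+ length (choose (suc k) xs)) (Listₚ.length-map (x ∷_) (choose k xs)))

  -- Suited to stars, which select half of a few blocks; the bound by a power of the length below is
  -- for the choice of few among all n vertices.
  length-choose-≤2^ : ∀ k xs → length (choose k xs) ≤ 2 ^ length xs
  length-choose-≤2^ zero    xs       = ℕₚ.m^n>0 2 (length xs)
  length-choose-≤2^ (suc k) []       = z≤n
  length-choose-≤2^ (suc k) (x ∷ xs) rewrite length-choose k x xs | ℕₚ.+-identityʳ (2 ^ length xs) =
    ℕₚ.+-mono-≤ (length-choose-≤2^ k xs) (length-choose-≤2^ (suc k) xs)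

  length-choose-≤^ : ∀ k xs → length (choose k xs) ≤ length xs ^ k
  length-choose-≤^ zero    xs       = s≤s z≤n
  length-choose-≤^ (suc k) []       = z≤n
  length-choose-≤^ (suc k) (x ∷ xs) rewrite length-choose k x xs =
    ℕₚ.+-mono-≤ (ℕₚ.≤-trans (length-choose-≤^ k xs) (ℕₚ.^-monoˡ-≤ k (ℕₚ.n≤1+n l)))
      (ℕₚ.≤-trans (length-choose-≤^ (suc k) xs) (ℕₚ.*-monoʳ-≤ l (ℕₚ.^-monoˡ-≤ k (ℕₚ.n≤1+n l))))
    where
    l : ℕ
    l = length xs

  chunks : ℕ → ℕ → List A → List (List A)
  chunks zero    d xs = []
  chunks (suc r) d xs = take d xs ∷ chunks r d (drop d xs)

  concat-chunks-⊆ : ∀ r d xs → concat (chunks r d xs) ⊆ xs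
  concat-chunks-⊆ zero    d xs = minimum xs
  concat-chunks-⊆ (suc r) d xs = subst (take d xs ++ concat (chunks r d (drop d xs)) ⊆_) (Listₚ.take++drop≡id d xs)
    (Sublistₚ.++⁺ ⊆-refl (concat-chunks-⊆ r d (drop d xs)))

  length-chunks : ∀ r d xs → length (chunks r d xs) ≡ r
  length-chunks zero    d xs = refl
  length-chunks (suc r) d xs = cong suc (length-chunks r d (drop d xs))

  chunks-full : ∀ r d xs → length xs ≡ r * d → All (λ b → length b ≡ d) (chunks r d xs)
  chunks-full zero    d xs len = []
  chunks-full (suc r) d xs len =
    trans (Listₚ.length-take d xs) (ℕₚ.m≤n⇒m⊓n≡m (subst (d ≤_) (sym len) (ℕₚ.m≤m+n d (r * d))))
    ∷ chunks-full r d (drop d xs) (trans (Listₚ.length-drop d xs) (trans (cong (_∸ d) len) (ℕₚ.m+n∸m≡n d (r * d))))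

  length-filter-mono : {P Q : Pred A 0ℓ} (P? : Decidable P) (Q? : Decidable Q) → ∀ xs →
    (∀ {x} → x ∈ xs → P x → Q x) → length (filter P? xs) ≤ length (filter Q? xs)
  length-filter-mono P? Q? []       h = z≤n
  length-filter-mono P? Q? (x ∷ xs) h with P? x | Q? x
  ... | yes p | yes q = s≤s (length-filter-mono P? Q? xs (h ∘ there))
  ... | yes p | no ¬q = ⊥-elim (¬q (h (here refl) p))
  ... | no ¬p | yes q = ℕₚ.m≤n⇒m≤1+n (length-filter-mono P? Q? xs (h ∘ there))
  ... | no ¬p | no ¬q = length-filter-mono P? Q? xs (h ∘ there)

  filter-delete₂ : {P Q : Pred A 0ℓ} (_≟_ : DecidableEquality A) (P? : Decidable P) (Q? : Decidable Q) → ∀ {a b} →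
    (∀ {x} → P x → Q x × x ≢ a × x ≢ b) → (∀ {x} → Q x → x ≢ a → x ≢ b → P x) → ∀ xs →
    filter P? xs ≡ Deletion.delete _≟_ b (Deletion.delete _≟_ a (filter Q? xs))
  filter-delete₂ _≟_ P? Q? {a} {b} to from xs = trans
    (filter-∩ P? (λ x → Q? x ×-dec ¬? (x ≟ a)) (λ x → ¬? (x ≟ b)) (λ p → (proj₁ (to p) , proj₁ (proj₂ (to p))) , proj₂ (proj₂ (to p)))
      (λ q r → from (proj₁ q) (proj₂ q) r) xs)
    (cong (filter (λ x → ¬? (x ≟ b))) (filter-∩ (λ x → Q? x ×-dec ¬? (x ≟ a)) Q? (λ x → ¬? (x ≟ a)) id _,_ xs))

module _ {A : Set} where

  -- As the concatenation has no repetitions, w lies in at most one of the lists, and only that list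
  -- can lose the property.
  length-filter-spoil : {P Q : Pred (List A) 0ℓ} (P? : Decidable P) (Q? : Decidable Q) {w : A} → ∀ xss → Unique (concat xss) →
    (∀ {xs} → xs ∈ xss → P xs → w ∉ xs → Q xs) → length (filter P? xss) ≤ suc (length (filter Q? xss))
  length-filter-spoil P? Q? [] u h = z≤n
  length-filter-spoil P? Q? {w} (xs ∷ xss) u h with P? xs | Q? xs
  ... | yes p | yes q = s≤s (length-filter-spoil P? Q? xss (AllPairs-⊆ (Sublistₚ.++⁺ˡ xs ⊆-refl) u) (h ∘ there))
  ... | no ¬p | yes q = ℕₚ.m≤n⇒m≤1+n (length-filter-spoil P? Q? xss (AllPairs-⊆ (Sublistₚ.++⁺ˡ xs ⊆-refl) u) (h ∘ there))
  ... | no ¬p | no ¬q = length-filter-spoil P? Q? xss (AllPairs-⊆ (Sublistₚ.++⁺ˡ xs ⊆-refl) u) (h ∘ there)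
  ... | yes p | no ¬q = s≤s (length-filter-mono P? Q? xss λ {ys} ys∈ pys → h (there ys∈) pys λ w∈ys →
          ¬q (h (here refl) p λ w∈xs → AllPairs-++⁻ xs u w∈xs (∈ₚ.∈-concat⁺′ w∈ys ys∈) refl))

allFin-sorted : ∀ n → AllPairs (λ x y → toℕ x < toℕ y) (allFin n)
allFin-sorted n = AllPairsₚ.tabulate⁺-< id

-- Adjacency in the square of the path 0, 1, 2, ..., oriented as on the board.
Near : ∀ {n} → Edge n → Set
Near (x , y) = toℕ x < toℕ y × toℕ y ≤ 2 + toℕ x

module _ {n R : ℕ} where

  private
    odd-neighbour : ∀ x → ∃ λ z → ¬ 2 ∣ z × x < z × z ≤ 2 + x
    odd-neighbour x with 2 ∣? suc x
    ... | no odd  = suc x , odd , ℕₚ.n<1+n x , ℕₚ.n≤1+n (suc x)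
    ... | yes even = suc (suc x) , (λ even′ → 2∤1 (Div.∣m+n∣m⇒∣n (subst (2 ∣_) (ℕₚ.+-comm 1 (suc x)) even′) even))
                   , ℕₚ.m<n⇒m<1+n (ℕₚ.n<1+n x) , ℕₚ.≤-refl
      where
      2∤1 : ¬ 2 ∣ 1
      2∤1 d with Div.∣1⇒≡1 d
      ... | ()

  -- Pairs consecutive survivors in increasing order; as no odd vertex is missing, their distance is
  -- at most 2. The bound `lo` makes the hypothesis on odd vertices inductive: it speaks only of the
  -- part of the path not yet paired.
  pair-up : ∀ lo (ks : List (Fin n)) → AllPairs (λ x y → toℕ x < toℕ y) ks → All (λ k → lo ≤ toℕ k × toℕ k < R) ks →
    (∀ z → lo ≤ toℕ z → toℕ z < R → ¬ 2 ∣ toℕ z → z ∈ ks) → 2 ∣ length ks →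
    ∃ λ (Mt : List (Edge n)) → All (λ e → Near e × proj₁ e ∈ ks × proj₂ e ∈ ks) Mt × AllPairs Disjoint Mt
      × (∀ {v} → v ∈ ks → Any (Incident v) Mt)
  pair-up lo [] sorted range odds even = [] , [] , [] , λ ()
  pair-up lo (x ∷ []) sorted range odds (divides zero ())
  pair-up lo (x ∷ []) sorted range odds (divides (suc q) ())
  pair-up lo (x ∷ y ∷ ks) ((x<y ∷ x<ks) ∷ (y<ks ∷ sorted)) ((lo≤x , x<R) ∷ (lo≤y , y<R) ∷ range) odds even
    with pair-up (suc (toℕ y)) ks sorted (All.zipWith (λ (y<k , _ , k<R) → y<k , k<R) (y<ks , range)) odds′ (even′ even)
    where
    odds′ : ∀ z → suc (toℕ y) ≤ toℕ z → toℕ z < R → ¬ 2 ∣ toℕ z → z ∈ ks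
    odds′ z y<z z<R odd with odds z (ℕₚ.≤-trans lo≤y (ℕₚ.<⇒≤ y<z)) z<R odd
    ... | here refl         = ⊥-elim (ℕₚ.<-asym x<y y<z)
    ... | there (here refl) = ⊥-elim (ℕₚ.<-irrefl refl y<z)
    ... | there (there z∈)  = z∈
    even′ : 2 ∣ suc (suc (length ks)) → 2 ∣ length ks
    even′ e = Div.∣m+n∣m⇒∣n {2} {2} e Div.∣-refl
  ... | Mt , near , disjoint , cover = (x , y) ∷ Mt
    , ((x<y , gap) , here refl , there (here refl)) ∷ All.map (λ (p , q , r) → p , there (there q) , there (there r)) near
    , All.map apart near ∷ disjoint
    , λ { (here refl) → here (inj₁ refl) ; (there (here refl)) → here (inj₂ refl) ; (there (there v∈)) → there (cover v∈) }
    where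
    -- If y lay beyond the first odd z after x, then z would be a survivor strictly between two
    -- consecutive ones.
    gap : toℕ y ≤ 2 + toℕ x
    gap with odd-neighbour (toℕ x)
    ... | z , odd , x<z , z≤2+x with toℕ y ℕₚ.≤? z
    ...   | yes y≤z = ℕₚ.≤-trans y≤z z≤2+x
    ...   | no y≰z = ⊥-elim (absurd (odds z′ (ℕₚ.≤-trans lo≤x (ℕₚ.<⇒≤ x<z′)) (ℕₚ.<-trans z′<y y<R) (subst (λ t → ¬ 2 ∣ t) (sym z≡) odd)))
      where
      z′ : Fin n
      z′ = fromℕ< (ℕₚ.<-trans (ℕₚ.≰⇒> y≰z) (Finₚ.toℕ<n y))
      z≡ : toℕ z′ ≡ z
      z≡ = Finₚ.toℕ-fromℕ< _
      x<z′ : toℕ x < toℕ z′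
      x<z′ = subst (toℕ x <_) (sym z≡) x<z
      z′<y : toℕ z′ < toℕ y
      z′<y = subst (_< toℕ y) (sym z≡) (ℕₚ.≰⇒> y≰z)
      absurd : z′ ∈ x ∷ y ∷ ks → ⊥
      absurd (here eq)          = ℕₚ.<-irrefl (cong toℕ (sym eq)) x<z′
      absurd (there (here eq))  = ℕₚ.<-irrefl (cong toℕ eq) z′<y
      absurd (there (there z∈)) = ℕₚ.<-asym z′<y (All.lookup y<ks z∈)
    x∉ : x ∉ ks
    x∉ x∈ = ℕₚ.<-irrefl refl (All.lookup x<ks x∈)
    y∉ : y ∉ ks
    y∉ y∈ = ℕₚ.<-irrefl refl (All.lookup y<ks y∈)
    apart : ∀ {e} → Near e × proj₁ e ∈ ks × proj₂ e ∈ ks → Disjoint (x , y) e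
    apart (_ , p , q) (v , inj₁ refl , inj₁ refl) = x∉ p
    apart (_ , p , q) (v , inj₁ refl , inj₂ refl) = x∉ q
    apart (_ , p , q) (v , inj₂ refl , inj₁ refl) = y∉ p
    apart (_ , p , q) (v , inj₂ refl , inj₂ refl) = y∉ q

-- Maker's strategy

drop-prefix : ∀ {A : Set} (xs ys : List A) → drop (length xs) (xs ++ ys) ≡ ys
drop-prefix []       ys = refl
drop-prefix (x ∷ xs) ys = drop-prefix xs ys

head-filter : ∀ {A : Set} {P : Pred A 0ℓ} (P? : Decidable P) {xs ys : List A} {x} → x ∈ xs → P x →
  ∃ λ y → head (filter P? xs ++ ys) ≡ just y × y ∈ xs × P y
head-filter P? {xs} x∈ px with filter P? xs in eq
... | []    with subst (_ ∈_) eq (∈ₚ.∈-filter⁺ P? x∈ px)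
...   | ()
head-filter P? {xs} x∈ px | y ∷ ys with ∈ₚ.∈-filter⁻ P? {xs = xs} (subst (y ∈_) (sym eq) (here refl))
... | y∈ , py = y , refl , y∈ , py

length-cartesianProduct : ∀ {A B : Set} (xs : List A) (ys : List B) → length (cartesianProduct xs ys) ≡ length xs * length ys
length-cartesianProduct []       ys = refl
length-cartesianProduct (x ∷ xs) ys = trans (Listₚ.length-++ (map (x ,_) ys))
  (cong₂ _+_ (Listₚ.length-map (x ,_) ys) (length-cartesianProduct xs ys))

module _ {n : ℕ} where
  open DecMembership (Finₚ._≟_ {n}) using (_∈?_) public
  private
    Vertices = List (Fin n)
    Edges    = List (Edge n)

  incident? : ∀ (v : Fin n) (e : Edge n) → Dec (Incident v e)
  incident? v e = (v Finₚ.≟ proj₁ e) ⊎-dec (v Finₚ.≟ proj₂ e)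

  Touched : Edges → Fin n → Set
  Touched L v = Any (Incident v) L

  touched? : ∀ L → Decidable (Touched L)
  touched? L v = Any.any? (incident? v) L

  Touched-snoc : ∀ L e {v} → Touched (L ++ [ e ]) v → Touched L v ⊎ v ≡ proj₁ e ⊎ v ≡ proj₂ e
  Touched-snoc L e t with Anyₚ.++⁻ L t
  ... | inj₁ p        = inj₁ p
  ... | inj₂ (here p) = inj₂ p

  -- Oriented: the first endpoint is tested against X only. This suffices because board edges
  -- increase and X is below Y in every use.
  rect : Vertices → Vertices → Edge n → Bool
  rect X Y e = ⌊ (proj₁ e ∈? X) ×-dec (proj₂ e ∈? Y) ⌋

  rect-true⁻ : ∀ X Y {e} → rect X Y e ≡ true → proj₁ e ∈ X × proj₂ e ∈ Y
  rect-true⁻ X Y {e} eq with proj₁ e ∈? X | proj₂ e ∈? Y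
  rect-true⁻ X Y eq | yes p | yes q = p , q
  rect-true⁻ X Y () | yes p | no _
  rect-true⁻ X Y () | no _  | _

  rect-true⁺ : ∀ X Y {e} → proj₁ e ∈ X → proj₂ e ∈ Y → rect X Y e ≡ true
  rect-true⁺ X Y {e} p q with proj₁ e ∈? X | proj₂ e ∈? Y
  ... | yes _ | yes _ = refl
  ... | yes _ | no ¬q = ⊥-elim (¬q q)
  ... | no ¬p | _     = ⊥-elim (¬p p)

  rect-false : ∀ X Y {e} → proj₂ e ∉ Y → rect X Y e ≡ false
  rect-false X Y {e} ¬q with rect X Y e in eq
  ... | false = refl
  ... | true  = ⊥-elim (¬q (proj₂ (rect-true⁻ X Y eq)))

  ∈-allEdges⁺ : ∀ {x y : Fin n} → toℕ x < toℕ y → (x , y) ∈ allEdges n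
  ∈-allEdges⁺ {x} {y} x<y = ∈ₚ.∈-filter⁺ _ (∈ₚ.∈-cartesianProduct⁺ (∈ₚ.∈-allFin x) (∈ₚ.∈-allFin y)) x<y

  ∈-allEdges⁻ : ∀ {e} → e ∈ allEdges n → toℕ (proj₁ e) < toℕ (proj₂ e)
  ∈-allEdges⁻ e∈ = proj₂ (∈ₚ.∈-filter⁻ _ {xs = cartesianProduct (allFin n) (allFin n)} e∈)

  count-rect : ∀ X Y → Unique X → Unique Y → (∀ {x y} → x ∈ X → y ∈ Y → toℕ x < toℕ y) →
    length X * length Y ≤ count (rect X Y) (allEdges n)
  count-rect X Y uX uY X<Y = subst (_≤ count (rect X Y) (allEdges n)) (length-cartesianProduct X Y)
    (count-filter-≥ (rect X Y) (Uniqueₚ.cartesianProduct⁺ uX uY)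
      (λ z∈ → let p , q = ∈ₚ.∈-cartesianProduct⁻ X Y z∈ in ∈-allEdges⁺ (X<Y p q))
      (λ z∈ → let p , q = ∈ₚ.∈-cartesianProduct⁻ X Y z∈ in rect-true⁺ X Y p q))

-- k controls the number of vertices left over by the greedy matching, D the length of a block of slots.
module Clever (n : ℕ) .{{_ : NonZero n}} (k D : ℕ) where
  h r R : ℕ
  h = k + k
  -- At most h blocks are spent on attachments, so twice h leaves h fresh ones for a star.
  r = h + h
  R = 2 * (r * D)

  -- Reduction modulo n only makes the map total; its value is meaningful for i < n.
  vertex : ℕ → Fin n
  vertex i = i DivMod.mod n

  toℕ-vertex : ∀ {i} → i < n → toℕ (vertex i) ≡ i
  toℕ-vertex i<n = trans (Finₚ.toℕ-fromℕ< _) (DivMod.m<n⇒m%n≡m i<n)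

  slots : List (Fin n)
  slots = applyUpTo (λ s → vertex (2 * s)) (r * D)

  blocks : List (List (Fin n))
  blocks = chunks r D slots

  inGadget? : (e : Edge n) → Dec (toℕ (proj₂ e) < R × toℕ (proj₂ e) ≤ 2 + toℕ (proj₁ e))
  inGadget? e = (toℕ (proj₂ e) ℕₚ.<? R) ×-dec (toℕ (proj₂ e) ℕₚ.≤? 2 + toℕ (proj₁ e))

  gadget : List (Edge n)
  gadget = filter inGadget? (allEdges n)

  isOutside? : (v : Fin n) → Dec (R ≤ toℕ v)
  isOutside? v = R ℕₚ.≤? toℕ v

  outside : List (Fin n)
  outside = filter isOutside? (allFin n)

  module _ (L : List (Edge n)) where
    isUntouched? : Decidable (λ v → ¬ Touched L v)
    isUntouched? v = ¬? (touched? L v)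

    isUnmatched? : Decidable (λ v → ¬ Touched L v × R ≤ toℕ v)
    isUnmatched? v = isUntouched? v ×-dec isOutside? v

    untouched unmatched : List (Fin n)
    untouched = filter isUntouched? (allFin n)
    unmatched = filter isUnmatched? (allFin n)

    fresh? : ∀ bl → Dec (All (λ w → ¬ Touched L w) bl)
    fresh? = All.all? (λ w → ¬? (touched? L w))

    freshBlocks : List (List (Fin n))
    freshBlocks = filter fresh? blocks

    Greedy Attach : Edge n → Set
    Greedy e = proj₁ e ∈ unmatched × proj₂ e ∈ unmatched
    Attach e = proj₁ e ∈ concat freshBlocks × proj₂ e ∈ unmatched

    greedy? : Decidable Greedy
    greedy? e = (proj₁ e ∈? unmatched) ×-dec (proj₂ e ∈? unmatched)

    attach? : Decidable Attach
    attach? e = (proj₁ e ∈? concat freshBlocks) ×-dec (proj₂ e ∈? unmatched)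

  -- The phase is read off the position: while the claims form a prefix of `gadget`, the dropped
  -- list starts with the next gadget edge, and afterwards L holds the later claims. Taking the head
  -- of a concatenation encodes the order of preference; the final `free M B` keeps Maker moving
  -- once he has won.
  strategy : Strategy n
  strategy M B = head (drop (length M) gadget ++ filter (greedy? L) (free M B) ++ filter (attach? L) (free M B) ++ free M B)
    where L = drop (length gadget) M

  -- For sorted S the lower half precedes the upper one, so all pairs between them are board edges.
  halves : List (Fin n) → Edge n → Bool
  halves S = rect (take k S) (drop k S)

  star : Fin n × List (List (Fin n)) → Edge n → Bool
  star (v , bls) = rect (concat bls) [ v ]

  halvesFamily starFamily family : List (Edge n → Bool)
  halvesFamily = map halves (choose h (allFin n))
  starFamily   = map star (cartesianProduct outside (choose h blocks))
  family       = halvesFamily ++ starFamily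

  gadgetFamily : List (Edge n → Bool)
  gadgetFamily = map (λ e x → ⌊ x ≟E e ⌋) gadget

  private
    unmatched⁻ : ∀ L {v} → v ∈ unmatched L → ¬ Touched L v × R ≤ toℕ v
    unmatched⁻ L v∈ = proj₂ (∈ₚ.∈-filter⁻ (isUnmatched? L) {xs = allFin n} v∈)

    untouched⁺ : ∀ L {v} → ¬ Touched L v → v ∈ untouched L
    untouched⁺ L {v} ¬t = ∈ₚ.∈-filter⁺ (isUntouched? L) (∈ₚ.∈-allFin v) ¬t

    gadget-below : ∀ {e} → e ∈ gadget → toℕ (proj₁ e) < R × toℕ (proj₂ e) < R
    gadget-below e∈ with ∈ₚ.∈-filter⁻ inGadget? {xs = allEdges n} e∈
    ... | e∈all , y<R , _ = ℕₚ.<-trans (∈-allEdges⁻ e∈all) y<R , y<R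

    gadget-near : ∀ {e} → Near e → toℕ (proj₂ e) < R → e ∈ gadget
    gadget-near (x<y , gap) y<R = ∈ₚ.∈-filter⁺ inGadget? (∈-allEdges⁺ x<y) (y<R , gap)

    -- Second endpoints decide: those of gadget edges lie below R, those of L are touched. Hence the
    -- threat of such a rectangle has not been cancelled by Maker, as `danger<1⇒free` requires.
    rect-unmatched : ∀ L X Y → (∀ {v} → v ∈ Y → v ∈ unmatched L) → any (rect X Y) (gadget ++ L) ≡ false
    rect-unmatched L X Y Y⊆ = any-false (rect X Y) (gadget ++ L) λ {e} e∈ → rect-false X Y (go e∈)
      where
      go : ∀ {e} → e ∈ gadget ++ L → proj₂ e ∉ Y
      go {e} e∈ y∈ with unmatched⁻ L (Y⊆ y∈) | ∈ₚ.∈-++⁻ gadget e∈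
      ... | ¬t , R≤y | inj₁ e∈G = ℕₚ.<-irrefl refl (ℕₚ.≤-<-trans R≤y (proj₂ (gadget-below e∈G)))
      ... | ¬t , R≤y | inj₂ e∈L = ¬t (Any.map (λ { refl → inj₂ refl }) e∈L)

  -- An edge starting at x ends at x+1 or x+2. Endpoints are coded in ℕ, since x+2 need not be a
  -- vertex.
  length-gadget : length gadget ≤ R * 2
  length-gadget = subst₂ _≤_ (Listₚ.length-map code gadget) len
    (length-⊆ (Uniqueₚ.map⁺ code-injective (Uniqueₚ.filter⁺ inGadget? allEdges-unique)) sub)
    where
    code : Edge n → ℕ × ℕ
    code (x , y) = toℕ x , toℕ y
    code-injective : ∀ {e f} → code e ≡ code f → e ≡ f
    code-injective eq = cong₂ _,_ (Finₚ.toℕ-injective (cong proj₁ eq)) (Finₚ.toℕ-injective (cong proj₂ eq))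
    pairs : ℕ → List (ℕ × ℕ)
    pairs i = (i , 1 + i) ∷ (i , 2 + i) ∷ []
    len : length (concat (map pairs (upTo R))) ≡ R * 2
    len = trans (length-concat 2 (map pairs (upTo R)) (Allₚ.map⁺ (All.tabulate λ _ → refl)))
      (cong (_* 2) (trans (Listₚ.length-map pairs (upTo R)) (Listₚ.length-upTo R)))
    sub : ∀ {p} → p ∈ map code gadget → p ∈ concat (map pairs (upTo R))
    sub p∈ with ∈ₚ.∈-map⁻ code p∈
    ... | (x , y) , e∈ , refl with ∈ₚ.∈-filter⁻ inGadget? {xs = allEdges n} e∈
    ...   | e∈all , y<R , gap = ∈ₚ.∈-concat⁺′ near (∈ₚ.∈-map⁺ pairs (∈ₚ.∈-upTo⁺ (ℕₚ.<-trans (∈-allEdges⁻ e∈all) y<R)))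
      where
      near : (toℕ x , toℕ y) ∈ pairs (toℕ x)
      near with ℕₚ.m≤n⇒m<n∨m≡n gap
      ... | inj₁ (s≤s y≤1+x) = here (cong (toℕ x ,_) (ℕₚ.≤-antisym y≤1+x (∈-allEdges⁻ e∈all)))
      ... | inj₂ y≡          = there (here (cong (toℕ x ,_) y≡))

  strategy-gadget : ∀ {M e rest} B → M ++ e ∷ rest ≡ gadget → strategy M B ≡ just e
  strategy-gadget {M} {e} {rest} B eq rewrite sym eq | drop-prefix M (e ∷ rest) = refl

  private
    strategy-late : ∀ L B → strategy (gadget ++ L) B ≡
      head (filter (greedy? L) (free (gadget ++ L) B) ++ filter (attach? L) (free (gadget ++ L) B) ++ free (gadget ++ L) B)
    strategy-late L B rewrite drop-prefix gadget L
      | Listₚ.drop-all (length (gadget ++ L)) gadget (subst (length gadget ≤_) (sym (Listₚ.length-++ gadget)) (ℕₚ.m≤m+n _ (length L))) = refl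

  strategy-legal : ∀ L B {x xs} → free (gadget ++ L) B ≡ x ∷ xs →
    ∃ λ e → strategy (gadget ++ L) B ≡ just e × e ∈ free (gadget ++ L) B
  strategy-legal L B {x} {xs} eq rewrite strategy-late L B
    with filter (greedy? L) (free (gadget ++ L) B) in eq₁ | filter (attach? L) (free (gadget ++ L) B) in eq₂
  ... | y ∷ ys | _      = y , refl , proj₁ (∈ₚ.∈-filter⁻ (greedy? L) (subst (y ∈_) (sym eq₁) (here refl)))
  ... | []     | y ∷ ys = y , refl , proj₁ (∈ₚ.∈-filter⁻ (attach? L) (subst (y ∈_) (sym eq₂) (here refl)))
  ... | []     | []     = x , cong head eq , subst (x ∈_) (sym eq) (here refl)

  -- c is the number of Attach moves made so far.
  record Invariant (L : List (Edge n)) : Set where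
    field
      c            : ℕ
      matching     : AllPairs Disjoint L
      slots-only   : ∀ {v} → Touched L v → toℕ v < R → 2 ∣ toℕ v
      -- A greedy edge uses up two unmatched vertices, an attaching edge only one; the slack c pays
      -- for the difference and bounds the number of moves.
      leftover     : length L * 2 + length (unmatched L) ≤ n + c
      unused       : r ≤ length (freshBlocks L) + c
      -- Once attaching has begun, c plus the number of unmatched vertices never grows, which caps
      -- the attachments at h.
      few-attached : c ≡ 0 ⊎ c + length (unmatched L) ≤ h
      parity       : length (untouched L) + length L * 2 ≡ n

  module _ (R≤n : R ≤ n) where

    slots-spec : ∀ {w} → w ∈ slots → toℕ w < R × 2 ∣ toℕ w
    slots-spec w∈ with ∈ₚ.∈-applyUpTo⁻ (λ s → vertex (2 * s)) w∈
    ... | s , s< , refl = subst (_< R) (sym eq) 2s<R , subst (2 ∣_) (sym eq) (divides s (ℕₚ.*-comm 2 s))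
      where
      2s<R : 2 * s < R
      2s<R = ℕₚ.*-monoʳ-< 2 s<
      eq : toℕ (vertex (2 * s)) ≡ 2 * s
      eq = toℕ-vertex (ℕₚ.<-≤-trans 2s<R R≤n)

    slots-unique : Unique slots
    slots-unique = Uniqueₚ.applyUpTo⁺₁ _ (r * D) λ {i} {j} i<j j< eq → ℕₚ.<⇒≢ (ℕₚ.*-monoʳ-< 2 i<j)
      (trans (sym (toℕ-vertex (ℕₚ.<-≤-trans (ℕₚ.*-monoʳ-< 2 (ℕₚ.<-trans i<j j<)) R≤n)))
        (trans (cong toℕ eq) (toℕ-vertex (ℕₚ.<-≤-trans (ℕₚ.*-monoʳ-< 2 j<) R≤n))))

    concat-blocks-unique : Unique (concat blocks)
    concat-blocks-unique = AllPairs-⊆ (concat-chunks-⊆ r D slots) slots-unique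

    block-spec : ∀ {bl w} → bl ∈ blocks → w ∈ bl → toℕ w < R × 2 ∣ toℕ w
    block-spec bl∈ w∈ = slots-spec (Sublist.lookup (concat-chunks-⊆ r D slots) (∈ₚ.∈-concat⁺′ w∈ bl∈))

    count-halves : ∀ {S} → S ∈ choose h (allFin n) → k * k ≤ count (halves S) (allEdges n)
    count-halves {S} S∈ with choose-⊆ h (allFin n) S∈
    ... | S⊆ , len = subst (_≤ count (halves S) (allEdges n)) (cong₂ _*_ len₁ len₂)
      (count-rect (take k S) (drop k S) (Uniqueₚ.take⁺ k uS) (Uniqueₚ.drop⁺ k uS)
        (AllPairs-++⁻ (take k S) (subst (AllPairs _) (sym (Listₚ.take++drop≡id k S)) (AllPairs-⊆ S⊆ (allFin-sorted n)))))
      where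
      uS : Unique S
      uS = AllPairs-⊆ S⊆ (Uniqueₚ.allFin⁺ n)
      len₁ : length (take k S) ≡ k
      len₁ = trans (Listₚ.length-take k S) (ℕₚ.m≤n⇒m⊓n≡m (subst (k ≤_) (sym len) (ℕₚ.m≤m+n k k)))
      len₂ : length (drop k S) ≡ k
      len₂ = trans (Listₚ.length-drop k S) (trans (cong (_∸ k) len) (ℕₚ.m+n∸m≡n k k))

    count-star : ∀ {p} → p ∈ cartesianProduct outside (choose h blocks) → h * D ≤ count (star p) (allEdges n)
    count-star {v , bls} p∈ with ∈ₚ.∈-cartesianProduct⁻ outside (choose h blocks) p∈
    ... | v∈ , bls∈ with choose-⊆ h blocks bls∈
    ...   | bls⊆ , len = subst (_≤ count (star (v , bls)) (allEdges n))
        (trans (ℕₚ.*-identityʳ _) (trans (length-concat D bls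
          (Sublistₚ.All-resp-⊆ bls⊆ (chunks-full r D slots (Listₚ.length-applyUpTo _ (r * D))))) (cong (_* D) len)))
        (count-rect (concat bls) [ v ] (AllPairs-⊆ (concat-⊆ bls⊆) concat-blocks-unique) ([] ∷ []) below)
      where
      below : ∀ {x y} → x ∈ concat bls → y ∈ [ v ] → toℕ x < toℕ y
      below x∈ (here refl) = ℕₚ.<-≤-trans
        (proj₁ (slots-spec (Sublist.lookup (concat-chunks-⊆ r D slots) (Sublist.lookup (concat-⊆ bls⊆) x∈))))
        (proj₂ (∈ₚ.∈-filter⁻ isOutside? {xs = allFin n} v∈))

    invariant-start : Invariant []
    invariant-start = record
      { c = 0 ; matching = [] ; slots-only = λ () ; few-attached = inj₁ refl
      ; leftover = ℕₚ.≤-trans (Listₚ.length-filter (isUnmatched? []) (allFin n)) (ℕₚ.≤-reflexive (trans (Listₚ.length-tabulate {n = n} id) (sym (ℕₚ.+-identityʳ n))))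
      ; unused = ℕₚ.≤-reflexive (sym (trans (ℕₚ.+-identityʳ _) (trans (cong length (Listₚ.filter-all (fresh? []) {blocks}
          (All.tabulate λ _ → All.tabulate λ _ ()))) (length-chunks r D slots))))
      ; parity = trans (ℕₚ.+-identityʳ _) (trans (cong length (Listₚ.filter-all (isUntouched? []) {allFin n} (All.tabulate λ _ ())))
          (Listₚ.length-tabulate {n = n} id)) }

    module _ {L : List (Edge n)} (inv : Invariant L) {e : Edge n} (e∈ : e ∈ allEdges n) where
      open Invariant inv
      open Deletion (Finₚ._≟_ {n}) using () renaming (delete to deleteV; length-delete to length-deleteV; delete-∉ to deleteV-∉)
      private
        L′ = L ++ [ e ]
        a = proj₁ e
        b = proj₂ e
        a≢b : a ≢ b
        a≢b eq = ℕₚ.<⇒≢ (∈-allEdges⁻ e∈) (cong toℕ eq)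

        touched-snoc⁺ : ∀ {v} → Touched L v ⊎ v ≡ a ⊎ v ≡ b → Touched L′ v
        touched-snoc⁺ (inj₁ t) = Anyₚ.++⁺ˡ t
        touched-snoc⁺ (inj₂ i) = Anyₚ.++⁺ʳ L (here i)

        untouched′ : untouched L′ ≡ deleteV b (deleteV a (untouched L))
        untouched′ = filter-delete₂ Finₚ._≟_ (isUntouched? L′) (isUntouched? L)
          (λ ¬t → ¬t ∘ touched-snoc⁺ ∘ inj₁ , (λ eq → ¬t (touched-snoc⁺ (inj₂ (inj₁ eq)))) , (λ eq → ¬t (touched-snoc⁺ (inj₂ (inj₂ eq)))))
          (λ ¬t ≢a ≢b t → Data.Sum.[ ¬t , Data.Sum.[ ≢a , ≢b ]′ ]′ (Touched-snoc L e t)) (allFin n)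

        unmatched′ : unmatched L′ ≡ deleteV b (deleteV a (unmatched L))
        unmatched′ = filter-delete₂ Finₚ._≟_ (isUnmatched? L′) (isUnmatched? L)
          (λ (¬t , R≤) → (¬t ∘ touched-snoc⁺ ∘ inj₁ , R≤) , (λ eq → ¬t (touched-snoc⁺ (inj₂ (inj₁ eq)))) , (λ eq → ¬t (touched-snoc⁺ (inj₂ (inj₂ eq)))))
          (λ (¬t , R≤) ≢a ≢b → (λ t → Data.Sum.[ ¬t , Data.Sum.[ ≢a , ≢b ]′ ]′ (Touched-snoc L e t)) , R≤) (allFin n)

        delete-two : ∀ {xs} → Unique xs → a ∈ xs → b ∈ xs → length xs ≡ 2 + length (deleteV b (deleteV a xs))
        delete-two u a∈ b∈ = trans (length-deleteV u a∈)
          (cong suc (length-deleteV (Uniqueₚ.filter⁺ (λ x → ¬? (x Finₚ.≟ a)) u) (∈ₚ.∈-filter⁺ (λ x → ¬? (x Finₚ.≟ a)) b∈ (a≢b ∘ sym))))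

        matching′ : ¬ Touched L a → ¬ Touched L b → AllPairs Disjoint L′
        matching′ ¬a ¬b = AllPairsₚ.++⁺ matching ([] ∷ []) (All.tabulate λ f∈ →
          (λ { (v , i , inj₁ refl) → ¬a (Any.map (λ { refl → i }) f∈)
             ; (v , i , inj₂ refl) → ¬b (Any.map (λ { refl → i }) f∈) }) ∷ [])

        parity′ : ¬ Touched L a → ¬ Touched L b → length (untouched L′) + length L′ * 2 ≡ n
        parity′ ¬a ¬b = begin
          length (untouched L′) + length L′ * 2        ≡⟨ cong (λ l → length (untouched L′) + l * 2) (length-snoc L e) ⟩
          length (untouched L′) + (2 + length L * 2)   ≡⟨ sym (ℕₚ.+-assoc (length (untouched L′)) 2 _) ⟩
          length (untouched L′) + 2 + length L * 2     ≡⟨ cong (_+ length L * 2) (ℕₚ.+-comm _ 2) ⟩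
          2 + length (untouched L′) + length L * 2     ≡⟨ cong (λ xs → 2 + length xs + length L * 2) untouched′ ⟩
          2 + length (deleteV b (deleteV a (untouched L))) + length L * 2
            ≡⟨ cong (_+ length L * 2) (sym (delete-two (Uniqueₚ.filter⁺ (isUntouched? L) (Uniqueₚ.allFin⁺ n)) (untouched⁺ L ¬a) (untouched⁺ L ¬b))) ⟩
          length (untouched L) + length L * 2          ≡⟨ parity ⟩
          n ∎
          where open ≡-Reasoning

      -- Both endpoints lie outside the gadget, so every block stays fresh and the parity of touched
      -- gadget vertices is not affected.
      invariant-greedy : Greedy L e → Invariant L′
      invariant-greedy (a∈ , b∈) = record
        { c = c ; matching = matching′ (proj₁ (unmatched⁻ L a∈)) (proj₁ (unmatched⁻ L b∈))
        ; slots-only = only ; leftover = left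
        ; unused = ℕₚ.≤-trans unused (ℕₚ.+-monoˡ-≤ c (length-filter-mono (fresh? L) (fresh? L′) blocks still-fresh))
        ; few-attached = Data.Sum.map₂ (ℕₚ.≤-trans (ℕₚ.+-monoʳ-≤ c (ℕₚ.≤-trans (ℕₚ.m≤n+m _ 2) (ℕₚ.≤-reflexive (sym |U|))))) few-attached
        ; parity = parity′ (proj₁ (unmatched⁻ L a∈)) (proj₁ (unmatched⁻ L b∈)) }
        where
        |U| : length (unmatched L) ≡ 2 + length (unmatched L′)
        |U| = trans (delete-two (Uniqueₚ.filter⁺ (isUnmatched? L) (Uniqueₚ.allFin⁺ n)) a∈ b∈) (cong (λ xs → 2 + length xs) (sym unmatched′))
        left : length L′ * 2 + length (unmatched L′) ≤ n + c
        left = subst (_≤ n + c) (trans (cong (length L * 2 +_) |U|) (trans (solve 2 (λ l u → l :* con 2 :+ (con 2 :+ u) := (con 1 :+ l) :* con 2 :+ u) refl (length L) _)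
          (cong (λ l → l * 2 + length (unmatched L′)) (sym (length-snoc L e))))) leftover
          where open ℕ-+-*-Solver
        outer : ∀ {v} → v ≡ a ⊎ v ≡ b → ¬ toℕ v < R
        outer (inj₁ refl) v<R = ℕₚ.<-irrefl refl (ℕₚ.≤-<-trans (proj₂ (unmatched⁻ L a∈)) v<R)
        outer (inj₂ refl) v<R = ℕₚ.<-irrefl refl (ℕₚ.≤-<-trans (proj₂ (unmatched⁻ L b∈)) v<R)
        only : ∀ {v} → Touched L′ v → toℕ v < R → 2 ∣ toℕ v
        only t v<R with Touched-snoc L e t
        ... | inj₁ t′ = slots-only t′ v<R
        ... | inj₂ i  = ⊥-elim (outer i v<R)
        still-fresh : ∀ {bl} → bl ∈ blocks → All (λ w → ¬ Touched L w) bl → All (λ w → ¬ Touched L′ w) bl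
        still-fresh bl∈ fresh = All.tabulate λ {w} w∈ t →
          Data.Sum.[ All.lookup fresh w∈ , (λ i → outer i (proj₁ (block-spec bl∈ w∈))) ]′ (Touched-snoc L e t)

      -- The slot spoils only its own block and is not itself counted as unmatched; c rises by one
      -- exactly as the number of unmatched vertices falls by one.
      invariant-attach : Attach L e → c + length (unmatched L) ≤ h → Invariant L′
      invariant-attach (a∈J , b∈) few with ∈ₚ.∈-concat⁻′ (freshBlocks L) a∈J
      ... | bl , a∈bl , bl∈J with ∈ₚ.∈-filter⁻ (fresh? L) {xs = blocks} bl∈J
      ...   | bl∈ , bl-fresh = record
        { c = suc c ; matching = matching′ ¬a (proj₁ (unmatched⁻ L b∈))
        ; slots-only = only ; leftover = left
        ; unused = ℕₚ.≤-trans unused (ℕₚ.≤-trans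
            (ℕₚ.+-monoˡ-≤ c (length-filter-spoil (fresh? L) (fresh? L′) {a} blocks concat-blocks-unique still-fresh))
            (ℕₚ.≤-reflexive (sym (ℕₚ.+-suc _ c))))
        ; few-attached = inj₂ (subst (_≤ h) (trans (cong (c +_) |U|) (ℕₚ.+-suc c _)) few)
        ; parity = parity′ ¬a (proj₁ (unmatched⁻ L b∈)) }
        where
        a<R : toℕ a < R
        a<R = proj₁ (block-spec bl∈ a∈bl)
        ¬a : ¬ Touched L a
        ¬a = All.lookup bl-fresh a∈bl
        |U| : length (unmatched L) ≡ suc (length (unmatched L′))
        |U| = trans (length-deleteV (Uniqueₚ.filter⁺ (isUnmatched? L) (Uniqueₚ.allFin⁺ n)) b∈)
          (cong suc (cong length (sym (trans unmatched′ (cong (deleteV b) (deleteV-∉ λ a∈ →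
            ℕₚ.<-irrefl refl (ℕₚ.≤-<-trans (proj₂ (unmatched⁻ L a∈)) a<R)))))))
        left : length L′ * 2 + length (unmatched L′) ≤ n + suc c
        left = subst₂ _≤_ (trans (cong (λ u → suc (length L * 2 + u)) |U|) (trans (solve 2 (λ l u → con 1 :+ (l :* con 2 :+ (con 1 :+ u)) := (con 1 :+ l) :* con 2 :+ u) refl (length L) _)
          (cong (λ l → l * 2 + length (unmatched L′)) (sym (length-snoc L e))))) (sym (ℕₚ.+-suc n c)) (s≤s leftover)
          where open ℕ-+-*-Solver
        only : ∀ {v} → Touched L′ v → toℕ v < R → 2 ∣ toℕ v
        only t v<R with Touched-snoc L e t
        ... | inj₁ t′          = slots-only t′ v<R
        ... | inj₂ (inj₁ refl) = proj₂ (block-spec bl∈ a∈bl)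
        ... | inj₂ (inj₂ refl) = ⊥-elim (ℕₚ.<-irrefl refl (ℕₚ.≤-<-trans (proj₂ (unmatched⁻ L b∈)) v<R))
        still-fresh : ∀ {bl′} → bl′ ∈ blocks → All (λ w → ¬ Touched L w) bl′ → a ∉ bl′ → All (λ w → ¬ Touched L′ w) bl′
        still-fresh bl′∈ fresh a∉ = All.tabulate λ {w} w∈ t → go w∈ (Touched-snoc L e t)
          where
          go : ∀ {w} → w ∈ _ → Touched L w ⊎ w ≡ a ⊎ w ≡ b → ⊥
          go w∈ (inj₁ t)           = All.lookup fresh w∈ t
          go w∈ (inj₂ (inj₁ refl)) = a∉ w∈
          go w∈ (inj₂ (inj₂ refl)) = ℕₚ.<-irrefl refl (ℕₚ.≤-<-trans (proj₂ (unmatched⁻ L b∈)) (proj₁ (block-spec bl′∈ w∈)))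

    -- If no greedy edge is free, safety of the halves shows that few vertices are unmatched; enough
    -- blocks are then fresh, and safety of a star at u gives an attaching edge.
    progress : ∀ {f L B u us} → Invariant L → unmatched L ≡ u ∷ us → danger f family (gadget ++ L) B ℚ.< 1ℚ →
      ∃ λ e → strategy (gadget ++ L) B ≡ just e × e ∈ free (gadget ++ L) B × Invariant (L ++ [ e ])
    progress {f} {L} {B} {u} {us} inv U≡ safe rewrite strategy-late L B with filter (greedy? L) (free (gadget ++ L) B) in eq
    ... | e ∷ es = e , refl , e∈ , invariant-greedy inv (proj₁ (∈-free⁻ {M = gadget ++ L} e∈)) greedy
      where
      e∈×greedy : e ∈ free (gadget ++ L) B × Greedy L e
      e∈×greedy = ∈ₚ.∈-filter⁻ (greedy? L) (subst (e ∈_) (sym eq) (here refl))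
      e∈ = proj₁ e∈×greedy
      greedy = proj₂ e∈×greedy
    ... | [] = continue (head-filter (attach? L) (proj₁ (proj₂ attachable)) (proj₂ (proj₂ attachable)))
      where
      open Invariant inv
      U = unmatched L
      U-sorted : U ⊆ allFin n
      U-sorted = Sublistₚ.filter-⊆ (isUnmatched? L) (allFin n)
      no-greedy : ∀ {e} → e ∈ free (gadget ++ L) B → ¬ Greedy L e
      no-greedy {e} e∈ g with subst (e ∈_) eq (∈ₚ.∈-filter⁺ (greedy? L) e∈ g)
      ... | ()
      -- Otherwise the first h unmatched vertices, cut into halves, would be joined by a free edge,
      -- which is a greedy one.
      U<h : length U < h
      U<h = ℕₚ.≰⇒> λ h≤U → contra h≤U
        where
        module _ (h≤U : h ≤ length U) where
          S = take h U
          S⊆U : S ⊆ U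
          S⊆U = Sublistₚ.take-⊆ h U
          S∈ : S ∈ choose h (allFin n)
          S∈ = subst (λ l → S ∈ choose l (allFin n)) (trans (Listₚ.length-take h U) (ℕₚ.m≤n⇒m⊓n≡m h≤U))
            (⊆⇒∈-choose (Sublist.⊆-trans S⊆U U-sorted))
          drop⊆ : ∀ {v} → v ∈ drop k S → v ∈ U
          drop⊆ {v} v∈ = Sublist.lookup S⊆U (subst (v ∈_) (Listₚ.take++drop≡id k S) (∈ₚ.∈-++⁺ʳ (take k S) v∈))
          take⊆ : ∀ {v} → v ∈ take k S → v ∈ U
          take⊆ {v} v∈ = Sublist.lookup S⊆U (subst (v ∈_) (Listₚ.take++drop≡id k S) (∈ₚ.∈-++⁺ˡ v∈))
          contra : ⊥
          contra with danger<1⇒free {f = f} {𝒜 = family} {M = gadget ++ L} {B = B} {A = halves S} safe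
                        (∈ₚ.∈-++⁺ˡ (∈ₚ.∈-map⁺ halves S∈)) (rect-unmatched L (take k S) (drop k S) drop⊆)
          ... | e , e∈ , hit with rect-true⁻ (take k S) (drop k S) hit
          ...   | p , q = no-greedy e∈ (take⊆ p , drop⊆ q)
      few : c + length U ≤ h
      few with few-attached
      ... | inj₁ c≡0 = subst (λ c → c + length U ≤ h) (sym c≡0) (ℕₚ.<⇒≤ U<h)
      ... | inj₂ le  = le
      u∈U : u ∈ U
      u∈U = subst (u ∈_) (sym U≡) (here refl)
      attachable : ∃ λ e → e ∈ free (gadget ++ L) B × Attach L e
      attachable with danger<1⇒free {f = f} {𝒜 = family} {M = gadget ++ L} {B = B} {A = star (u , take h J)} safe
                        (∈ₚ.∈-++⁺ʳ halvesFamily (∈ₚ.∈-map⁺ star (∈ₚ.∈-cartesianProduct⁺ u∈outside J∈)))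
                        (rect-unmatched L (concat (take h J)) [ u ] λ { (here refl) → u∈U })
        where
        J = freshBlocks L
        u∈outside : u ∈ outside
        u∈outside = ∈ₚ.∈-filter⁺ isOutside? (∈ₚ.∈-allFin u) (proj₂ (unmatched⁻ L u∈U))
        -- From h + h ≤ |J| + c and c ≤ h.
        h≤J : h ≤ length J
        h≤J = ℕₚ.+-cancelʳ-≤ h h (length J) (ℕₚ.≤-trans unused (ℕₚ.+-monoʳ-≤ (length J) (ℕₚ.≤-trans (ℕₚ.m≤m+n c (length U)) few)))
        J∈ : take h J ∈ choose h blocks
        J∈ = subst (λ l → take h J ∈ choose l blocks) (trans (Listₚ.length-take h J) (ℕₚ.m≤n⇒m⊓n≡m h≤J))
          (⊆⇒∈-choose (Sublist.⊆-trans (Sublistₚ.take-⊆ h J) (Sublistₚ.filter-⊆ (fresh? L) blocks)))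
      ... | e , e∈ , hit with rect-true⁻ (concat (take h (freshBlocks L))) [ u ] hit
      ...   | p , here refl = e , e∈ , Sublist.lookup (concat-⊆ (Sublistₚ.take-⊆ h (freshBlocks L))) p , u∈U
      continue : (∃ λ e → head (filter (attach? L) (free (gadget ++ L) B) ++ free (gadget ++ L) B) ≡ just e
                   × e ∈ free (gadget ++ L) B × Attach L e) → _
      continue (e , σ≡ , e∈ , att) = e , σ≡ , e∈ , invariant-attach inv (proj₁ (∈-free⁻ {M = gadget ++ L} e∈)) att few

    private
      below : ∀ {L v} → unmatched L ≡ [] → ¬ Touched L v → toℕ v < R
      below {L} {v} U≡ ¬t = ℕₚ.≰⇒> λ R≤v → ∉[] (subst (v ∈_) U≡ (∈ₚ.∈-filter⁺ (isUnmatched? L) (∈ₚ.∈-allFin v) (¬t , R≤v)))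
        where
        ∉[] : v ∉ []
        ∉[] ()

    -- Free of parity, hence valid for odd n as well: an untouched vertex v lies in the gadget and
    -- has the neighbour v+1, or v-1 at the end of the path, which differs from 0 because 1 < R.
    all-touched : ∀ {L} → 1 < R → unmatched L ≡ [] → MinDegreeOne n (gadget ++ L)
    all-touched {L} 1<R U≡ v with touched? L v
    ... | yes t = Anyₚ.++⁺ʳ gadget t
    ... | no ¬t with suc (toℕ v) ℕₚ.<? R
    ...   | yes 1+v<R = Anyₚ.++⁺ˡ (Any.map (λ { refl → inj₁ refl })
            (gadget-near {v , vertex (suc (toℕ v))} (ℕₚ.≤-reflexive (sym eq) , subst (_≤ 2 + toℕ v) (sym eq) (ℕₚ.n≤1+n _)) (subst (_< R) (sym eq) 1+v<R)))
      where
      eq : toℕ (vertex (suc (toℕ v))) ≡ suc (toℕ v)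
      eq = toℕ-vertex (ℕₚ.<-≤-trans 1+v<R R≤n)
    ...   | no 1+v≮R with toℕ v in eq
    ...     | zero  = ⊥-elim (1+v≮R 1<R)
    ...     | suc p = Anyₚ.++⁺ˡ (Any.map (λ { refl → inj₂ refl })
            (gadget-near {vertex p , v} (subst₂ _<_ (sym eq′) (sym eq) (ℕₚ.n<1+n p) , subst₂ (λ x y → y ≤ 2 + x) (sym eq′) (sym eq) (ℕₚ.n≤1+n _))
              (below {L} U≡ ¬t)))
      where
      eq′ : toℕ (vertex p) ≡ p
      eq′ = toℕ-vertex (ℕₚ.<-trans (ℕₚ.n<1+n p) (subst (_< n) eq (Finₚ.toℕ<n v)))

    -- The untouched vertices contain all odd vertices of the gadget, as only slots were used up,
    -- and their number is even because n is. Pairing them along gadget edges completes the matching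
    -- L.
    perfect-matching : ∀ {L} → Invariant L → unmatched L ≡ [] → 2 ∣ n → HasPerfectMatching n (gadget ++ L)
    perfect-matching {L} inv U≡ 2∣n with pair-up {n} {R} 0 (untouched L)
        (AllPairs-⊆ (Sublistₚ.filter-⊆ (isUntouched? L) (allFin n)) (allFin-sorted n))
        (All.tabulate λ v∈ → z≤n , below {L} U≡ (proj₂ (∈ₚ.∈-filter⁻ (isUntouched? L) {xs = allFin n} v∈)))
        (λ z _ z<R odd → untouched⁺ L λ t → odd (slots-only t z<R))
        (Div.∣m+n∣m⇒∣n (subst (2 ∣_) (trans (sym parity) (ℕₚ.+-comm (length (untouched L)) _)) 2∣n) (divides (length L) refl))
      where open Invariant inv
    ... | Mt , near , disjoint , cover = L ++ Mt
      , Allₚ.++⁺ (All.tabulate λ e∈ → ∈ₚ.∈-++⁺ʳ gadget e∈)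
          (All.map (λ (nr , p , q) → ∈ₚ.∈-++⁺ˡ (gadget-near nr (below {L} U≡ (¬touched q)))) near)
      , AllPairsₚ.++⁺ matching disjoint (All.tabulate λ f∈ → All.map (λ (_ , p , q) →
          λ { (v , i , inj₁ refl) → ¬touched p (Any.map (λ { refl → i }) f∈)
            ; (v , i , inj₂ refl) → ¬touched q (Any.map (λ { refl → i }) f∈) }) near)
      , covered
      where
      open Invariant inv
      ¬touched : ∀ {v} → v ∈ untouched L → ¬ Touched L v
      ¬touched v∈ = proj₂ (∈ₚ.∈-filter⁻ (isUntouched? L) {xs = allFin n} v∈)
      covered : ∀ v → Any (Incident v) (L ++ Mt)
      covered v with touched? L v
      ... | yes t = Anyₚ.++⁺ˡ t
      ... | no ¬t = Anyₚ.++⁺ʳ L (cover (untouched⁺ L ¬t))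

-- Playing against the potential

1-mono : ∀ {p q} → p ℚ.≤ q → 1ℚ - q ℚ.≤ 1ℚ - p
1-mono p≤q = ℚₚ.+-monoʳ-≤ 1ℚ (ℚₚ.neg-antimono-≤ p≤q)

1-q≤1 : ∀ {q} → 0ℚ ℚ.≤ q → 1ℚ - q ℚ.≤ 1ℚ
1-q≤1 {q} 0≤q = ℚₚ.≤-trans (1-mono 0≤q) (ℚₚ.≤-reflexive (ℚₚ.+-identityʳ 1ℚ))

1-q≤0 : ∀ {q} → 1ℚ ℚ.≤ q → 1ℚ - q ℚ.≤ 0ℚ
1-q≤0 {q} 1≤q = ℚₚ.≤-trans (1-mono 1≤q) (ℚₚ.≤-reflexive (ℚₚ.+-inverseʳ 1ℚ))

module _ {n : ℕ} where
  -- The properties of the danger that the game argument uses; a sum of dangers with different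
  -- horizons can then be played against like a single one.
  record Potential (f : ℕ) (Ψ : List (Edge n) → List (Edge n) → ℚ) : Set where
    field
      nonneg  : ∀ M B → 0ℚ ℚ.≤ Ψ M B
      breaker-step : ∀ {F} M B → length (free M B) ≡ suc F → f ≤ F →
        ∑ (free M B) (λ e → Ψ M (B ++ [ e ])) ℚ.≤ ι (suc F) ℚ.* Ψ M B
      maker-step   : ∀ {F e} M B → length (free M B) ≡ suc F → f ≤ F → e ∈ free M B → Ψ (M ++ [ e ]) B ℚ.≤ Ψ M B

  danger-potential : ∀ f 𝒜 → Potential f (danger f 𝒜)
  danger-potential f 𝒜 = record
    { nonneg       = λ M B → ∑-≥0 𝒜 λ A → threat≥0 f A M B
    ; breaker-step = danger-breaker 𝒜
    ; maker-step   = danger-maker 𝒜 }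

  -- Raising the horizon only weakens the requirements, so the later stage of the board, g, may be
  -- replaced by f.
  sum-potential : ∀ {f g Φ Ψ} → g ≤ f → Potential f Φ → Potential g Ψ → Potential f (λ M B → Φ M B ℚ.+ Ψ M B)
  sum-potential {f} {g} {Φ} {Ψ} g≤f P Q = record
    { nonneg       = λ M B → ℚₚ.+-mono-≤ (nonneg P M B) (nonneg Q M B)
    ; breaker-step = λ {F} M B len f≤F → ℚₚ.≤-trans
        (ℚₚ.≤-reflexive (∑-+ (free M B) (λ e → Φ M (B ++ [ e ])) (λ e → Ψ M (B ++ [ e ]))))
        (ℚₚ.≤-trans (ℚₚ.+-mono-≤ (breaker-step P M B len f≤F) (breaker-step Q M B len (ℕₚ.≤-trans g≤f f≤F)))
          (ℚₚ.≤-reflexive (sym (ℚₚ.*-distribˡ-+ (ι (suc F)) (Φ M B) (Ψ M B)))))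
    ; maker-step   = λ M B len f≤F e∈ → ℚₚ.+-mono-≤ (maker-step P M B len f≤F e∈) (maker-step Q M B len (ℕₚ.≤-trans g≤f f≤F) e∈) }
    where open Potential

  module _ (b : ℕ) (σ : Strategy n) {P : Outcome n → Set} {f Ψ} (pot : Potential f Ψ) {N : ℕ} where
    open Potential pot

    -- One full round. The clock says that free edges and completed rounds make up the board; the
    -- horizon condition says that at least f edges stay free after this round.
    potential-turn : ∀ {M B e F} → σ M B ≡ just e → e ∈ free M B → length (free M B) ≡ F →
      F + length M * suc b ≡ N → f + suc (length M) * suc b ≤ N →
      (∀ F′ B′ → F′ < F → length (free (M ++ [ e ]) B′) ≡ F′ → F′ + length (M ++ [ e ]) * suc b ≡ N →
        PrAtLeast (makerTurn b σ F′ (M ++ [ e ]) B′) P (1ℚ - Ψ (M ++ [ e ]) B′)) →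
      PrAtLeast (makerTurn b σ F M B) P (1ℚ - Ψ M B)
    potential-turn {M} {B} {e} {F} σ≡ e∈ len clock horizon next = go (free M B) refl
      where
      go : ∀ xs → free M B ≡ xs → PrAtLeast (makerTurn b σ F M B) P (1ℚ - Ψ M B)
      go [] eq with subst (e ∈_) eq e∈
      ... | ()
      go (x ∷ xs) eq = subst (λ F → PrAtLeast (makerTurn b σ F M B) P (1ℚ - Ψ M B)) (sym F≡)
        (subst (λ D → PrAtLeast D P (1ℚ - Ψ M B)) (sym (makerTurn-move b σ {length xs} eq σ≡ e∈))
          (Pr-weaken (1-mono (maker-step M B (trans len F≡) (ℕₚ.≤-trans (ℕₚ.m≤m+n f b) room) e∈))
            (breaker-potential b σ (Ψ (M ++ [ e ])) (λ B′ → breaker-step (M ++ [ e ]) B′) b (length xs) B len′ room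
              λ F′ B′ len″ F′+b → next F′ B′
                (subst (F′ <_) (sym F≡) (s≤s (subst (F′ ≤_) F′+b (ℕₚ.m≤m+n F′ b)))) len″ (clock′ F′+b))))
        where
        F≡ : F ≡ suc (length xs)
        F≡ = trans (sym len) (cong length eq)
        len′ : length (free (M ++ [ e ]) B) ≡ length xs
        len′ = ℕₚ.suc-injective (trans (trans (cong (suc ∘ length) (free-maker M B e)) (sym (length-delete (free-unique M B) e∈))) (cong length eq))
        room : f + b ≤ length xs
        room = ℕₚ.≤-pred (ℕₚ.+-cancelʳ-≤ (length M * suc b) _ _ (subst₂ _≤_
          (trans (sym (ℕₚ.+-assoc f (suc b) _)) (cong (_+ length M * suc b) (ℕₚ.+-suc f b)))
          (trans (sym clock) (cong (_+ length M * suc b) F≡)) horizon))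
        clock′ : ∀ {F′} → F′ + b ≡ length xs → F′ + length (M ++ [ e ]) * suc b ≡ N
        clock′ {F′} F′+b = trans (cong (λ l → F′ + l * suc b) (length-snoc M e))
          (trans (sym (ℕₚ.+-assoc F′ (suc b) _)) (trans (cong (_+ length M * suc b)
            (trans (ℕₚ.+-suc F′ b) (trans (cong suc F′+b) (sym F≡)))) clock))

-- One event for all three claims: degrees for every n, a matching for even n, and both already
-- within the first T moves.
Won : ∀ {n} → ℕ → Outcome n → Set
Won {n} T o = legal o ≡ true × ∃ λ M₀ → (∃ λ rest → maker o ≡ M₀ ++ rest) × length M₀ ≤ T × MinDegreeOne n M₀
                × (2 ∣ n → HasPerfectMatching n M₀)

module Play (n : ℕ) .{{_ : NonZero n}} (k D b : ℕ) where
  open Clever n k D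

  private
    g N : ℕ
    g = length gadget
    N = length (allEdges n)

  module _ (R≤n : R ≤ n) (1<R : 1 < R) {f f₁ T : ℕ}
           (f-spec : f + T * suc b ≡ N) (f₁-spec : f₁ + g * suc b ≡ N)
           (T-spec : ∀ {l} → l * 2 ≤ n + h → g + l ≤ T) where

    f≤f₁ : f ≤ f₁
    f≤f₁ = ℕₚ.+-cancelʳ-≤ (g * suc b) f f₁ (ℕₚ.≤-trans
      (ℕₚ.+-monoʳ-≤ f (ℕₚ.*-monoˡ-≤ (suc b) (subst (_≤ T) (ℕₚ.+-identityʳ g) (T-spec {0} z≤n))))
      (ℕₚ.≤-reflexive (trans f-spec (sym f₁-spec))))

    short : ∀ {L} → Invariant L → length (gadget ++ L) ≤ T
    short {L} inv = subst (_≤ T) (sym (Listₚ.length-++ gadget)) (T-spec (ℕₚ.≤-trans (ℕₚ.m+n≤o⇒m≤o (length L * 2) leftover) (ℕₚ.+-monoʳ-≤ n c≤h)))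
      where
      open Invariant inv
      c≤h : c ≤ h
      c≤h with few-attached
      ... | inj₁ c≡0 = subst (_≤ h) (sym c≡0) z≤n
      ... | inj₂ le  = ℕₚ.m+n≤o⇒m≤o c le

    -- With nothing left unmatched the result no longer depends on Breaker, so the probability is 1
    -- whatever the danger.
    won-game : ∀ {L} → Invariant L → unmatched L ≡ [] → ∀ F B → PrAtLeast (makerTurn b strategy F (gadget ++ L) B) (Won T) 1ℚ
    won-game {L} inv U≡ F B = Pr-certain (maker-totalWeight b strategy F (gadget ++ L) B)
      (All.map (λ (leg , rest , eq) → leg , gadget ++ L , (rest , eq) , short inv , all-touched R≤n 1<R U≡ , perfect-matching R≤n inv U≡)
        (subst (λ M → All (Extends b strategy (gadget ++ L) ∘ proj₂) (makerTurn b strategy F M B)) (Listₚ.++-identityʳ (gadget ++ L))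
          (maker-extends b strategy (gadget ++ L) move F [] B)))
      where
      move : ∀ rest B {x xs} → free ((gadget ++ L) ++ rest) B ≡ x ∷ xs →
        ∃ λ e → strategy ((gadget ++ L) ++ rest) B ≡ just e × e ∈ free ((gadget ++ L) ++ rest) B
      move rest B rewrite Listₚ.++-assoc gadget L rest = strategy-legal (L ++ rest) B

    -- The recursion is on a bound m for the number of free edges, since a round removes several at
    -- once. A position is won, or unsafe and then the bound is void, or safe and `progress`
    -- supplies a move.
    main-phase : ∀ m {L} B F → Invariant L → F < m → length (free (gadget ++ L) B) ≡ F → F + length (gadget ++ L) * suc b ≡ N →
      PrAtLeast (makerTurn b strategy F (gadget ++ L) B) (Won T) (1ℚ - danger f family (gadget ++ L) B)
    main-phase (suc m) {L} B F inv F<m len clock = cases (unmatched L) refl (danger f family (gadget ++ L) B ℚₚ.<? 1ℚ)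
      where
      pot : Potential f (danger f family)
      pot = danger-potential f family
      cases : ∀ us → unmatched L ≡ us → Dec (danger f family (gadget ++ L) B ℚ.< 1ℚ) →
        PrAtLeast (makerTurn b strategy F (gadget ++ L) B) (Won T) (1ℚ - danger f family (gadget ++ L) B)
      cases []       U≡ _            = Pr-weaken (1-q≤1 (Potential.nonneg pot (gadget ++ L) B)) (won-game inv U≡ F B)
      cases (u ∷ us) U≡ (no unsafe)  = Pr-trivial (1-q≤0 (ℚₚ.≮⇒≥ unsafe))
      cases (u ∷ us) U≡ (yes safe) with progress R≤n {f} {L} {B} inv U≡ safe
      ... | e , σ≡ , e∈ , inv′ = potential-turn b strategy pot σ≡ e∈ len clock horizon next
        where
        horizon : f + suc (length (gadget ++ L)) * suc b ≤ N
        horizon = subst (f + suc (length (gadget ++ L)) * suc b ≤_) f-spec (ℕₚ.+-monoʳ-≤ f (ℕₚ.*-monoˡ-≤ (suc b)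
          (subst (_≤ T) (trans (cong length (sym (Listₚ.++-assoc gadget L [ e ]))) (length-snoc (gadget ++ L) e)) (short inv′))))
        next : ∀ F′ B′ → F′ < F → length (free ((gadget ++ L) ++ [ e ]) B′) ≡ F′ → F′ + length ((gadget ++ L) ++ [ e ]) * suc b ≡ N →
          PrAtLeast (makerTurn b strategy F′ ((gadget ++ L) ++ [ e ]) B′) (Won T) (1ℚ - danger f family ((gadget ++ L) ++ [ e ]) B′)
        next F′ B′ F′<F rewrite Listₚ.++-assoc gadget L [ e ] = main-phase m B′ F′ inv′ (ℕₚ.<-≤-trans F′<F (ℕₚ.≤-pred F<m))

    -- Both dangers are carried along: that of the gadget keeps its next edge free, and that of the
    -- main family must not have grown when the main phase begins.
    gadget-phase : ∀ m {M rest} B F → M ++ rest ≡ gadget → F < m → length (free M B) ≡ F → F + length M * suc b ≡ N →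
      PrAtLeast (makerTurn b strategy F M B) (Won T) (1ℚ - (danger f₁ gadgetFamily M B ℚ.+ danger f family M B))
    -- The gadget is complete, and its nonnegative danger is dropped from the bound.
    gadget-phase m {M} {[]} B F M≡ F<m len clock = Pr-weaken
      (1-mono (subst (ℚ._≤ danger f₁ gadgetFamily M B ℚ.+ danger f family M B) (ℚₚ.+-identityˡ (danger f family M B))
        (ℚₚ.+-monoˡ-≤ (danger f family M B) (Potential.nonneg (danger-potential f₁ gadgetFamily) M B))))
      (subst (λ M → length (free M B) ≡ F → F + length M * suc b ≡ N → PrAtLeast (makerTurn b strategy F M B) (Won T) (1ℚ - danger f family M B))
        M≡′ (main-phase m B F (invariant-start R≤n) F<m) len clock)
      where
      M≡′ : gadget ++ [] ≡ M
      M≡′ = trans (Listₚ.++-identityʳ gadget) (trans (sym M≡) (Listₚ.++-identityʳ M))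
    gadget-phase (suc m) {M} {e ∷ rest} B F M≡ F<m len clock = cases (Ψ M B ℚₚ.<? 1ℚ)
      where
      Ψ : List (Edge n) → List (Edge n) → ℚ
      Ψ M B = danger f₁ gadgetFamily M B ℚ.+ danger f family M B
      pot : Potential f₁ Ψ
      pot = sum-potential f≤f₁ (danger-potential f₁ gadgetFamily) (danger-potential f family)
      same : Edge n → Edge n → Bool
      same e x = ⌊ x ≟E e ⌋
      unique : Unique (M ++ e ∷ rest)
      unique = subst Unique (sym M≡) (Uniqueₚ.filter⁺ inGadget? allEdges-unique)
      unclaimed : any (same e) M ≡ false
      unclaimed = any-false (same e) M λ {x} x∈ → distinct (AllPairs-++⁻ M unique x∈ (here refl))
        where
        distinct : ∀ {x} → x ≢ e → same e x ≡ false
        distinct {x} x≢e with x ≟E e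
        ... | yes x≡e = ⊥-elim (x≢e x≡e)
        ... | no _    = refl
      cases : Dec (Ψ M B ℚ.< 1ℚ) → PrAtLeast (makerTurn b strategy F M B) (Won T) (1ℚ - Ψ M B)
      cases (no unsafe) = Pr-trivial (1-q≤0 (ℚₚ.≮⇒≥ unsafe))
      cases (yes safe)  = potential-turn b strategy pot (strategy-gadget B M≡) e∈ len clock horizon next
        where
        e∈ : e ∈ free M B
        e∈ with danger<1⇒free {f = f₁} {𝒜 = gadgetFamily} {M = M} {B = B} {A = same e}
                  (ℚₚ.≤-<-trans (≤-+≥0 (Potential.nonneg (danger-potential f family) M B)) safe)
                  (∈ₚ.∈-map⁺ same (subst (e ∈_) M≡ (∈ₚ.∈-++⁺ʳ M (here refl)))) unclaimed
        ... | x , x∈ , hit with x ≟E e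
        ...   | yes refl = x∈
        horizon : f₁ + suc (length M) * suc b ≤ N
        horizon = subst (f₁ + suc (length M) * suc b ≤_) f₁-spec (ℕₚ.+-monoʳ-≤ f₁ (ℕₚ.*-monoˡ-≤ (suc b)
          (subst (suc (length M) ≤_) (trans (trans (sym (ℕₚ.+-suc (length M) (length rest))) (sym (Listₚ.length-++ M))) (cong length M≡))
            (s≤s (ℕₚ.m≤m+n (length M) (length rest))))))
        next : ∀ F′ B′ → F′ < F → length (free (M ++ [ e ]) B′) ≡ F′ → F′ + length (M ++ [ e ]) * suc b ≡ N →
          PrAtLeast (makerTurn b strategy F′ (M ++ [ e ]) B′) (Won T) (1ℚ - Ψ (M ++ [ e ]) B′)
        next F′ B′ F′<F = gadget-phase m {rest = rest} B′ F′ (trans (Listₚ.++-assoc M [ e ] rest) M≡) (ℕₚ.<-≤-trans F′<F (ℕₚ.≤-pred F<m))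

    Pr-won : PrAtLeast (game n b strategy) (Won T) (1ℚ - (danger f₁ gadgetFamily [] [] ℚ.+ danger f family [] []))
    Pr-won = gadget-phase (suc N) {[]} {gadget} [] N refl (ℕₚ.n<1+n N) free-all (ℕₚ.+-identityʳ N)
      where
      free-all : length (free {n} [] []) ≡ N
      free-all = cong length (Listₚ.filter-all _ {allEdges n} (All.tabulate λ _ ()))

-- Counting

module _ (n : ℕ) where
  private
    E square : List (Edge n)
    E = allEdges n
    square = cartesianProduct (allFin n) (allFin n)
    swap : Edge n → Edge n
    swap (x , y) = y , x
    E↑ diagonal pieces : List (Edge n)
    E↑ = map swap E
    diagonal = map (λ x → x , x) (allFin n)
    pieces = E ++ E↑ ++ diagonal

    length-pieces : length pieces ≡ length E * 2 + n
    length-pieces = begin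
      length pieces                               ≡⟨ Listₚ.length-++ E ⟩
      length E + length (E↑ ++ diagonal)          ≡⟨ cong (length E +_) (Listₚ.length-++ E↑) ⟩
      length E + (length E↑ + length diagonal)    ≡⟨ cong₂ (λ a b → length E + (a + b)) (Listₚ.length-map swap E)
                                                      (trans (Listₚ.length-map _ (allFin n)) (Listₚ.length-tabulate {n = n} id)) ⟩
      length E + (length E + n)                   ≡⟨ solve 2 (λ e n → e :+ (e :+ n) := e :* con 2 :+ n) refl (length E) n ⟩
      length E * 2 + n ∎
      where
      open ≡-Reasoning
      open ℕ-+-*-Solver

    length-square : length square ≡ n * n
    length-square = trans (length-cartesianProduct (allFin n) (allFin n))
      (cong₂ _*_ (Listₚ.length-tabulate {n = n} id) (Listₚ.length-tabulate {n = n} id))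

    in-square : ∀ {e} → e ∈ square
    in-square {x , y} = ∈ₚ.∈-cartesianProduct⁺ (∈ₚ.∈-allFin x) (∈ₚ.∈-allFin y)

    up : ∀ {e} → e ∈ E↑ → toℕ (proj₂ e) < toℕ (proj₁ e)
    up e∈ with ∈ₚ.∈-map⁻ swap e∈
    ... | f , f∈ , refl = ∈-allEdges⁻ f∈

    diag : ∀ {e} → e ∈ diagonal → toℕ (proj₂ e) ≡ toℕ (proj₁ e)
    diag e∈ with ∈ₚ.∈-map⁻ (λ x → x , x) e∈
    ... | x , _ , refl = refl

    pieces-unique : Unique pieces
    pieces-unique = Uniqueₚ.++⁺ allEdges-unique
      (Uniqueₚ.++⁺ (Uniqueₚ.map⁺ (λ eq → cong swap eq) allEdges-unique) (Uniqueₚ.map⁺ (cong proj₁) (Uniqueₚ.allFin⁺ n))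
        (λ (p , q) → ℕₚ.<⇒≢ (up p) (diag q)))
      λ (p , q) → apart p (∈ₚ.∈-++⁻ E↑ q)
      where
      apart : ∀ {e} → e ∈ E → e ∈ E↑ ⊎ e ∈ diagonal → ⊥
      apart p (inj₁ q) = ℕₚ.<-asym (∈-allEdges⁻ p) (up q)
      apart p (inj₂ q) = ℕₚ.<⇒≢ (∈-allEdges⁻ p) (sym (diag q))

    square⊆pieces : ∀ {e} → e ∈ square → e ∈ pieces
    square⊆pieces {x , y} _ with ℕₚ.<-cmp (toℕ x) (toℕ y)
    ... | tri< x<y _ _ = ∈ₚ.∈-++⁺ˡ (∈-allEdges⁺ x<y)
    ... | tri> _ _ y<x = ∈ₚ.∈-++⁺ʳ E (∈ₚ.∈-++⁺ˡ (∈ₚ.∈-map⁺ swap (∈-allEdges⁺ y<x)))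
    ... | tri≈ _ x≡y _ = ∈ₚ.∈-++⁺ʳ E (∈ₚ.∈-++⁺ʳ E↑ (subst (λ z → (x , z) ∈ diagonal) (Finₚ.toℕ-injective x≡y)
                           (∈ₚ.∈-map⁺ (λ x → x , x) (∈ₚ.∈-allFin x))))

  -- The n² ordered pairs are the edges, their mirror images and the diagonal; this form avoids
  -- halving and truncated subtraction.
  length-allEdges : length (allEdges n) * 2 + n ≡ n * n
  length-allEdges = ℕₚ.≤-antisym
    (subst₂ _≤_ length-pieces length-square (length-⊆ pieces-unique λ _ → in-square))
    (subst₂ _≤_ length-square length-pieces (length-⊆ (Uniqueₚ.cartesianProduct⁺ (Uniqueₚ.allFin⁺ n) (Uniqueₚ.allFin⁺ n)) square⊆pieces))

-- Breaker's side: too few claims above the threshold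

MinDegreeOne⇒n≤2∣G∣ : ∀ {n G} → MinDegreeOne n G → n ≤ length G * 2
MinDegreeOne⇒n≤2∣G∣ {n} {G} deg = subst₂ _≤_ (Listₚ.length-tabulate {n = n} id) len
  (length-⊆ (Uniqueₚ.allFin⁺ n) λ {v} _ → endpoint (deg v))
  where
  ends : Edge n → List (Fin n)
  ends (x , y) = x ∷ y ∷ []
  endpoint : ∀ {v G} → Any (Incident v) G → v ∈ concat (map ends G)
  endpoint (here (inj₁ eq)) = here eq
  endpoint (here (inj₂ eq)) = there (here eq)
  endpoint (there t)        = there (there (endpoint t))
  len : length (concat (map ends G)) ≡ length G * 2
  len = trans (length-concat 2 (map ends G) (Allₚ.map⁺ (All.tabulate λ _ → refl))) (cong (_* 2) (Listₚ.length-map ends G))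

HasPerfectMatching⇒MinDegreeOne : ∀ {n G} → HasPerfectMatching n G → MinDegreeOne n G
HasPerfectMatching⇒MinDegreeOne (Mt , Mt⊆G , _ , cover) v with find (cover v)
... | e , e∈ , i = Any.map (λ { refl → i }) (All.lookup Mt⊆G e∈)

-- With p = n - 2 and β = b + 1 the count gives pβ ≤ p(p + 3), so β ≤ n + 1. Together with (m+2) n <
-- (m+1) β this forces n ≤ m + 1.
too-few-claims : ∀ m {n b l N} → m + 3 ≤ n → N * 2 + n ≡ n * n → l * suc b ≤ N + b → suc (suc m) * n < suc m * suc b → n ≤ l * 2 → ⊥
too-few-claims m {n} {b} {l} {N} big N≡ l≤ b> n≤ with ℕₚ.m≤n⇒∃[o]m+o≡n big
... | t , refl = ℕₚ.<-irrefl refl (ℕₚ.<-≤-trans (ℕₚ.m≤n+m (suc (suc m)) (suc t)) (ℕₚ.≤-trans (ℕₚ.≤-reflexive eq₀) p+2≤m+1))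
  where
  open ℕ-+-*-Solver
  p β : ℕ
  p = suc (m + t)
  β = suc b
  eq₀ : suc t + suc (suc m) ≡ p + 2
  eq₀ = solve 2 (λ m t → con 1 :+ t :+ (con 2 :+ m) := con 1 :+ (m :+ t) :+ con 2) refl m t
  n≡ : m + 3 + t ≡ p + 2
  n≡ = solve 2 (λ m t → m :+ con 3 :+ t := con 1 :+ (m :+ t) :+ con 2) refl m t
  nβ : (p + 2) * β + (p + 2) + 2 ≤ (p + 2) * (p + 2) + β * 2
  nβ = begin
    (p + 2) * β + (p + 2) + 2      ≤⟨ ℕₚ.+-monoˡ-≤ 2 (ℕₚ.+-monoˡ-≤ (p + 2) (ℕₚ.*-monoˡ-≤ β (subst (_≤ l * 2) n≡ n≤))) ⟩
    l * 2 * β + (p + 2) + 2        ≡⟨ solve 3 (λ l β p → l :* con 2 :* β :+ (p :+ con 2) :+ con 2 := l :* β :* con 2 :+ (p :+ con 2) :+ con 2) refl l β p ⟩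
    l * β * 2 + (p + 2) + 2        ≤⟨ ℕₚ.+-monoˡ-≤ 2 (ℕₚ.+-monoˡ-≤ (p + 2) (ℕₚ.*-monoˡ-≤ 2 l≤)) ⟩
    (N + b) * 2 + (p + 2) + 2      ≡⟨ solve 3 (λ N b p → (N :+ b) :* con 2 :+ (p :+ con 2) :+ con 2 := N :* con 2 :+ (p :+ con 2) :+ (con 1 :+ b) :* con 2) refl N b p ⟩
    N * 2 + (p + 2) + β * 2        ≡⟨ cong (_+ β * 2) (subst (λ n → N * 2 + n ≡ n * n) n≡ N≡) ⟩
    (p + 2) * (p + 2) + β * 2      ∎
    where open ℕₚ.≤-Reasoning
  pβ : p * β + (p + 4) ≤ (p + 2) * (p + 2)
  pβ = ℕₚ.+-cancelʳ-≤ (β * 2) _ _ (subst (_≤ (p + 2) * (p + 2) + β * 2)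
    (solve 2 (λ p β → (p :+ con 2) :* β :+ (p :+ con 2) :+ con 2 := p :* β :+ (p :+ con 4) :+ β :* con 2) refl p β) nβ)
  -- The terms common to both sides of the comparison, kept so that no subtraction occurs.
  C : ℕ
  C = p * (suc m * (p + 2)) + suc m * (p + 4)
  scaled : (p + 2) * p + C ≤ suc m * p + C
  scaled = begin
    (p + 2) * p + C                              ≡⟨ solve 2 (λ m p → (p :+ con 2) :* p :+ (p :* ((con 1 :+ m) :* (p :+ con 2)) :+ (con 1 :+ m) :* (p :+ con 4))
                                                      := p :* ((con 2 :+ m) :* (p :+ con 2)) :+ (con 1 :+ m) :* (p :+ con 4)) refl m p ⟩
    p * (suc (suc m) * (p + 2)) + suc m * (p + 4) ≤⟨ ℕₚ.+-monoˡ-≤ _ (ℕₚ.*-monoʳ-≤ p (ℕₚ.<⇒≤ (subst (λ n → suc (suc m) * n < suc m * β) n≡ b>))) ⟩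
    p * (suc m * β) + suc m * (p + 4)            ≡⟨ solve 3 (λ m p β → p :* ((con 1 :+ m) :* β) :+ (con 1 :+ m) :* (p :+ con 4) := (con 1 :+ m) :* (p :* β :+ (p :+ con 4))) refl m p β ⟩
    suc m * (p * β + (p + 4))                    ≤⟨ ℕₚ.*-monoʳ-≤ (suc m) pβ ⟩
    suc m * ((p + 2) * (p + 2))                  ≡⟨ solve 2 (λ m p → (con 1 :+ m) :* ((p :+ con 2) :* (p :+ con 2)) := (con 1 :+ m) :* p :+ (p :* ((con 1 :+ m) :* (p :+ con 2)) :+ (con 1 :+ m) :* (p :+ con 4))) refl m p ⟩
    suc m * p + C ∎
    where open ℕₚ.≤-Reasoning
  p+2≤m+1 : p + 2 ≤ suc m
  p+2≤m+1 = ℕₚ.*-cancelʳ-≤ (p + 2) (suc m) p (ℕₚ.+-cancelʳ-≤ C _ _ scaled)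

-- Breaker wins in every branch as soon as n ≥ m + 3, so the bound on n does not depend on δ.
breaker-wins : ∀ {Win : ∀ n → Outcome n → Set} → (∀ {n o} → Win n o → MinDegreeOne n (maker o)) → ∀ ε → 0ℚ ℚ.< ε →
  (σ : ∀ n → Strategy n) → ∀ δ → 0ℚ ℚ.< δ → ∃ λ N → ∀ n → N ≤ n → PrAtLeast (game n (biasUp ε n) (σ n)) (λ o → ¬ Win n o) (1ℚ - δ)
breaker-wins {Win} win⇒deg ε ε>0 σ δ δ>0 with reciprocal-below ε ε>0
... | m , 1≤mε = m + 3 , λ n m+3≤n → Pr-weaken (1-q≤1 (ℚₚ.<⇒≤ δ>0))
  (Pr-certain (maker-totalWeight (biasUp ε n) (σ n) (length (allEdges n)) [] [])
    (All.map (λ {x} few win → too-few-claims m {l = length (maker (proj₂ x))} m+3≤n (length-allEdges n) few (biasUp-> ε m n 1≤mε)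
        (MinDegreeOne⇒n≤2∣G∣ (win⇒deg {o = proj₂ x} win)))
      (maker-claims (biasUp ε n) (σ n) (length (allEdges n)) [] [] (ℕₚ.+-identityʳ (length (allEdges n))))))

-- Logarithms against n

n<2^[1+j]⇒log≤j : ∀ j n → n < 2 ^ suc j → ⌊log₂ n ⌋ ≤ j
n<2^[1+j]⇒log≤j zero    zero          _ = z≤n
n<2^[1+j]⇒log≤j zero    (suc zero)    _ = z≤n
n<2^[1+j]⇒log≤j zero    (suc (suc n)) (s≤s (s≤s ()))
n<2^[1+j]⇒log≤j (suc j) n n< = ℕₚ.≤-trans (ℕₚ.m≤n+m∸n ⌊log₂ n ⌋ 1)
  (s≤s (subst (_≤ j) (⌊log₂⌊n/2⌋⌋≡⌊log₂n⌋∸1 n) (n<2^[1+j]⇒log≤j j ⌊ n /2⌋ half)))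
  where
  half : ⌊ n /2⌋ < 2 ^ suc j
  half = ℕₚ.≰⇒> λ le → ℕₚ.<-irrefl refl (ℕₚ.<-≤-trans n< (ℕₚ.≤-trans
    (ℕₚ.+-mono-≤ le (subst (_≤ ⌊ n /2⌋) (sym (ℕₚ.+-identityʳ _)) le))
    (ℕₚ.≤-trans (ℕₚ.+-monoʳ-≤ ⌊ n /2⌋ (ℕₚ.⌊n/2⌋≤⌈n/2⌉ n)) (ℕₚ.≤-reflexive (ℕₚ.⌊n/2⌋+⌈n/2⌉≡n n)))))

2^log≤n : ∀ n .{{_ : NonZero n}} → 2 ^ ⌊log₂ n ⌋ ≤ n
2^log≤n n@(suc _) with ⌊log₂ n ⌋ in eq
... | zero  = s≤s z≤n
... | suc j = ℕₚ.≮⇒≥ λ n< → ℕₚ.<-irrefl refl (subst (_≤ j) eq (n<2^[1+j]⇒log≤j j n n<))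

n<2^[1+log] : ∀ n → n < 2 ^ suc ⌊log₂ n ⌋
n<2^[1+log] n = ℕₚ.≰⇒> λ le → ℕₚ.<-irrefl refl (subst (_≤ ⌊log₂ n ⌋) (⌊log₂[2^n]⌋≡n (suc ⌊log₂ n ⌋)) (⌊log₂⌋-mono-≤ le))

-- The constant 8 gives equality at l = 3; from there on the cube at most doubles, as 2(4+t)³ -
-- (5+t)³ = 3 + 21t + 9t² + t³.
cube≤8*2^ : ∀ l → suc l * suc l * suc l ≤ 8 * 2 ^ l
cube≤8*2^ 0 = ℕₚ.m≤m+n 1 7
cube≤8*2^ 1 = ℕₚ.m≤m+n 8 8
cube≤8*2^ 2 = ℕₚ.m≤m+n 27 5
cube≤8*2^ 3 = ℕₚ.m≤m+n 64 0
cube≤8*2^ (suc l@(suc (suc (suc t)))) = begin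
  suc (suc l) * suc (suc l) * suc (suc l) ≤⟨ ℕₚ.m≤m+n _ (3 + 21 * t + 9 * (t * t) + t * t * t) ⟩
  suc (suc l) * suc (suc l) * suc (suc l) + (3 + 21 * t + 9 * (t * t) + t * t * t)
    ≡⟨ solve 1 (λ t → (con 5 :+ t) :* (con 5 :+ t) :* (con 5 :+ t) :+ (con 3 :+ con 21 :* t :+ con 9 :* (t :* t) :+ t :* t :* t)
         := con 2 :* ((con 4 :+ t) :* (con 4 :+ t) :* (con 4 :+ t))) refl t ⟩
  2 * (suc l * suc l * suc l)             ≤⟨ ℕₚ.*-monoʳ-≤ 2 (cube≤8*2^ l) ⟩
  2 * (8 * 2 ^ l)                         ≡⟨ solve 1 (λ x → con 2 :* (con 8 :* x) := con 8 :* (con 2 :* x)) refl (2 ^ l) ⟩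
  8 * 2 ^ suc l                           ∎
  where
  open ℕₚ.≤-Reasoning
  open ℕ-+-*-Solver

-- For n ≥ 2^(8K) and ℓ = 1 + log n, the factor 8K is at most ℓ, so 8Kℓ² ≤ ℓ³ ≤ 8 · 2^(log n) ≤ 8n.
log²-small : ∀ K → ∃ λ N → ∀ n → N ≤ n → K * (suc ⌊log₂ n ⌋ * suc ⌊log₂ n ⌋) ≤ n
log²-small K = 2 ^ (8 * K) , λ n N≤n → go n N≤n
  where
  go : ∀ n → 2 ^ (8 * K) ≤ n → K * (suc ⌊log₂ n ⌋ * suc ⌊log₂ n ⌋) ≤ n
  go zero    N≤n with ℕₚ.≤-trans (ℕₚ.m^n>0 2 (8 * K)) N≤n
  ... | ()
  go n@(suc _) N≤n = ℕₚ.*-cancelˡ-≤ 8 (begin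
    8 * (K * (ℓ * ℓ)) ≡⟨ solve 2 (λ K ℓ → con 8 :* (K :* (ℓ :* ℓ)) := ℓ :* ℓ :* (con 8 :* K)) refl K ℓ ⟩
    ℓ * ℓ * (8 * K)   ≤⟨ ℕₚ.*-monoʳ-≤ (ℓ * ℓ) 8K≤ℓ ⟩
    ℓ * ℓ * ℓ         ≤⟨ cube≤8*2^ ⌊log₂ n ⌋ ⟩
    8 * 2 ^ ⌊log₂ n ⌋ ≤⟨ ℕₚ.*-monoʳ-≤ 8 (2^log≤n n) ⟩
    8 * n             ∎)
    where
    open ℕₚ.≤-Reasoning
    open ℕ-+-*-Solver
    ℓ : ℕ
    ℓ = suc ⌊log₂ n ⌋
    8K≤ℓ : 8 * K ≤ ℓ
    8K≤ℓ = ℕₚ.m≤n⇒m≤1+n (subst (_≤ ⌊log₂ n ⌋) (⌊log₂[2^n]⌋≡n (8 * K)) (⌊log₂⌋-mono-≤ N≤n))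

-- Initial danger

∑-++ : ∀ {A : Set} (xs ys : List A) f → ∑ (xs ++ ys) f ≡ ∑ xs f ℚ.+ ∑ ys f
∑-++ []       ys f = sym (ℚₚ.+-identityˡ (∑ ys f))
∑-++ (x ∷ xs) ys f = trans (cong (f x ℚ.+_) (∑-++ xs ys f)) (sym (ℚₚ.+-assoc (f x) (∑ xs f) (∑ ys f)))

hit-≤-1-p : ∀ w {f t N} → 0 < N → f + t ≡ N → suc w * t ≤ w * N → hit f N ℚ.≤ 1ℚ - (ℤ.+ 1) ℚ./ suc w
hit-≤-1-p w {f} {t} {suc N} _ f+t le = ι-cancel-*ˡ w (ℚₚ.≤-trans (ι-cancel-*ˡ N scaled) (ℚₚ.≤-reflexive (sym eq)))
  where
  open +-*-Solver
  p x : ℚ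
  p = (ℤ.+ 1) ℚ./ suc w
  x = hit f (suc N)
  eq : ι (suc w) ℚ.* (1ℚ - p) ≡ ι w
  eq = trans (solve 2 (λ a p → a :* (con 1ℚ :- p) := a :- a :* p) refl (ι (suc w)) p)
    (trans (cong₂ _-_ (ι-suc w) (1/suc-inverse w)) (solve 1 (λ a → con 1ℚ :+ a :- con 1ℚ := a) refl (ι w)))
  N∸f : suc N ∸ f ≡ t
  N∸f = trans (cong (_∸ f) (sym f+t)) (ℕₚ.m+n∸m≡n f t)
  scaled : ι (suc N) ℚ.* (ι (suc w) ℚ.* x) ℚ.≤ ι (suc N) ℚ.* ι w
  scaled = subst₂ ℚ._≤_
    (trans (ι-* (suc w) t) (trans (cong (ι (suc w) ℚ.*_) (sym (trans (hit-spec f (suc N)) (cong ι N∸f))))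
      (solve 3 (λ a b c → a :* (b :* c) := b :* (a :* c)) refl (ι (suc w)) (ι (suc N)) x)))
    (trans (ι-* w (suc N)) (ℚₚ.*-comm (ι w) (ι (suc N))))
    (ι-mono le)

-- The exponent 7(w+1) is chosen so that 1 + 7(w+1) · 1/(w+1) = 8 in `pow-decay`.
hit-decay : ∀ w {f t N} → 0 < N → f + t ≡ N → suc w * t ≤ w * N → pow (hit f N) (7 * suc w) ℚ.* ι 8 ℚ.≤ 1ℚ
hit-decay w {f} {t} {N} N>0 f+t le = subst (λ z → pow (hit f N) (7 * suc w) ℚ.* z ℚ.≤ 1ℚ) eq
  (pow-decay (7 * suc w) (hit≥0 f N) (1/suc≥0 w) (hit-≤-1-p w N>0 f+t le))
  where
  p : ℚ
  p = (ℤ.+ 1) ℚ./ suc w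
  eq : 1ℚ ℚ.+ ι (7 * suc w) ℚ.* p ≡ ι 8
  eq = trans (cong (1ℚ ℚ.+_) (trans (cong (ℚ._* p) (ι-* 7 (suc w))) (trans (ℚₚ.*-assoc (ι 7) (ι (suc w)) p)
    (trans (cong (ι 7 ℚ.*_) (1/suc-inverse w)) (ℚₚ.*-identityʳ (ι 7)))))) (sym (ι-suc 7))

pow-8 : ∀ {x D} → 0ℚ ℚ.≤ x → pow x D ℚ.* ι 8 ℚ.≤ 1ℚ → ∀ e → pow x (e * D) ℚ.* ι (8 ^ e) ℚ.≤ 1ℚ
pow-8 {x} {D} 0≤x h zero    = ℚₚ.≤-reflexive (trans (ℚₚ.*-identityˡ (ι 1)) ι-1)
pow-8 {x} {D} 0≤x h (suc e) = subst₂ ℚ._≤_ (sym eq) (ℚₚ.*-identityˡ 1ℚ)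
  (*-mono₂ (*≥0 (pow≥0 D 0≤x) (ι≥0 8)) 0≤1 h (pow-8 {x} {D} 0≤x h e))
  where
  open +-*-Solver
  eq : pow x (suc e * D) ℚ.* ι (8 ^ suc e) ≡ pow x D ℚ.* ι 8 ℚ.* (pow x (e * D) ℚ.* ι (8 ^ e))
  eq = trans (cong₂ ℚ._*_ (pow-+ x D (e * D)) (ι-* 8 (8 ^ e)))
    (solve 4 (λ a b c d → a :* b :* (c :* d) := a :* c :* (b :* d)) refl (pow x D) (pow x (e * D)) (ι 8) (ι (8 ^ e)))

module _ {n : ℕ} where
  private
    N : ℕ
    N = length (allEdges n)

  threat-start : ∀ f A → threat {n} f A [] [] ≡ pow (hit f N) (count A (allEdges n))
  threat-start f A = cong₂ (λ l c → pow (hit f l) c) (cong length free≡) (cong (count A) free≡)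
    where
    free≡ : free {n} [] [] ≡ allEdges n
    free≡ = Listₚ.filter-all _ {allEdges n} (All.tabulate λ _ ())

  danger-start : ∀ {f 𝒜 z} → (∀ {A} → A ∈ 𝒜 → pow (hit f N) (count A (allEdges n)) ℚ.≤ z) → danger f 𝒜 [] [] ℚ.≤ ι (length 𝒜) ℚ.* z
  danger-start {f} {𝒜} {z} h = ℚₚ.≤-trans (∑-mono 𝒜 λ {A} A∈ → subst (ℚ._≤ z) (sym (threat-start f A)) (h A∈)) (ℚₚ.≤-reflexive (∑-const 𝒜 z))

  -- The union bound in units of D: a set with at least eD edges contributes at most 8^-e. The
  -- conclusion bounds the danger by 1/S, multiplied out.
  family-danger : ∀ {f D} e S 𝒜 → pow (hit f N) D ℚ.* ι 8 ℚ.≤ 1ℚ → (∀ {A} → A ∈ 𝒜 → e * D ≤ count A (allEdges n)) →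
    length 𝒜 * S ≤ 8 ^ e → danger f 𝒜 [] [] ℚ.* ι S ℚ.≤ 1ℚ
  family-danger {f} {D} e S 𝒜 h big few = ℚₚ.≤-trans
    (*-monoʳ (ι≥0 S) (danger-start {f} {𝒜} {z} λ A∈ → pow-anti (hit≥0 f N) (hit≤1 f N) (big A∈)))
    (ℚₚ.≤-trans (ℚₚ.≤-reflexive eq) (ℚₚ.≤-trans (*-monoˡ (pow≥0 (e * D) (hit≥0 f N)) (ι-mono few)) (pow-8 {hit f N} {D} (hit≥0 f N) h e)))
    where
    open +-*-Solver
    z : ℚ
    z = pow (hit f N) (e * D)
    eq : ι (length 𝒜) ℚ.* z ℚ.* ι S ≡ z ℚ.* ι (length 𝒜 * S)
    eq = trans (solve 3 (λ a z s → a :* z :* s := z :* (a :* s)) refl (ι (length 𝒜)) z (ι S)) (cong (z ℚ.*_) (sym (ι-* (length 𝒜) S)))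

  -- A single edge has threat t/N, where t claims precede the horizon; no power helps here, so t
  -- itself has to be small.
  singleton-danger : ∀ {f} t S 𝒜 → 0 < N → f + t ≡ N → (∀ {A} → A ∈ 𝒜 → 1 ≤ count A (allEdges n)) →
    length 𝒜 * S * t ≤ N → danger f 𝒜 [] [] ℚ.* ι S ℚ.≤ 1ℚ
  singleton-danger {f} t S 𝒜 N>0 f+t big few = ℚₚ.≤-trans
    (*-monoʳ (ι≥0 S) (danger-start {f} {𝒜} {x} λ {A} A∈ → subst (pow x (count A (allEdges n)) ℚ.≤_) (ℚₚ.*-identityʳ x)
      (pow-anti (hit≥0 f N) (hit≤1 f N) (big A∈)))) (go N refl N>0)
    where
    open +-*-Solver
    x : ℚ
    x = hit f N
    a : ℚ
    a = ι (length 𝒜)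
    go : ∀ N′ → N′ ≡ N → 0 < N′ → a ℚ.* x ℚ.* ι S ℚ.≤ 1ℚ
    go (suc N′) N≡ _ = ι-cancel-*ˡ N′ (subst₂ ℚ._≤_ (sym lhs) (sym (ℚₚ.*-identityʳ (ι (suc N′)))) (ι-mono (subst (length 𝒜 * S * t ≤_) (sym N≡) few)))
      where
      Nx : ι (suc N′) ℚ.* x ≡ ι t
      Nx = trans (cong (λ N → ι N ℚ.* x) N≡) (trans (hit-spec f N) (cong ι (trans (cong (_∸ f) (sym f+t)) (ℕₚ.m+n∸m≡n f t))))
      lhs : ι (suc N′) ℚ.* (a ℚ.* x ℚ.* ι S) ≡ ι (length 𝒜 * S * t)
      lhs = trans (solve 4 (λ m a x s → m :* (a :* x :* s) := a :* s :* (m :* x)) refl (ι (suc N′)) a x (ι S))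
        (trans (cong₂ ℚ._*_ (sym (ι-* (length 𝒜) S)) Nx) (sym (ι-* (length 𝒜 * S) t)))

-- To leading order T is n/2 and b at most mn/(m+1), which uses the share 4m/(4m+4) of the board.
-- The allowed share (4m+3)/(4m+4) leaves room for the lower-order terms.
horizon-room : ∀ m n b T x N → suc m * b ≤ m * n → T * 2 ≤ n + x → N * 2 + n ≡ n * n → (8 + 4 * x) * suc m ≤ n →
  (4 + m * 4) * (T * suc b) ≤ (3 + m * 4) * N
horizon-room m n b T x N b≤ T≤ N≡ big = ℕₚ.*-cancelʳ-≤ _ _ 2 (ℕₚ.+-cancelʳ-≤ ((3 + m * 4) * n) _ _ (begin
  (4 + m * 4) * (T * suc b) * 2 + (3 + m * 4) * n
    ≡⟨ solve 4 (λ m T b n → (con 4 :+ m :* con 4) :* (T :* (con 1 :+ b)) :* con 2 :+ (con 3 :+ m :* con 4) :* n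
         := con 4 :* (T :* con 2) :* ((con 1 :+ m) :* b :+ (con 1 :+ m)) :+ (con 3 :+ m :* con 4) :* n) refl m T b n ⟩
  4 * (T * 2) * (suc m * b + suc m) + (3 + m * 4) * n
    ≤⟨ ℕₚ.+-monoˡ-≤ _ (ℕₚ.*-mono-≤ (ℕₚ.*-monoʳ-≤ 4 T≤) (ℕₚ.+-monoˡ-≤ (suc m) b≤)) ⟩
  4 * (n + x) * (m * n + suc m) + (3 + m * 4) * n
    ≡⟨ solve 3 (λ m n x → con 4 :* (n :+ x) :* (m :* n :+ (con 1 :+ m)) :+ (con 3 :+ m :* con 4) :* n
         := con 4 :* (m :* (n :* n)) :+ ((con 7 :+ con 8 :* m) :* n :+ con 4 :* x :* m :* n :+ con 4 :* x :* (con 1 :+ m))) refl m n x ⟩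
  4 * (m * (n * n)) + ((7 + 8 * m) * n + 4 * x * m * n + 4 * x * suc m)
    ≤⟨ ℕₚ.+-monoʳ-≤ (4 * (m * (n * n))) (ℕₚ.+-monoʳ-≤ ((7 + 8 * m) * n + 4 * x * m * n) (ℕₚ.≤-trans (ℕₚ.*-monoʳ-≤ (4 * x) 1+m≤n) (ℕₚ.m≤m+n _ n))) ⟩
  4 * (m * (n * n)) + ((7 + 8 * m) * n + 4 * x * m * n + (4 * x * n + n))
    ≡⟨ solve 3 (λ m n x → con 4 :* (m :* (n :* n)) :+ ((con 7 :+ con 8 :* m) :* n :+ con 4 :* x :* m :* n :+ (con 4 :* x :* n :+ n))
         := con 4 :* (m :* (n :* n)) :+ (con 8 :+ con 4 :* x) :* (con 1 :+ m) :* n) refl m n x ⟩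
  4 * (m * (n * n)) + (8 + 4 * x) * suc m * n
    ≤⟨ ℕₚ.+-monoʳ-≤ (4 * (m * (n * n))) (ℕₚ.≤-trans (ℕₚ.*-monoˡ-≤ n big) (ℕₚ.m≤n*m (n * n) 3)) ⟩
  4 * (m * (n * n)) + 3 * (n * n)
    ≡⟨ solve 2 (λ m q → con 4 :* (m :* q) :+ con 3 :* q := (con 3 :+ m :* con 4) :* q) refl m (n * n) ⟩
  (3 + m * 4) * (n * n) ≡⟨ cong ((3 + m * 4) *_) (sym N≡) ⟩
  (3 + m * 4) * (N * 2 + n)
    ≡⟨ solve 3 (λ w N n → w :* (N :* con 2 :+ n) := w :* N :* con 2 :+ w :* n) refl (3 + m * 4) N n ⟩
  (3 + m * 4) * N * 2 + (3 + m * 4) * n ∎))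
  where
  open ℕₚ.≤-Reasoning
  open ℕ-+-*-Solver
  1+m≤n : suc m ≤ n
  1+m≤n = ℕₚ.≤-trans (ℕₚ.m≤n*m (suc m) (8 + 4 * x)) big

gadget-room : ∀ g G s β n N → g ≤ G → β ≤ n → N * 2 + n ≡ n * n → 2 * (G * G) * s + 1 ≤ n → g * s * (g * β) ≤ N
gadget-room g G s β n N g≤ β≤ N≡ big = ℕₚ.*-cancelʳ-≤ _ _ 2 (ℕₚ.+-cancelʳ-≤ n _ _ (begin
  g * s * (g * β) * 2 + n ≤⟨ ℕₚ.+-monoˡ-≤ n (ℕₚ.*-monoˡ-≤ 2 (ℕₚ.*-mono-≤ (ℕₚ.*-monoˡ-≤ s g≤) (ℕₚ.*-mono-≤ g≤ β≤))) ⟩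
  G * s * (G * n) * 2 + n ≡⟨ solve 3 (λ G s n → G :* s :* (G :* n) :* con 2 :+ n := (con 2 :* (G :* G) :* s :+ con 1) :* n) refl G s n ⟩
  (2 * (G * G) * s + 1) * n ≤⟨ ℕₚ.*-monoˡ-≤ n big ⟩
  n * n ≡⟨ sym N≡ ⟩
  N * 2 + n ∎))
  where
  open ℕₚ.≤-Reasoning
  open ℕ-+-*-Solver

-- Choice of the parameters and the three error terms

Won-mono : ∀ {n T T′} {o : Outcome n} → T ≤ T′ → Won T o → Won T′ o
Won-mono T≤T′ (leg , M₀ , ext , short , won) = leg , M₀ , ext , ℕₚ.≤-trans short T≤T′ , won

-- Per unit of ℓ = 1 + log n, 16D² bounds the gadget edges and D is half the allowance for
-- attachments. The factor 2 serves twice: for the bound on 2T, and for ℓ ≤ 2 log n in the bound on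
-- T.
overhead : ℕ → ℕ
overhead D = 2 * (16 * (D * D) + D)

module Estimate (m n : ℕ) .{{_ : NonZero n}} (b s D : ℕ) (D≡ : D ≡ 7 * (4 + m * 4)) (b≤ : suc m * b ≤ m * n)
  (s≤n : s ≤ n) (2≤n : 2 ≤ n) (R-room : 8 * (D * D) * suc ⌊log₂ n ⌋ ≤ n)
  (x-room : (8 + 4 * (overhead D * suc ⌊log₂ n ⌋)) * suc m ≤ n)
  (G-room : 2 * (16 * (D * D) * suc ⌊log₂ n ⌋ * (16 * (D * D) * suc ⌊log₂ n ⌋)) * s + 1 ≤ n) where

  private
    ℓ G x : ℕ
    ℓ = suc ⌊log₂ n ⌋
    G = 16 * (D * D) * ℓ
    x = overhead D * ℓ

  -- With k = Dℓ the k² edges between two halves amount to ℓk units of D, enough to outweigh the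
  -- n^(2k) choices of the halves.
  k : ℕ
  k = D * ℓ

  open Clever n k D

  private
    g N T : ℕ
    g = length gadget
    N = length (allEdges n)
    T = g + (n / 2 + k)

    D>0 : 1 ≤ D
    D>0 = subst (1 ≤_) (sym D≡) (s≤s z≤n)

    ℓ≤k : ℓ ≤ k
    ℓ≤k = subst (_≤ k) (ℕₚ.*-identityˡ ℓ) (ℕₚ.*-monoˡ-≤ ℓ D>0)

    R≡ : R ≡ 8 * (D * D) * ℓ
    R≡ = solve 2 (λ D ℓ → con 2 :* ((D :* ℓ :+ D :* ℓ :+ (D :* ℓ :+ D :* ℓ)) :* D) := con 8 :* (D :* D) :* ℓ) refl D ℓ
      where open ℕ-+-*-Solver

    R≤n : R ≤ n
    R≤n = subst (_≤ n) (sym R≡) R-room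

    1<R : 1 < R
    1<R = subst (1 <_) (sym R≡) (ℕₚ.≤-trans (ℕₚ.m≤m+n 2 6) (ℕₚ.*-mono-≤ {8} {8 * (D * D)} {1} {ℓ}
      (ℕₚ.*-monoʳ-≤ 8 (ℕₚ.*-mono-≤ D>0 D>0)) (s≤s z≤n)))

    g≤G : g ≤ G
    g≤G = ℕₚ.≤-trans length-gadget (ℕₚ.≤-reflexive (trans (cong (_* 2) R≡)
      (solve 2 (λ d ℓ → con 8 :* d :* ℓ :* con 2 := con 16 :* d :* ℓ) refl (D * D) ℓ)))
      where open ℕ-+-*-Solver

    N-spec : N * 2 + n ≡ n * n
    N-spec = length-allEdges n

    N>0 : 0 < N
    N>0 = ℕₚ.n≢0⇒n>0 λ N≡0 → ℕₚ.<-irrefl (trans (cong (λ N → N * 2 + n) (sym N≡0)) N-spec)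
      (ℕₚ.<-≤-trans (subst (_< n + n) (ℕₚ.+-identityʳ n) (ℕₚ.+-monoʳ-< n (ℕₚ.≤-trans (s≤s z≤n) 2≤n)))
        (subst (_≤ n * n) (cong (n +_) (ℕₚ.+-identityʳ n)) (ℕₚ.*-monoˡ-≤ n 2≤n)))

    T*2≤ : T * 2 ≤ n + x
    T*2≤ = begin
      T * 2                             ≡⟨ solve 3 (λ g a k → (g :+ (a :+ k)) :* con 2 := a :* con 2 :+ (g :* con 2 :+ k :* con 2)) refl g (n / 2) k ⟩
      n / 2 * 2 + (g * 2 + k * 2)       ≤⟨ ℕₚ.+-mono-≤ (DivMod.m/n*n≤m n 2) (ℕₚ.+-monoˡ-≤ (k * 2) (ℕₚ.*-monoˡ-≤ 2 g≤G)) ⟩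
      n + (G * 2 + k * 2)               ≡⟨ cong (n +_) (solve 2 (λ D ℓ → con 16 :* (D :* D) :* ℓ :* con 2 :+ D :* ℓ :* con 2 := con 2 :* (con 16 :* (D :* D) :+ D) :* ℓ) refl D ℓ) ⟩
      n + x                             ∎
      where
      open ℕₚ.≤-Reasoning
      open ℕ-+-*-Solver

    T-spec : ∀ {l} → l * 2 ≤ n + h → g + l ≤ T
    T-spec {l} l*2≤ = ℕₚ.+-monoʳ-≤ g (begin
      l               ≡⟨ sym (DivMod.m*n/n≡m l 2) ⟩
      l * 2 / 2       ≤⟨ DivMod./-monoˡ-≤ 2 l*2≤ ⟩
      (n + h) / 2     ≡⟨ cong (λ z → (n + z) / 2) (solve 1 (λ k → k :+ k := k :* con 2) refl k) ⟩
      (n + k * 2) / 2 ≡⟨ DivMod.+-distrib-/-∣ʳ n (divides k refl) ⟩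
      n / 2 + k * 2 / 2 ≡⟨ cong (n / 2 +_) (DivMod.m*n/n≡m k 2) ⟩
      n / 2 + k       ∎)
      where
      open ℕₚ.≤-Reasoning
      open ℕ-+-*-Solver

    T≤ : T ≤ n / 2 + overhead D * ⌊log₂ n ⌋
    T≤ = begin
      T                                     ≤⟨ ℕₚ.+-monoˡ-≤ (n / 2 + k) g≤G ⟩
      G + (n / 2 + k)                       ≡⟨ solve 3 (λ D ℓ a → con 16 :* (D :* D) :* ℓ :+ (a :+ D :* ℓ) := a :+ (con 16 :* (D :* D) :+ D) :* ℓ) refl D ℓ (n / 2) ⟩
      n / 2 + (16 * (D * D) + D) * ℓ        ≤⟨ ℕₚ.+-monoʳ-≤ (n / 2) (ℕₚ.*-monoʳ-≤ (16 * (D * D) + D) (ℕₚ.+-monoˡ-≤ ⌊log₂ n ⌋ 1≤log)) ⟩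
      n / 2 + (16 * (D * D) + D) * (⌊log₂ n ⌋ + ⌊log₂ n ⌋)
        ≡⟨ cong (n / 2 +_) (solve 2 (λ a l → a :* (l :+ l) := con 2 :* a :* l) refl (16 * (D * D) + D) ⌊log₂ n ⌋) ⟩
      n / 2 + overhead D * ⌊log₂ n ⌋        ∎
      where
      open ℕₚ.≤-Reasoning
      open ℕ-+-*-Solver
      1≤log : 1 ≤ ⌊log₂ n ⌋
      1≤log = ⌊log₂⌋-mono-≤ 2≤n

    room : (4 + m * 4) * (T * suc b) ≤ (3 + m * 4) * N
    room = horizon-room m n b T x N b≤ T*2≤ N-spec x-room

    Tβ≤N : T * suc b ≤ N
    Tβ≤N = ℕₚ.*-cancelˡ-≤ (4 + m * 4) (ℕₚ.≤-trans room (ℕₚ.*-monoˡ-≤ N (ℕₚ.n≤1+n (3 + m * 4))))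

    gβ≤N : g * suc b ≤ N
    gβ≤N = ℕₚ.≤-trans (ℕₚ.*-monoˡ-≤ (suc b) (ℕₚ.m≤m+n g _)) Tβ≤N

    f f₁ : ℕ
    f  = N ∸ T * suc b
    f₁ = N ∸ g * suc b

    f-spec : f + T * suc b ≡ N
    f-spec = ℕₚ.m∸n+n≡m Tβ≤N

    f₁-spec : f₁ + g * suc b ≡ N
    f₁-spec = ℕₚ.m∸n+n≡m gβ≤N

    b<n : suc b ≤ n
    b<n = ℕₚ.*-cancelˡ-< (suc m) b n (ℕₚ.≤-<-trans b≤ (ℕₚ.m<n+m (m * n) (ℕₚ.≤-trans (s≤s z≤n) 2≤n)))

    decay : pow (hit f N) D ℚ.* ι 8 ℚ.≤ 1ℚ
    decay = subst (λ D → pow (hit f N) D ℚ.* ι 8 ℚ.≤ 1ℚ) (sym D≡) (hit-decay (3 + m * 4) N>0 f-spec room)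

    n≤2^ℓ : n ≤ 2 ^ ℓ
    n≤2^ℓ = ℕₚ.<⇒≤ (n<2^[1+log] n)

    coarsen : ∀ d → 0ℚ ℚ.≤ d → d ℚ.* ι (2 ^ ℓ) ℚ.≤ 1ℚ → d ℚ.* ι s ℚ.≤ 1ℚ
    coarsen d 0≤d h = ℚₚ.≤-trans (*-monoˡ 0≤d (ι-mono (ℕₚ.≤-trans s≤n n≤2^ℓ))) h

    nonneg : ∀ f (𝒜 : List (Edge n → Bool)) → 0ℚ ℚ.≤ danger f 𝒜 [] []
    nonneg f 𝒜 = Potential.nonneg (danger-potential f 𝒜) [] []

    8^≡ : ∀ e → 8 ^ e ≡ 2 ^ (3 * e)
    8^≡ e = ℕₚ.^-*-assoc 2 3 e

    -- At most 2^(2ℓk) sets face 8^(ℓk) = 2^(3ℓk), which leaves a factor of at least 2^ℓ.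
    halves-danger : danger f halvesFamily [] [] ℚ.* ι s ℚ.≤ 1ℚ
    halves-danger = coarsen (danger f halvesFamily [] []) (nonneg f halvesFamily) (family-danger {n} {f} {D} (ℓ * k) (2 ^ ℓ) halvesFamily decay big few)
      where
      big : ∀ {A} → A ∈ halvesFamily → ℓ * k * D ≤ count A (allEdges n)
      big A∈ with ∈ₚ.∈-map⁻ halves A∈
      ... | S , S∈ , refl = ℕₚ.≤-trans (ℕₚ.≤-reflexive (solve 3 (λ ℓ k D → ℓ :* k :* D := D :* ℓ :* k) refl ℓ k D)) (count-halves R≤n S∈)
        where open ℕ-+-*-Solver
      few : length halvesFamily * 2 ^ ℓ ≤ 8 ^ (ℓ * k)
      few = begin
        length halvesFamily * 2 ^ ℓ          ≡⟨ cong (_* 2 ^ ℓ) (Listₚ.length-map halves (choose h (allFin n))) ⟩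
        length (choose h (allFin n)) * 2 ^ ℓ ≤⟨ ℕₚ.*-monoˡ-≤ (2 ^ ℓ) (ℕₚ.≤-trans (length-choose-≤^ h (allFin n))
                                                  (ℕₚ.^-monoˡ-≤ h (subst (_≤ 2 ^ ℓ) (sym (Listₚ.length-tabulate {n = n} id)) n≤2^ℓ))) ⟩
        (2 ^ ℓ) ^ h * 2 ^ ℓ                  ≡⟨ cong (_* 2 ^ ℓ) (ℕₚ.^-*-assoc 2 ℓ h) ⟩
        2 ^ (ℓ * h) * 2 ^ ℓ                  ≡⟨ sym (ℕₚ.^-distribˡ-+-* 2 (ℓ * h) ℓ) ⟩
        2 ^ (ℓ * h + ℓ)                      ≤⟨ ℕₚ.^-monoʳ-≤ 2 (ℕₚ.+-monoʳ-≤ (ℓ * h) (subst (_≤ ℓ * k) (ℕₚ.*-identityʳ ℓ) (ℕₚ.*-monoʳ-≤ ℓ (ℕₚ.≤-trans (s≤s z≤n) ℓ≤k)))) ⟩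
        2 ^ (ℓ * h + ℓ * k)                  ≡⟨ cong (2 ^_) (solve 2 (λ ℓ k → ℓ :* (k :+ k) :+ ℓ :* k := con 3 :* (ℓ :* k)) refl ℓ k) ⟩
        2 ^ (3 * (ℓ * k))                    ≡⟨ sym (8^≡ (ℓ * k)) ⟩
        8 ^ (ℓ * k)                          ∎
        where
        open ℕₚ.≤-Reasoning
        open ℕ-+-*-Solver

    -- At most 2^(ℓ + 4k) stars face 8^h = 2^(6k), and ℓ ≤ k leaves a factor of at least 2^ℓ.
    star-danger : danger f starFamily [] [] ℚ.* ι s ℚ.≤ 1ℚ
    star-danger = coarsen (danger f starFamily [] []) (nonneg f starFamily) (family-danger {n} {f} {D} h (2 ^ ℓ) starFamily decay big few)
      where
      big : ∀ {A} → A ∈ starFamily → h * D ≤ count A (allEdges n)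
      big A∈ with ∈ₚ.∈-map⁻ star A∈
      ... | p , p∈ , refl = count-star R≤n p∈
      few : length starFamily * 2 ^ ℓ ≤ 8 ^ h
      few = begin
        length starFamily * 2 ^ ℓ ≡⟨ cong (_* 2 ^ ℓ) (trans (Listₚ.length-map star (cartesianProduct outside (choose h blocks)))
                                       (length-cartesianProduct outside (choose h blocks))) ⟩
        length outside * length (choose h blocks) * 2 ^ ℓ
          ≤⟨ ℕₚ.*-monoˡ-≤ (2 ^ ℓ) (ℕₚ.*-mono-≤
               (ℕₚ.≤-trans (Listₚ.length-filter isOutside? (allFin n)) (subst (_≤ 2 ^ ℓ) (sym (Listₚ.length-tabulate {n = n} id)) n≤2^ℓ))
               (ℕₚ.≤-trans (length-choose-≤2^ h blocks) (ℕₚ.≤-reflexive (cong (2 ^_) (length-chunks r D slots))))) ⟩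
        2 ^ ℓ * 2 ^ r * 2 ^ ℓ     ≡⟨ cong (_* 2 ^ ℓ) (sym (ℕₚ.^-distribˡ-+-* 2 ℓ r)) ⟩
        2 ^ (ℓ + r) * 2 ^ ℓ       ≡⟨ sym (ℕₚ.^-distribˡ-+-* 2 (ℓ + r) ℓ) ⟩
        2 ^ (ℓ + r + ℓ)           ≤⟨ ℕₚ.^-monoʳ-≤ 2 (ℕₚ.+-mono-≤ (ℕₚ.+-monoˡ-≤ r ℓ≤k) ℓ≤k) ⟩
        2 ^ (k + r + k)           ≡⟨ cong (2 ^_) (solve 1 (λ k → k :+ (k :+ k :+ (k :+ k)) :+ k := con 3 :* (k :+ k)) refl k) ⟩
        2 ^ (3 * h)               ≡⟨ sym (8^≡ h) ⟩
        8 ^ h                     ∎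
        where
        open ℕₚ.≤-Reasoning
        open ℕ-+-*-Solver

    -- With g edges of threat g(b+1)/N each, this is the term of order log² n / n.
    gadget-danger : danger f₁ gadgetFamily [] [] ℚ.* ι s ℚ.≤ 1ℚ
    gadget-danger = singleton-danger {n} {f₁} (g * suc b) s gadgetFamily N>0 f₁-spec big
      (subst (λ l → l * s * (g * suc b) ≤ N) (sym (Listₚ.length-map _ gadget)) (gadget-room g G s (suc b) n N g≤G b<n N-spec G-room))
      where
      big : ∀ {A} → A ∈ gadgetFamily → 1 ≤ count A (allEdges n)
      big A∈ with ∈ₚ.∈-map⁻ (λ e x → ⌊ x ≟E e ⌋) A∈
      ... | e , e∈ , refl = count-filter-≥ (λ x → ⌊ x ≟E e ⌋) {zs = e ∷ []} ([] ∷ [])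
              (λ { (here refl) → proj₁ (∈ₚ.∈-filter⁻ inGadget? {xs = allEdges n} e∈) }) (λ { (here refl) → same })
        where
        same : ⌊ e ≟E e ⌋ ≡ true
        same with e ≟E e
        ... | yes _ = refl
        ... | no e≢ = ⊥-elim (e≢ refl)

  failure : ℚ
  failure = danger f₁ gadgetFamily [] [] ℚ.+ danger f family [] []

  failure-small : failure ℚ.* ι s ℚ.≤ ι 3
  failure-small = subst₂ ℚ._≤_ (sym eq) three (ℚₚ.+-mono-≤ gadget-danger (ℚₚ.+-mono-≤ halves-danger star-danger))
    where
    a u v : ℚ
    a = danger f₁ gadgetFamily [] []
    u = danger f halvesFamily [] []
    v = danger f starFamily [] []
    eq : failure ℚ.* ι s ≡ a ℚ.* ι s ℚ.+ (u ℚ.* ι s ℚ.+ v ℚ.* ι s)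
    eq = trans (cong (λ z → (a ℚ.+ z) ℚ.* ι s) (∑-++ halvesFamily starFamily (λ A → threat f A [] [])))
      (trans (ℚₚ.*-distribʳ-+ (ι s) a (u ℚ.+ v)) (cong (a ℚ.* ι s ℚ.+_) (ℚₚ.*-distribʳ-+ (ι s) u v)))
    three : 1ℚ ℚ.+ (1ℚ ℚ.+ 1ℚ) ≡ ι 3
    three = sym (trans (ι-suc 2) (cong (1ℚ ℚ.+_) (trans (ι-suc 1) (cong (1ℚ ℚ.+_) ι-1))))

  Pr-quick : PrAtLeast (game n b strategy) (Won (n / 2 + overhead D * ⌊log₂ n ⌋)) (1ℚ - failure)
  Pr-quick = Pr-map (λ {o} → Won-mono {o = o} T≤) (Play.Pr-won n k D b R≤n 1<R f-spec f₁-spec T-spec)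

-- D depends on ε alone, so one strategy serves every δ; δ affects only how large n must be.
clever : ℕ → ∀ n → Strategy n
clever D zero      = λ _ _ → nothing
clever D n@(suc _) = Clever.strategy n (D * suc ⌊log₂ n ⌋) D

module _ (m D : ℕ) (D≡ : D ≡ 7 * (4 + m * 4)) {ε : ℚ} (1≤mε : 1ℚ ℚ.≤ ι (suc m) ℚ.* ε) {δ : ℚ} {d : ℕ} (1≤dδ : 1ℚ ℚ.≤ ι (suc d) ℚ.* δ) where
  private
    s A₁ A₂ A₃ : ℕ
    -- Each of the three families contributes at most 1/s, in total 1/(d+1) ≤ δ.
    s  = 3 * suc d
    A₁ = 8 * (D * D)
    A₂ = (8 + 4 * overhead D) * suc m
    A₃ = 2 * (16 * (D * D) * (16 * (D * D))) * s + 1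

  -- Every size condition has the form A ℓ² ≤ n up to rounding, so the sum of the coefficients
  -- covers all of them.
  threshold : ℕ
  threshold = s + (2 + (A₁ + (A₂ + A₃)))

  clever-wins-large : ∀ n .{{_ : NonZero n}} → threshold * (suc ⌊log₂ n ⌋ * suc ⌊log₂ n ⌋) ≤ n →
    PrAtLeast (game n (biasDown ε n) (Clever.strategy n (D * suc ⌊log₂ n ⌋) D)) (Won (n / 2 + overhead D * ⌊log₂ n ⌋)) (1ℚ - δ)
  clever-wins-large n total = Pr-weaken (1-mono failure≤δ) Pr-quick
    where
    open ℕ-+-*-Solver
    ℓ : ℕ
    ℓ = suc ⌊log₂ n ⌋
    part : ∀ {A} → A ≤ threshold → A * (ℓ * ℓ) ≤ n
    part A≤ = ℕₚ.≤-trans (ℕₚ.*-monoˡ-≤ (ℓ * ℓ) A≤) total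
    once : ∀ A → A ≤ A * (ℓ * ℓ)
    once A = ℕₚ.m≤m*n A (ℓ * ℓ)
    ℓ≤ℓℓ : ℓ ≤ ℓ * ℓ
    ℓ≤ℓℓ = ℕₚ.m≤m*n ℓ ℓ
    s≤ : s ≤ threshold
    s≤ = ℕₚ.m≤m+n s _
    2≤ : 2 ≤ threshold
    2≤ = ℕₚ.≤-trans (ℕₚ.m≤m+n 2 _) (ℕₚ.m≤n+m _ s)
    A₁≤ : A₁ ≤ threshold
    A₁≤ = ℕₚ.≤-trans (ℕₚ.m≤m+n A₁ _) (ℕₚ.≤-trans (ℕₚ.m≤n+m _ 2) (ℕₚ.m≤n+m _ s))
    A₂≤ : A₂ ≤ threshold
    A₂≤ = ℕₚ.≤-trans (ℕₚ.m≤m+n A₂ A₃) (ℕₚ.≤-trans (ℕₚ.m≤n+m _ A₁) (ℕₚ.≤-trans (ℕₚ.m≤n+m _ 2) (ℕₚ.m≤n+m _ s)))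
    A₃≤ : A₃ ≤ threshold
    A₃≤ = ℕₚ.≤-trans (ℕₚ.m≤n+m A₃ A₂) (ℕₚ.≤-trans (ℕₚ.m≤n+m _ A₁) (ℕₚ.≤-trans (ℕₚ.m≤n+m _ 2) (ℕₚ.m≤n+m _ s)))
    x-room : (8 + 4 * (overhead D * ℓ)) * suc m ≤ n
    x-room = ℕₚ.≤-trans (ℕₚ.≤-trans (ℕₚ.*-monoˡ-≤ (suc m) (ℕₚ.+-monoˡ-≤ (4 * (overhead D * ℓ)) (ℕₚ.m≤m*n 8 ℓ)))
      (ℕₚ.≤-trans (ℕₚ.≤-reflexive (solve 3 (λ C ℓ μ → (con 8 :* ℓ :+ con 4 :* (C :* ℓ)) :* μ := (con 8 :+ con 4 :* C) :* μ :* ℓ) refl (overhead D) ℓ (suc m)))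
        (ℕₚ.*-monoʳ-≤ A₂ ℓ≤ℓℓ))) (part A₂≤)
    G-room : 2 * (16 * (D * D) * ℓ * (16 * (D * D) * ℓ)) * s + 1 ≤ n
    G-room = ℕₚ.≤-trans (ℕₚ.≤-trans (ℕₚ.+-monoʳ-≤ (2 * (16 * (D * D) * ℓ * (16 * (D * D) * ℓ)) * s) (s≤s z≤n))
      (ℕₚ.≤-reflexive (solve 3 (λ G ℓ s → con 2 :* (G :* ℓ :* (G :* ℓ)) :* s :+ ℓ :* ℓ := (con 2 :* (G :* G) :* s :+ con 1) :* (ℓ :* ℓ)) refl (16 * (D * D)) ℓ s)))
      (part A₃≤)
    open Estimate m n (biasDown ε n) s D D≡ (biasDown-≤ ε m n 1≤mε) (ℕₚ.≤-trans (once s) (part s≤)) (ℕₚ.≤-trans (once 2) (part 2≤))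
      (ℕₚ.≤-trans (ℕₚ.*-monoʳ-≤ A₁ ℓ≤ℓℓ) (part A₁≤)) x-room G-room
    failure≤δ : failure ℚ.≤ δ
    failure≤δ = ι-cancel-*ˡ (d + 2 * suc d) (ℚₚ.≤-trans (ℚₚ.≤-reflexive (ℚₚ.*-comm (ι s) failure)) (ℚₚ.≤-trans failure-small
      (subst₂ ℚ._≤_ (ℚₚ.*-identityʳ (ι 3)) (trans (sym (ℚₚ.*-assoc (ι 3) (ι (suc d)) δ)) (cong (ℚ._* δ) (sym (ι-* 3 (suc d)))))
        (*-monoˡ (ι≥0 3) 1≤dδ))))

  clever-wins : ∃ λ N₀ → ∀ n → N₀ ≤ n →
    PrAtLeast (game n (biasDown ε n) (clever D n)) (Won (n / 2 + overhead D * ⌊log₂ n ⌋)) (1ℚ - δ)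
  clever-wins with log²-small threshold
  ... | N₀ , large = N₀ , go
    where
    go : ∀ n → N₀ ≤ n → PrAtLeast (game n (biasDown ε n) (clever D n)) (Won (n / 2 + overhead D * ⌊log₂ n ⌋)) (1ℚ - δ)
    go zero      N₀≤n with large zero N₀≤n
    ... | ()
    go n@(suc _) N₀≤n = clever-wins-large n (large n N₀≤n)

maker-wins : ∀ ε → 0ℚ ℚ.< ε → Σ (∀ n → Strategy n) λ σ → Σ ℕ λ C → ∀ δ → 0ℚ ℚ.< δ → ∃ λ N₀ → ∀ n → N₀ ≤ n →
  PrAtLeast (game n (biasDown ε n) (σ n)) (Won (n / 2 + C * ⌊log₂ n ⌋)) (1ℚ - δ)
maker-wins ε ε>0 with reciprocal-below ε ε>0
... | m , 1≤mε = clever D , overhead D , λ δ δ>0 → let d , 1≤dδ = reciprocal-below δ δ>0 in clever-wins m D refl {ε} 1≤mε {δ} {d} 1≤dδ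
  where
  D : ℕ
  D = 7 * (4 + m * 4)

-- From quick wins to the two sharp thresholds

take-++-⊇ : ∀ {A : Set} {t} (xs ys : List A) → length xs ≤ t → ∀ {x} → x ∈ xs → x ∈ take t (xs ++ ys)
take-++-⊇ (x ∷ xs) ys (s≤s len≤) (here eq)  = here eq
take-++-⊇ (x ∷ xs) ys (s≤s len≤) (there x∈) = there (take-++-⊇ xs ys len≤ x∈)

HasPerfectMatching-mono : ∀ {n G H} → (∀ {e} → e ∈ G → e ∈ H) → HasPerfectMatching n G → HasPerfectMatching n H
HasPerfectMatching-mono G⊆H (Mt , Mt⊆G , rest) = Mt , All.map G⊆H Mt⊆G , rest

Won⇒quick : ∀ {n T} → 2 ∣ n → {o : Outcome n} → Won T o → legal o ≡ true × HasPerfectMatching n (take T (maker o))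
Won⇒quick 2∣n (leg , M₀ , (rest , refl) , short , _ , pm) = leg , HasPerfectMatching-mono (take-++-⊇ M₀ rest short) (pm 2∣n)

Won⇒MakerWinsPM : ∀ {n T} → 2 ∣ n → {o : Outcome n} → Won T o → MakerWinsPM n o
Won⇒MakerWinsPM 2∣n (leg , M₀ , (rest , refl) , _ , _ , pm) = leg , HasPerfectMatching-mono ∈ₚ.∈-++⁺ˡ (pm 2∣n)

Won⇒MakerWinsMinDeg1 : ∀ {n T} {o : Outcome n} → Won T o → MakerWinsMinDeg1 n o
Won⇒MakerWinsMinDeg1 (leg , M₀ , (rest , refl) , _ , deg , _) = leg , λ v → Anyₚ.++⁺ˡ (deg v)

-- Covers both games: Breaker's side needs only that a win forces minimum degree one, Maker's side
-- only that `Won` implies a win on the domain.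
sharp-threshold : ∀ {Dom : ℕ → Set} {Win : ∀ n → Outcome n → Set} →
  (∀ {n o} → Win n o → MinDegreeOne n (maker o)) → (∀ {n T} → Dom n → {o : Outcome n} → Won T o → Win n o) →
  SharpThreshold Dom Win id
sharp-threshold {Dom} {Win} win⇒deg won⇒win ε ε>0 = breaker-side , maker-side (maker-wins ε ε>0)
  where
  breaker-side : (σ : ∀ n → Strategy n) → ∀ δ → 0ℚ ℚ.< δ → ∃ λ N → ∀ n → N ≤ n → Dom n →
    PrAtLeast (game n (biasUp ε n) (σ n)) (λ o → ¬ Win n o) (1ℚ - δ)
  breaker-side σ δ δ>0 with breaker-wins {Win} (λ {n} {o} → win⇒deg {n} {o}) ε ε>0 σ δ δ>0
  ... | N , wins = N , λ n N≤n _ → wins n N≤n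
  maker-side : _ → Σ (∀ n → Strategy n) λ σ → ∀ δ → 0ℚ ℚ.< δ → ∃ λ N → ∀ n → N ≤ n → Dom n →
    PrAtLeast (game n (biasDown ε n) (σ n)) (Win n) (1ℚ - δ)
  maker-side (σ , C , wins) = σ , λ δ δ>0 → let N , w = wins δ δ>0 in N , λ n N≤n dom → Pr-map (λ {o} → won⇒win dom {o}) (w n N≤n)

theorem1 : (∀ (ε : ℚ) → 0ℚ ℚ.< ε →
    Σ ((n : ℕ) → Strategy n) λ σ → Σ ℕ λ C →
    ∀ (δ : ℚ) → 0ℚ ℚ.< δ → ∃ λ N → ∀ (n : ℕ) → N ≤ n → 2 ∣ n →
    PrAtLeast (game n (biasDown ε n) (σ n))
    (λ o → legal o ≡ true ×
    HasPerfectMatching n (take (n / 2 + C * ⌊log₂ n ⌋) (maker o)))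
    (1ℚ - δ))
    × SharpThreshold (λ n → 2 ∣ n) MakerWinsPM (λ n → n)
    × SharpThreshold (λ _ → ⊤) MakerWinsMinDeg1 (λ n → n)
theorem1 =
    (λ ε ε>0 → let σ , C , wins = maker-wins ε ε>0 in σ , C , λ δ δ>0 →
      let N , w = wins δ δ>0 in N , λ n N≤n 2∣n → Pr-map (λ {o} → Won⇒quick 2∣n {o}) (w n N≤n))
  , sharp-threshold (λ {n} {o} (_ , pm) → HasPerfectMatching⇒MinDegreeOne pm) (λ 2∣n {o} → Won⇒MakerWinsPM 2∣n {o})
  , sharp-threshold (λ {n} {o} (_ , deg) → deg) (λ _ {o} → Won⇒MakerWinsMinDeg1 {o = o})
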